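{- The theory $\mathrm{RCA}_0^{\Omega}+\mathrm{STP}$ proves $(S^2)^{\mathrm{st}}\leftrightarrow(\mathrm{RB})$, where $(\mathrm{RB})$ is the statement: there is a standard functional $\Phi^{1\to1}$ such that for all standard $f^1$ and all $M\in\Omega$, $$(\forall g^{0}\leq_{0^{*}}\overline{\Phi(f)}M)(\exists x^{0}\leq M)(f(\overline{g}x)=0)\leftrightarrow(\forall g^{1})(\exists x^{0})(f(\overline{g}x)=0).$$
   Context: BASE THEORY. Finite types: $0$ (natural numbers), $\sigma\to\tau$, and $\sigma^{*}$ (finite sequences of objects of type $\sigma$); $1=0\to 0$, $2=1\to 0$, $3=2\to 0$. Superscripts indicate types; tuples are coded as single objects where convenient. Equality $=_0$ is primitive; for $\tau=\tau_1\to\dots\to\tau_k\to 0$, $x=_\tau y$ means $(\forall z_1\dots z_k)(xz_1\dots z_k=_0 yz_1\dots z_k)$. $\mathrm{RCA}_0^{\omega}$ is Kohlenbach's higher-order base theory: classical arithmetic in all finite types with combinators, zero, successor, the recursor $R_0$ (primitive recursion with type $0$ values), quantifier-free induction, extensionality $x=_\rho y\to\varphi(x)=_\tau\varphi(y)$ for all $\varphi^{\rho\to\tau}$, and $\mathrm{QF\text{ - }AC}^{1,0}$, where $\mathrm{QF\text{ - }AC}^{\sigma,\tau}$ is $(\forall x^\sigma)(\exists y^\tau)A_0(x,y)\to(\exists F^{\sigma\to\tau})(\forall x)A_0(x,F(x))$ for quantifier-free $A_0$. $\mathrm{RCA}_0^{\Omega}$ extends $\mathrm{RCA}_0^{\omega}$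 (with the types $\sigma^*$) by a predicate $\mathrm{st}$ ("is standard") for each type. A formula is internal if it does not contain $\mathrm{st}$; $(\forall^{\mathrm{st}}x)A$ is $(\forall x)(\mathrm{st}(x)\to A)$, $(\exists^{\mathrm{st}}x)A$ is $(\exists x)(\mathrm{st}(x)\wedge A)$; $N\in\Omega$ means $\neg\mathrm{st}(N^0)$; $A^{\mathrm{st}}$ is $A$ with all quantifiers (except bounded number quantifiers) relativised to $\mathrm{st}$. Axioms: (i) standardness respects equality, closed terms are standard, a standard functional applied to a standard object is standard, and numbers below a standard number are standard; (ii) Idealization: $(\forall^{\mathrm{st}}x^{\sigma^*})(\exists y^\tau)(\forall z\in x)\varphi(z,y)\to(\exists y)(\forall^{\mathrm{st}}z^{\sigma})\varphi(z,y)$ for internal $\varphi$; (iii) $\mathrm{HAC}_{\mathrm{int}}$: $(\forall^{\mathrm{st}}x^{\rho})(\exists^{\mathrm{st}}y^{\tau})\varphi(x,y)\to(\exists^{\mathrm{st}}\Phi^{\rho\to\tau^*})(\forall^{\mathrm{st}}x)(\exists y\in\Phi(x))\varphi(x,y)$ for internal $\varphi$; (iv) $\mathrm{PF\text{ - }TP}_\forall$: $(\forall^{\mathrm{st}}x^\tau)\varphi(x)\to(\forall x^\tau)\varphi(x)$ for internal $\varphi(x)$ with no parameters other than $x$; (v) for certain functionals uniquely specified by a parameter-free internal formula $D$ (e.g. the Suslin functional in $(S^2)$), a constant $\Xi_0$ with the axiom $\mathrm{st}(\Xi_0)\wedge(\forall^{\mathrm{st}}\Xi)[D^{\mathrm{st}}(\Xi)\to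 \Xi_0$ and $\Xi$ agree on all standard inputs$]$; these constants do not count as parameters in (iv). NOTATION. $\overline{g}x$ is the (code of the) initial segment of $g$ of length $x$; for (codes of) finite sequences $\tau,\sigma$, $\tau\leq_{0^*}\sigma$ means $|\tau|=|\sigma|\wedge(\forall i<|\sigma|)(\tau(i)\leq_0\sigma(i))$. Sets $X^1$ are given by characteristic functions. PRINCIPLES. $\mathrm{STP}$ (standard part principle): $(\forall X^1)(\exists^{\mathrm{st}}Y^1)(\forall^{\mathrm{st}}x^0)(x\in X\leftrightarrow x\in Y)$. $(S^2)$ (Suslin functional): $(\exists S^2)(\forall f^1)[S(f)=_00\leftrightarrow(\exists g^1)(\forall x^0)(f(\overline{g}x)\neq0)]$. -}

module Defs where

open import Data.Empty using (⊥)
open import Data.List using (List; []; _∷_; map)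
open import Data.List.Membership.Propositional using (_∈_)
open import Data.List.Relation.Binary.Subset.Propositional using (_⊆_)
open import Data.List.Relation.Unary.Any using (here; there)
open import Data.Product using (_×_)
open import Data.Sum using (_⊎_; inj₁; inj₂; [_,_]′)
open import Data.Unit using (⊤; tt)
open import Function using (id)
open import Relation.Binary.PropositionalEquality using (refl)

-- Deep embedding of many-sorted classical logic over the finite types.
-- Variables are typed de Bruijn indices.

infixl 9 _·_
infix  6 _≐_ _≤_ _<_ _∈ˢ_ _∈ˣ_ _≤₀*_
infix  5 ¬_
infixr 4 _∧_
infixr 3 _∨_
infixr 2 _⇒_
infix  1 _⇔_
infixr 0 ∀[_]_ ∃[_]_ ∀ˢᵗ[_]_ ∃ˢᵗ[_]_
infixr 8 _⟶_
infix  9 _✶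
infix -1 _∣_⊢_ _⊢_

data Type : Set where
  𝟎   : Type
  _⟶_ : Type → Type → Type
  _✶  : Type → Type

pattern 𝟏 = 𝟎 ⟶ 𝟎
pattern 𝟐 = 𝟏 ⟶ 𝟎

Ctx : Set
Ctx = List Type

-- HasSt is inhabited exactly when the language has the standardness predicate.
record Language : Set₁ where
  field
    Extra : Type → Set
    HasSt : Set

open Language

variable
  L     : Language
  Γ Δ   : Ctx
  ρ σ τ : Type

-- A finite sequence of type σ ✶ amounts to a function 𝟎 ⟶ σ cut off at a
-- length: seq F n is ⟨F 0, …, F (n − 1)⟩.
data Const (L : Language) : Type → Set where
  O     : Const L 𝟎
  S     : Const L 𝟏
  Π     : Const L (σ ⟶ τ ⟶ σ)
  Σ     : Const L ((ρ ⟶ σ ⟶ τ) ⟶ (ρ ⟶ σ) ⟶ ρ ⟶ τ)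
  R₀    : Const L (𝟎 ⟶ 𝟎 ⟶ (𝟎 ⟶ 𝟎 ⟶ 𝟎) ⟶ 𝟎)
  seq   : Const L ((𝟎 ⟶ σ) ⟶ 𝟎 ⟶ σ ✶)
  len   : Const L (σ ✶ ⟶ 𝟎)
  elt   : Const L (σ ✶ ⟶ 𝟎 ⟶ σ)
  extra : Extra L σ → Const L σ

data Term (L : Language) (Γ : Ctx) : Type → Set where
  var : σ ∈ Γ → Term L Γ σ
  con : Const L σ → Term L Γ σ
  _·_ : Term L Γ (σ ⟶ τ) → Term L Γ σ → Term L Γ τ

pattern x₀ = var (here refl)
pattern x₁ = var (there (here refl))
pattern x₂ = var (there (there (here refl)))
pattern x₃ = var (there (there (there (here refl))))
pattern x₄ = var (there (there (there (there (here refl)))))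

Subst : Language → Ctx → Ctx → Set
Subst L Γ Δ = ∀ {σ} → σ ∈ Γ → Term L Δ σ

liftᴿ : Γ ⊆ Δ → (σ ∷ Γ) ⊆ (σ ∷ Δ)
liftᴿ r (here p)  = here p
liftᴿ r (there i) = there (r i)

renameᵀ : Γ ⊆ Δ → Term L Γ σ → Term L Δ σ
renameᵀ r (var i) = var (r i)
renameᵀ r (con c) = con c
renameᵀ r (t · u) = renameᵀ r t · renameᵀ r u

wkᵀ : Term L Γ σ → Term L (τ ∷ Γ) σ
wkᵀ = renameᵀ there

liftˢ : Subst L Γ Δ → Subst L (σ ∷ Γ) (σ ∷ Δ)
liftˢ s (here p)  = var (here p)
liftˢ s (there i) = wkᵀ (s i)

substᵀ : Subst L Γ Δ → Term L Γ σ → Term L Δ σ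
substᵀ s (var i) = s i
substᵀ s (con c) = con c
substᵀ s (t · u) = substᵀ s t · substᵀ s u

inst : Term L Γ σ → Subst L (σ ∷ Γ) Γ
inst t (here refl) = t
inst t (there i)   = var i

-- Bracket abstraction.  The left summand holds the terms in which the
-- abstracted variable does not occur; these get a single Π.

Absᵀ : Language → Ctx → Type → Type → Set
Absᵀ L Γ σ τ = Term L Γ τ ⊎ Term L Γ (σ ⟶ τ)

bracket : Term L (σ ∷ Γ) τ → Absᵀ L Γ σ τ
bracket-· : Absᵀ L Γ σ (ρ ⟶ τ) → Absᵀ L Γ σ ρ → Absᵀ L Γ σ τ

bracket {σ = σ} (var (here refl)) = inj₂ (con Σ · con Π · con (Π {τ = σ}))
bracket (var (there i)) = inj₁ (var i)
bracket (con c)         = inj₁ (con c)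
bracket (t · u)         = bracket-· (bracket t) (bracket u)

bracket-· (inj₁ t) (inj₁ u) = inj₁ (t · u)
bracket-· (inj₁ t) (inj₂ u) = inj₂ (con Σ · (con Π · t) · u)
bracket-· (inj₂ t) (inj₁ u) = inj₂ (con Σ · t · (con Π · u))
bracket-· (inj₂ t) (inj₂ u) = inj₂ (con Σ · t · u)

ƛ : Term L (σ ∷ Γ) τ → Term L Γ (σ ⟶ τ)
ƛ t = [ (λ u → con Π · u) , id ]′ (bracket t)

ze : Term L Γ 𝟎
ze = con O

su : Term L Γ 𝟎 → Term L Γ 𝟎
su t = con S · t

zeroᵗ : ∀ σ → Term L Γ σ
zeroᵗ 𝟎       = ze
zeroᵗ (σ ⟶ τ) = con Π · zeroᵗ τ
zeroᵗ (σ ✶)   = con seq · (con Π · zeroᵗ σ) · ze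

-- Primitive recursive functions.  The step term of R₀ takes the previous
-- value first and the counter second.

add : Term L Γ (𝟎 ⟶ 𝟎 ⟶ 𝟎)
add = ƛ (ƛ (con R₀ · x₀ · x₁ · ƛ (ƛ (su x₁))))

pred : Term L Γ 𝟏
pred = ƛ (con R₀ · x₀ · ze · ƛ (ƛ x₀))

monus : Term L Γ (𝟎 ⟶ 𝟎 ⟶ 𝟎)
monus = ƛ (ƛ (con R₀ · x₀ · x₁ · ƛ (ƛ (pred · x₁))))

-- 1 for positive arguments, 0 at 0
sg : Term L Γ 𝟏
sg = ƛ (monus · su ze · (monus · su ze · x₀))

triangle : Term L Γ 𝟏
triangle = ƛ (con R₀ · x₀ · ze · ƛ (ƛ (add · x₁ · su x₀)))

-- Cantor pairing: pair m n = (m + n)(m + n + 1)/2 + m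
pair : Term L Γ (𝟎 ⟶ 𝟎 ⟶ 𝟎)
pair = ƛ (ƛ (add · (triangle · (add · x₁ · x₀)) · x₁))

-- the largest w with triangle w ≤ p
diagonal : Term L Γ 𝟏
diagonal = ƛ (con R₀ · x₀ · ze · ƛ (ƛ
  (add · x₁ · (monus · su ze · (monus · (triangle · su x₁) · su x₀)))))

fst : Term L Γ 𝟏
fst = ƛ (monus · x₀ · (triangle · (diagonal · x₀)))

snd : Term L Γ 𝟏
snd = ƛ (monus · (diagonal · x₀) · (fst · x₀))

-- Codes of finite sequences of numbers: 0 codes the empty sequence and
-- snoc s n = 1 + pair s n codes s followed by n.  This is a bijection between
-- numbers and finite sequences of numbers.

snoc : Term L Γ (𝟎 ⟶ 𝟎 ⟶ 𝟎)
snoc = ƛ (ƛ (su (pair · x₁ · x₀)))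

-- drop n s: the sequence s without its last n entries
drop : Term L Γ (𝟎 ⟶ 𝟎 ⟶ 𝟎)
drop = ƛ (ƛ (con R₀ · x₁ · x₀ · ƛ (ƛ (fst · (pred · x₁)))))

-- the number of k < s such that dropping k entries leaves s nonempty
lh : Term L Γ 𝟏
lh = ƛ (con R₀ · x₀ · ze · ƛ (ƛ (add · x₁ · (sg · (drop · x₀ · x₂)))))

-- ent s i = s(i); meaningful for i < |s| only
ent : Term L Γ (𝟎 ⟶ 𝟏)
ent = ƛ (ƛ (snd · (pred · (drop · (monus · (lh · x₁) · su x₀) · x₁))))

-- bar g x = ⟨g 0, …, g (x − 1)⟩; for a code s use bar (ent s) x
bar : Term L Γ (𝟏 ⟶ 𝟎 ⟶ 𝟎)
bar = ƛ (ƛ (con R₀ · x₀ · ze · ƛ (ƛ (snoc · x₁ · (x₃ · x₀)))))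

data Formula (L : Language) (Γ : Ctx) : Set where
  _≐_         : Term L Γ 𝟎 → Term L Γ 𝟎 → Formula L Γ
  std         : HasSt L → Term L Γ σ → Formula L Γ
  ⊥̇           : Formula L Γ
  _∧_ _∨_ _⇒_ : Formula L Γ → Formula L Γ → Formula L Γ
  ∀[_]_ ∃[_]_ : ∀ σ → Formula L (σ ∷ Γ) → Formula L Γ

¬_ : Formula L Γ → Formula L Γ
¬ A = A ⇒ ⊥̇

_⇔_ : Formula L Γ → Formula L Γ → Formula L Γ
A ⇔ B = (A ⇒ B) ∧ (B ⇒ A)

rename : Γ ⊆ Δ → Formula L Γ → Formula L Δ
rename r (t ≐ u)    = renameᵀ r t ≐ renameᵀ r u
rename r (std h t)  = std h (renameᵀ r t)
rename r ⊥̇          = ⊥̇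
rename r (A ∧ B)    = rename r A ∧ rename r B
rename r (A ∨ B)    = rename r A ∨ rename r B
rename r (A ⇒ B)    = rename r A ⇒ rename r B
rename r (∀[ σ ] A) = ∀[ σ ] rename (liftᴿ r) A
rename r (∃[ σ ] A) = ∃[ σ ] rename (liftᴿ r) A

wk : Formula L Γ → Formula L (σ ∷ Γ)
wk = rename there

subst : Subst L Γ Δ → Formula L Γ → Formula L Δ
subst s (t ≐ u)    = substᵀ s t ≐ substᵀ s u
subst s (std h t)  = std h (substᵀ s t)
subst s ⊥̇          = ⊥̇
subst s (A ∧ B)    = subst s A ∧ subst s B
subst s (A ∨ B)    = subst s A ∨ subst s B
subst s (A ⇒ B)    = subst s A ⇒ subst s B
subst s (∀[ σ ] A) = ∀[ σ ] subst (liftˢ s) A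
subst s (∃[ σ ] A) = ∃[ σ ] subst (liftˢ s) A

_[_] : Formula L (σ ∷ Γ) → Term L Γ σ → Formula L Γ
A [ t ] = subst (inst t) A

sucˢ : Subst L (𝟎 ∷ Γ) (𝟎 ∷ Γ)
sucˢ (here refl) = su x₀
sucˢ (there i)   = var (there i)

-- from A(x, y), with y = x₀ and x = x₁, to A(x, F x), with x = x₀ and F = x₁
choiceˢ : Subst L (τ ∷ σ ∷ Γ) (σ ∷ (σ ⟶ τ) ∷ Γ)
choiceˢ (here refl)         = x₁ · x₀
choiceˢ (there (here refl)) = x₀
choiceˢ (there (there i))   = var (there (there i))

QuantifierFree : Formula L Γ → Set
QuantifierFree (_ ≐ _)    = ⊤
QuantifierFree (std _ _)  = ⊥
QuantifierFree ⊥̇          = ⊤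
QuantifierFree (A ∧ B)    = QuantifierFree A × QuantifierFree B
QuantifierFree (A ∨ B)    = QuantifierFree A × QuantifierFree B
QuantifierFree (A ⇒ B)    = QuantifierFree A × QuantifierFree B
QuantifierFree (∀[ _ ] _) = ⊥
QuantifierFree (∃[ _ ] _) = ⊥

Internal : Formula L Γ → Set
Internal (_ ≐ _)    = ⊤
Internal (std _ _)  = ⊥
Internal ⊥̇          = ⊤
Internal (A ∧ B)    = Internal A × Internal B
Internal (A ∨ B)    = Internal A × Internal B
Internal (A ⇒ B)    = Internal A × Internal B
Internal (∀[ _ ] A) = Internal A
Internal (∃[ _ ] A) = Internal A

_≤_ : Term L Γ 𝟎 → Term L Γ 𝟎 → Formula L Γ
t ≤ u = monus · t · u ≐ ze

_<_ : Term L Γ 𝟎 → Term L Γ 𝟎 → Formula L Γ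
t < u = su t ≤ u

eq : ∀ σ → Term L Γ σ → Term L Γ σ → Formula L Γ
eq 𝟎       t u = t ≐ u
eq (σ ⟶ τ) t u = ∀[ σ ] eq τ (wkᵀ t · x₀) (wkᵀ u · x₀)
eq (σ ✶)   t u = con len · t ≐ con len · u
  ∧ (∀[ 𝟎 ] x₀ < con len · wkᵀ t
             ⇒ eq σ (con elt · wkᵀ t · x₀) (con elt · wkᵀ u · x₀))

_∈ˢ_ : Term L Γ σ → Term L Γ (σ ✶) → Formula L Γ
_∈ˢ_ {σ = σ} t s =
  ∃[ 𝟎 ] x₀ < con len · wkᵀ s ∧ eq σ (wkᵀ t) (con elt · wkᵀ s · x₀)

_≤₀*_ : Term L Γ 𝟎 → Term L Γ 𝟎 → Formula L Γ
s ≤₀* t = lh · s ≐ lh · t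
  ∧ (∀[ 𝟎 ] x₀ < lh · wkᵀ t ⇒ ent · wkᵀ s · x₀ ≤ ent · wkᵀ t · x₀)

-- Axioms may have free variables, which are read as universally quantified.
Theory : Language → Set₁
Theory L = ∀ {Γ} → Formula L Γ → Set

-- Classical natural deduction.
data _∣_⊢_ (T : Theory L) : List (Formula L Γ) → Formula L Γ → Set where
  axiom : ∀ {H} {A : Formula L Γ} → T A → T ∣ H ⊢ A
  hyp   : ∀ {H} {A : Formula L Γ} → A ∈ H → T ∣ H ⊢ A
  raa   : ∀ {H} {A : Formula L Γ} → T ∣ (¬ A) ∷ H ⊢ ⊥̇ → T ∣ H ⊢ A
  ⇒I    : ∀ {H} {A B : Formula L Γ} → T ∣ A ∷ H ⊢ B → T ∣ H ⊢ A ⇒ B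
  ⇒E    : ∀ {H} {A B : Formula L Γ} → T ∣ H ⊢ A ⇒ B → T ∣ H ⊢ A → T ∣ H ⊢ B
  ∧I    : ∀ {H} {A B : Formula L Γ} → T ∣ H ⊢ A → T ∣ H ⊢ B → T ∣ H ⊢ A ∧ B
  ∧E₁   : ∀ {H} {A B : Formula L Γ} → T ∣ H ⊢ A ∧ B → T ∣ H ⊢ A
  ∧E₂   : ∀ {H} {A B : Formula L Γ} → T ∣ H ⊢ A ∧ B → T ∣ H ⊢ B
  ∨I₁   : ∀ {H} {A B : Formula L Γ} → T ∣ H ⊢ A → T ∣ H ⊢ A ∨ B
  ∨I₂   : ∀ {H} {A B : Formula L Γ} → T ∣ H ⊢ B → T ∣ H ⊢ A ∨ B
  ∨E    : ∀ {H} {A B C : Formula L Γ} →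
          T ∣ H ⊢ A ∨ B → T ∣ A ∷ H ⊢ C → T ∣ B ∷ H ⊢ C → T ∣ H ⊢ C
  ∀I    : ∀ {H} {A : Formula L (σ ∷ Γ)} → T ∣ map wk H ⊢ A → T ∣ H ⊢ ∀[ σ ] A
  ∀E    : ∀ {H} {A : Formula L (σ ∷ Γ)} →
          T ∣ H ⊢ ∀[ σ ] A → (t : Term L Γ σ) → T ∣ H ⊢ A [ t ]
  ∃I    : ∀ {H} {A : Formula L (σ ∷ Γ)} →
          (t : Term L Γ σ) → T ∣ H ⊢ A [ t ] → T ∣ H ⊢ ∃[ σ ] A
  ∃E    : ∀ {H} {A : Formula L (σ ∷ Γ)} {B : Formula L Γ} →
          T ∣ H ⊢ ∃[ σ ] A → T ∣ A ∷ map wk H ⊢ wk B → T ∣ H ⊢ B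

_⊢_ : Theory L → Formula L [] → Set
T ⊢ A = T ∣ [] ⊢ A

-- Kohlenbach's RCA₀^ω in the language L.  The axioms on seq, len and elt are
-- those of a definitional extension by the types σ ✶; out of range, elt takes
-- the value zeroᵗ σ, so that extensionality holds for it.
data RCA₀^ω {L : Language} {Γ : Ctx} : Formula L Γ → Set where
  ≐-refl   : ∀ t → RCA₀^ω (t ≐ t)
  ≐-sym    : ∀ t u → RCA₀^ω (t ≐ u ⇒ u ≐ t)
  ≐-trans  : ∀ t u v → RCA₀^ω (t ≐ u ∧ u ≐ v ⇒ t ≐ v)
  ext      : (t u : Term L Γ ρ) (φ : Term L Γ (ρ ⟶ τ)) →
             RCA₀^ω (eq ρ t u ⇒ eq τ (φ · t) (φ · u))
  su≢0     : ∀ t → RCA₀^ω (¬ su t ≐ ze)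
  su-inj   : ∀ t u → RCA₀^ω (su t ≐ su u ⇒ t ≐ u)
  Π-eq     : (t : Term L Γ σ) (u : Term L Γ τ) → RCA₀^ω (eq σ (con Π · t · u) t)
  Σ-eq     : (t : Term L Γ (ρ ⟶ σ ⟶ τ)) (u : Term L Γ (ρ ⟶ σ)) (v : Term L Γ ρ) →
             RCA₀^ω (eq τ (con Σ · t · u · v) (t · v · (u · v)))
  R₀-zero  : ∀ t u → RCA₀^ω (con R₀ · ze · t · u ≐ t)
  R₀-suc   : ∀ n t u →
             RCA₀^ω (con R₀ · su n · t · u ≐ u · (con R₀ · n · t · u) · n)
  len-seq  : (F : Term L Γ (𝟎 ⟶ σ)) (n : Term L Γ 𝟎) →
             RCA₀^ω (con len · (con seq · F · n) ≐ n)
  elt-seq  : (F : Term L Γ (𝟎 ⟶ σ)) (n i : Term L Γ 𝟎) →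
             RCA₀^ω (i < n ⇒ eq σ (con elt · (con seq · F · n) · i) (F · i))
  elt-out  : (s : Term L Γ (σ ✶)) (i : Term L Γ 𝟎) →
             RCA₀^ω (con len · s ≤ i ⇒ eq σ (con elt · s · i) (zeroᵗ σ))
  QF-IND   : (A : Formula L (𝟎 ∷ Γ)) → QuantifierFree A →
             RCA₀^ω (A [ ze ] ∧ (∀[ 𝟎 ] A ⇒ subst sucˢ A) ⇒ (∀[ 𝟎 ] A))
  QF-AC¹⁰  : (A : Formula L (𝟎 ∷ 𝟏 ∷ Γ)) → QuantifierFree A →
             RCA₀^ω ((∀[ 𝟏 ] ∃[ 𝟎 ] A) ⇒ (∃[ 𝟐 ] ∀[ 𝟏 ] subst choiceˢ A))

-- The language of RCA₀^ω has no predicate st, so its formulas are internal.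
ℒ^ω : Language
ℒ^ω = record { Extra = λ _ → ⊥ ; HasSt = ⊥ }

Uniqueness : Formula ℒ^ω (ρ ∷ []) → Formula ℒ^ω []
Uniqueness {ρ = ρ} D = ∀[ ρ ] ∀[ ρ ] (rename (liftᴿ (λ ())) D ∧ wk D ⇒ eq ρ x₀ x₁)

-- The functionals of type ρ that get a constant: those specified by a
-- parameter-free internal formula which RCA₀^ω proves to have at most one
-- solution.  (Without uniqueness, agreement with every solution would be
-- contradictory: the Suslin functional has to be normalised, say to S(f) ≤ 1.)
record Specification (ρ : Type) : Set where
  constructor specification
  field
    D       : Formula ℒ^ω (ρ ∷ [])
    .unique : RCA₀^ω ⊢ Uniqueness D

ℒ^Ω : Language
ℒ^Ω = record { Extra = Specification ; HasSt = ⊤ }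

embedᶜ : Const ℒ^ω σ → Const ℒ^Ω σ
embedᶜ O   = O
embedᶜ S   = S
embedᶜ Π   = Π
embedᶜ Σ   = Σ
embedᶜ R₀  = R₀
embedᶜ seq = seq
embedᶜ len = len
embedᶜ elt = elt
embedᶜ (extra ())

embedᵀ : Term ℒ^ω Γ σ → Term ℒ^Ω Γ σ
embedᵀ (var i) = var i
embedᵀ (con c) = con (embedᶜ c)
embedᵀ (t · u) = embedᵀ t · embedᵀ u

embed : Formula ℒ^ω Γ → Formula ℒ^Ω Γ
embed (t ≐ u)    = embedᵀ t ≐ embedᵀ u
embed (std () _)
embed ⊥̇          = ⊥̇
embed (A ∧ B)    = embed A ∧ embed B
embed (A ∨ B)    = embed A ∨ embed B
embed (A ⇒ B)    = embed A ⇒ embed B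
embed (∀[ σ ] A) = ∀[ σ ] embed A
embed (∃[ σ ] A) = ∃[ σ ] embed A

st : Term ℒ^Ω Γ σ → Formula ℒ^Ω Γ
st = std tt

∀ˢᵗ[_]_ ∃ˢᵗ[_]_ : ∀ σ → Formula ℒ^Ω (σ ∷ Γ) → Formula ℒ^Ω Γ
∀ˢᵗ[ σ ] A = ∀[ σ ] st x₀ ⇒ A
∃ˢᵗ[ σ ] A = ∃[ σ ] st x₀ ∧ A

-- Bounded number quantifiers are relativised too.  As numbers below a standard
-- number are standard, this makes no difference for formulas with standard
-- parameters.
_ˢᵗ : Formula ℒ^Ω Γ → Formula ℒ^Ω Γ
(t ≐ u) ˢᵗ    = t ≐ u
(std h t) ˢᵗ  = std h t
⊥̇ ˢᵗ          = ⊥̇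
(A ∧ B) ˢᵗ    = A ˢᵗ ∧ B ˢᵗ
(A ∨ B) ˢᵗ    = A ˢᵗ ∨ B ˢᵗ
(A ⇒ B) ˢᵗ    = A ˢᵗ ⇒ B ˢᵗ
(∀[ σ ] A) ˢᵗ = ∀ˢᵗ[ σ ] A ˢᵗ
(∃[ σ ] A) ˢᵗ = ∃ˢᵗ[ σ ] A ˢᵗ

data RCA₀^Ω {Γ : Ctx} : Formula ℒ^Ω Γ → Set where
  base     : {A : Formula ℒ^Ω Γ} → RCA₀^ω A → RCA₀^Ω A
  st-≡     : (t u : Term ℒ^Ω Γ σ) → RCA₀^Ω (st t ∧ eq σ t u ⇒ st u)
  st-clo   : (t : Term ℒ^Ω [] σ) → RCA₀^Ω (st (renameᵀ (λ ()) t))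
  st-app   : (t : Term ℒ^Ω Γ (σ ⟶ τ)) (u : Term ℒ^Ω Γ σ) →
             RCA₀^Ω (st t ∧ st u ⇒ st (t · u))
  st-≤     : (m n : Term ℒ^Ω Γ 𝟎) → RCA₀^Ω (st n ∧ m ≤ n ⇒ st m)
  -- φ has the free variables z (x₀) and y (x₁)
  I        : (φ : Formula ℒ^Ω (σ ∷ τ ∷ Γ)) → Internal φ →
             RCA₀^Ω ((∀ˢᵗ[ σ ✶ ] ∃[ τ ] ∀[ σ ] x₀ ∈ˢ x₂ ⇒ rename (liftᴿ (liftᴿ there)) φ)
                     ⇒ (∃[ τ ] ∀ˢᵗ[ σ ] φ))
  -- φ has the free variables y (x₀) and x (x₁)
  HAC-int  : (φ : Formula ℒ^Ω (τ ∷ ρ ∷ Γ)) → Internal φ →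
             RCA₀^Ω ((∀ˢᵗ[ ρ ] ∃ˢᵗ[ τ ] φ)
                     ⇒ (∃ˢᵗ[ ρ ⟶ τ ✶ ] ∀ˢᵗ[ ρ ] ∃[ τ ]
                          x₀ ∈ˢ x₂ · x₁ ∧ rename (liftᴿ (liftᴿ there)) φ))
  PF-TP∀   : (φ : Formula ℒ^Ω (τ ∷ [])) → Internal φ →
             RCA₀^Ω ((∀ˢᵗ[ τ ] rename (liftᴿ (λ ())) φ)
                     ⇒ (∀[ τ ] rename (liftᴿ (λ ())) φ))
  Ξ₀       : (s : Specification ρ) →
             RCA₀^Ω (st (con (extra s))
                     ∧ (∀ˢᵗ[ ρ ] rename (liftᴿ (λ ())) (embed (Specification.D s) ˢᵗ)
                                 ⇒ (eq ρ (con (extra s)) x₀) ˢᵗ))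

data _⊕_ (T : Theory L) (A : Formula L []) {Γ : Ctx} : Formula L Γ → Set where
  old : {B : Formula L Γ} → T B → (T ⊕ A) B
  new : (T ⊕ A) (rename (λ ()) A)

-- a characteristic function takes the value 1 on the set and 0 off it
IsSet : Term L Γ 𝟏 → Formula L Γ
IsSet X = ∀[ 𝟎 ] wkᵀ X · x₀ ≤ su ze

_∈ˣ_ : Term L Γ 𝟎 → Term L Γ 𝟏 → Formula L Γ
t ∈ˣ X = X · t ≐ su ze

STP : Formula ℒ^Ω []
STP = ∀[ 𝟏 ] IsSet x₀ ⇒
        (∃ˢᵗ[ 𝟏 ] IsSet x₀ ∧ (∀ˢᵗ[ 𝟎 ] x₀ ∈ˣ x₂ ⇔ x₀ ∈ˣ x₁))

S² : Formula ℒ^Ω []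
S² = ∃[ 𝟐 ] ∀[ 𝟏 ]
       x₁ · x₀ ≐ ze ⇔ (∃[ 𝟏 ] ∀[ 𝟎 ] ¬ x₂ · (bar · x₁ · x₀) ≐ ze)

-- the bound variables are, from the outside in, Φ, f, M, g and x
RB : Formula ℒ^Ω []
RB = ∃ˢᵗ[ 𝟏 ⟶ 𝟏 ] ∀ˢᵗ[ 𝟏 ] ∀[ 𝟎 ] ¬ st x₀ ⇒
       ((∀[ 𝟎 ] x₀ ≤₀* bar · (x₃ · x₂) · x₁
                ⇒ (∃[ 𝟎 ] x₀ ≤ x₂ ∧ x₃ · (bar · (ent · x₁) · x₀) ≐ ze))
        ⇔ (∀[ 𝟏 ] ∃[ 𝟎 ] x₃ · (bar · x₁ · x₀) ≐ ze))

{-# OPTIONS --safe #-}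
module Submission where

-- From (S²)^st one gets the constant ξ for the (normalised) Suslin functional.
-- For standard f and g, either ξ(f) = 0 or f has a zero along g; this is internal
-- with no other parameters, so PF-TP∀ gives it for all f and g, and transfer for
-- Π⁰₁- and Π¹₁-formulas with standard parameters follows.  HAC-int then yields,
-- for each standard f that is not a bar, a finite list containing a path that
-- avoids the zeros of f, and Φ(f) is the sum of the list: this dominates the path.
-- Conversely, STP turns a code below Φ(f) of nonstandard length M into a
-- standard sequence, so a bar is hit below M.
--
-- From (RB), the bounded left-hand side is decided by a functional U(f, Φ(f), M)
-- whose value for standard f is the same for all M ∈ Ω.  By underspill it is
-- already settled at a standard m, HAC-int gives a standard bound for m, and
-- plugging in this bound gives the Suslin functional.  Applied to the function
-- s ↦ f(ḡ|s|), (RB) also shows that a zero of f along a standard g can be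
-- found at a standard position.

open import Defs
open import Data.List using (List; []; _∷_; map)
open import Data.List.Membership.Propositional using (_∈_)
open import Data.List.Relation.Binary.Subset.Propositional using (_⊆_)
open import Data.List.Relation.Binary.Subset.Propositional.Properties using (map⁺)
open import Data.List.Relation.Unary.Any using (here; there)
open import Data.Product using (_,_)
open import Data.Sum using (inj₁; inj₂)
open import Data.Unit using (tt)
open import Function using (_∘_; _$_)
open import Relation.Binary.PropositionalEquality as ≡ using (_≡_; refl)

-- PF-TP admits internal formulas without parameters only, so the functional given by (S²)^st cannot
-- itself occur in a transferred formula, whereas the constant `ξ` can. The constant also expresses
-- by an equation that `f` has a standard path, and this keeps the condition that enters HAC-int
-- internal. HAC-int returns finite lists in place of values. Summing a list is harmless in both
-- directions because the conditions are monotone: a larger `Φ(f)` still dominates the path, and a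
-- settled value stays settled at larger arguments. Under (RB), `Φ` is a parameter, which blocks
-- PF-TP for formulas that contain it. What helps is that the right-hand side of (RB) quantifies
-- over all `g` and `x`: for a function of the length alone it says that there is a zero anywhere,
-- and the bounded side then locates it. The gap between all positions and the standard ones, to
-- which the relativised Suslin functional refers, is what both directions have to bridge.

variable
  Γ′ Δ′ : Ctx

pattern x₅ = var (there (there (there (there (there (here refl))))))
pattern x₆ = var (there (there (there (there (there (there (here refl)))))))
pattern x₇ = var (there (there (there (there (there (there (there (here refl))))))))

-- Lemmas about arbitrary terms t, u are stated as subst (ε ▸ t ▸ u) A for a
-- template A: this reduces to the expected instance, whereas two uses of ∀E
-- leave a substᵀ (inst u) (wkᵀ t) in place of t.
infixl 5 _▸_

_▸_ : Subst L Γ Δ → Term L Δ σ → Subst L (σ ∷ Γ) Δ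
(s ▸ t) (here refl) = t
(s ▸ t) (there i)   = s i

ε : Subst L [] Δ
ε ()

wkˢ : Subst L Γ Δ → Subst L Γ (σ ∷ Δ)
wkˢ s i = wkᵀ (s i)

-- Calculus of renamings and substitutions

substᵀ-renameᵀ : {r : Γ ⊆ Δ} {s : Subst L Δ Δ′} {s′ : Subst L Γ Δ′} →
  (∀ {σ} (i : σ ∈ Γ) → s (r i) ≡ s′ i) →
  (t : Term L Γ τ) → substᵀ s (renameᵀ r t) ≡ substᵀ s′ t
substᵀ-renameᵀ e (var i) = e i
substᵀ-renameᵀ e (con c) = refl
substᵀ-renameᵀ e (t · u) = ≡.cong₂ _·_ (substᵀ-renameᵀ e t) (substᵀ-renameᵀ e u)

renameᵀ-substᵀ : {s : Subst L Γ Δ} {r : Δ ⊆ Δ′} {s′ : Subst L Γ Δ′} →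
  (∀ {σ} (i : σ ∈ Γ) → renameᵀ r (s i) ≡ s′ i) →
  (t : Term L Γ τ) → renameᵀ r (substᵀ s t) ≡ substᵀ s′ t
renameᵀ-substᵀ e (var i) = e i
renameᵀ-substᵀ e (con c) = refl
renameᵀ-substᵀ e (t · u) = ≡.cong₂ _·_ (renameᵀ-substᵀ e t) (renameᵀ-substᵀ e u)

substᵀ-substᵀ : {s : Subst L Γ Δ} {s′ : Subst L Δ Δ′} {s″ : Subst L Γ Δ′} →
  (∀ {σ} (i : σ ∈ Γ) → substᵀ s′ (s i) ≡ s″ i) →
  (t : Term L Γ τ) → substᵀ s′ (substᵀ s t) ≡ substᵀ s″ t
substᵀ-substᵀ e (var i) = e i
substᵀ-substᵀ e (con c) = refl
substᵀ-substᵀ e (t · u) = ≡.cong₂ _·_ (substᵀ-substᵀ e t) (substᵀ-substᵀ e u)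

renameᵀ-renameᵀ : {r : Γ ⊆ Δ} {r′ : Δ ⊆ Δ′} {r″ : Γ ⊆ Δ′} →
  (∀ {σ} (i : σ ∈ Γ) → r′ (r i) ≡ r″ i) →
  (t : Term L Γ τ) → renameᵀ r′ (renameᵀ r t) ≡ renameᵀ r″ t
renameᵀ-renameᵀ e (var i) = ≡.cong var (e i)
renameᵀ-renameᵀ e (con c) = refl
renameᵀ-renameᵀ e (t · u) = ≡.cong₂ _·_ (renameᵀ-renameᵀ e t) (renameᵀ-renameᵀ e u)

substᵀ-var : (t : Term L Γ τ) → substᵀ var t ≡ t
substᵀ-var (var i) = refl
substᵀ-var (con c) = refl
substᵀ-var (t · u) = ≡.cong₂ _·_ (substᵀ-var t) (substᵀ-var u)

substᵀ-inst-wkᵀ : {u : Term L Γ σ} (t : Term L Γ τ) → substᵀ (inst u) (wkᵀ t) ≡ t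
substᵀ-inst-wkᵀ t = ≡.trans (substᵀ-renameᵀ (λ _ → refl) t) (substᵀ-var t)

substᵀ-liftˢ-wkᵀ : {s : Subst L Γ Δ} (t : Term L Γ τ) →
  substᵀ (liftˢ {σ = σ} s) (wkᵀ t) ≡ wkᵀ (substᵀ s t)
substᵀ-liftˢ-wkᵀ t =
  ≡.trans (substᵀ-renameᵀ (λ _ → refl) t) (≡.sym (renameᵀ-substᵀ (λ _ → refl) t))

renameᵀ-liftᴿ-wkᵀ : {r : Γ ⊆ Δ} (t : Term L Γ τ) →
  renameᵀ (liftᴿ {σ = σ} r) (wkᵀ t) ≡ wkᵀ (renameᵀ r t)
renameᵀ-liftᴿ-wkᵀ t =
  ≡.trans (renameᵀ-renameᵀ (λ _ → refl) t) (≡.sym (renameᵀ-renameᵀ (λ _ → refl) t))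

subst-subst : {s : Subst L Γ Δ} {s′ : Subst L Δ Δ′} {s″ : Subst L Γ Δ′} →
  (∀ {σ} (i : σ ∈ Γ) → substᵀ s′ (s i) ≡ s″ i) →
  (A : Formula L Γ) → subst s′ (subst s A) ≡ subst s″ A
subst-subst-liftˢ : {s : Subst L Γ Δ} {s′ : Subst L Δ Δ′} {s″ : Subst L Γ Δ′} →
  (∀ {σ} (i : σ ∈ Γ) → substᵀ s′ (s i) ≡ s″ i) →
  (A : Formula L (τ ∷ Γ)) → subst (liftˢ s′) (subst (liftˢ s) A) ≡ subst (liftˢ s″) A
subst-subst e (t ≐ u)    = ≡.cong₂ _≐_ (substᵀ-substᵀ e t) (substᵀ-substᵀ e u)
subst-subst e (std h t)  = ≡.cong (std h) (substᵀ-substᵀ e t)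
subst-subst e ⊥̇          = refl
subst-subst e (A ∧ B)    = ≡.cong₂ _∧_ (subst-subst e A) (subst-subst e B)
subst-subst e (A ∨ B)    = ≡.cong₂ _∨_ (subst-subst e A) (subst-subst e B)
subst-subst e (A ⇒ B)    = ≡.cong₂ _⇒_ (subst-subst e A) (subst-subst e B)
subst-subst e (∀[ σ ] A) = ≡.cong (∀[ σ ]_) (subst-subst-liftˢ e A)
subst-subst e (∃[ σ ] A) = ≡.cong (∃[ σ ]_) (subst-subst-liftˢ e A)
subst-subst-liftˢ {s = s} e = subst-subst λ where
  (here refl) → refl
  (there i)   → ≡.trans (substᵀ-liftˢ-wkᵀ (s i)) (≡.cong wkᵀ (e i))

substᵀ-cong : {s s′ : Subst L Γ Δ} → (∀ {σ} (i : σ ∈ Γ) → s i ≡ s′ i) →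
  (t : Term L Γ τ) → substᵀ s t ≡ substᵀ s′ t
substᵀ-cong e (var i) = e i
substᵀ-cong e (con c) = refl
substᵀ-cong e (t · u) = ≡.cong₂ _·_ (substᵀ-cong e t) (substᵀ-cong e u)

subst-cong : {s s′ : Subst L Γ Δ} → (∀ {σ} (i : σ ∈ Γ) → s i ≡ s′ i) →
  (A : Formula L Γ) → subst s A ≡ subst s′ A
subst-cong-liftˢ : {s s′ : Subst L Γ Δ} → (∀ {σ} (i : σ ∈ Γ) → s i ≡ s′ i) →
  (A : Formula L (τ ∷ Γ)) → subst (liftˢ s) A ≡ subst (liftˢ s′) A
subst-cong e (t ≐ u)    = ≡.cong₂ _≐_ (substᵀ-cong e t) (substᵀ-cong e u)
subst-cong e (std h t)  = ≡.cong (std h) (substᵀ-cong e t)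
subst-cong e ⊥̇          = refl
subst-cong e (A ∧ B)    = ≡.cong₂ _∧_ (subst-cong e A) (subst-cong e B)
subst-cong e (A ∨ B)    = ≡.cong₂ _∨_ (subst-cong e A) (subst-cong e B)
subst-cong e (A ⇒ B)    = ≡.cong₂ _⇒_ (subst-cong e A) (subst-cong e B)
subst-cong e (∀[ σ ] A) = ≡.cong (∀[ σ ]_) (subst-cong-liftˢ e A)
subst-cong e (∃[ σ ] A) = ≡.cong (∃[ σ ]_) (subst-cong-liftˢ e A)
subst-cong-liftˢ e = subst-cong λ where
  (here refl) → refl
  (there i)   → ≡.cong wkᵀ (e i)

∀[]-inst : {s : Subst L Γ Δ} (A : Formula L (σ ∷ Γ)) (t : Term L Δ σ) →
  subst (liftˢ s) A [ t ] ≡ subst (s ▸ t) A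
∀[]-inst {s = s} A t = subst-subst (λ where
  (here refl) → refl
  (there i)   → substᵀ-inst-wkᵀ (s i)) A

subst-eq : ∀ σ {s : Subst L Γ Δ} {t u : Term L Γ σ} →
  subst s (eq σ t u) ≡ eq σ (substᵀ s t) (substᵀ s u)
subst-eq 𝟎 = refl
subst-eq (σ ⟶ τ) {s} {t} {u} = ≡.cong (∀[ σ ]_) (≡.trans (subst-eq τ)
  (≡.cong₂ (λ t u → eq τ (t · x₀) (u · x₀)) (substᵀ-liftˢ-wkᵀ t) (substᵀ-liftˢ-wkᵀ u)))
subst-eq (σ ✶) {s} {t} {u} = ≡.cong (λ A → con len · substᵀ s t ≐ con len · substᵀ s u ∧ (∀[ 𝟎 ] A))
  (≡.cong₂ _⇒_
    (≡.cong (λ t → x₀ < con len · t) (substᵀ-liftˢ-wkᵀ t))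
    (≡.trans (subst-eq σ) (≡.cong₂ (λ t u → eq σ (con elt · t · x₀) (con elt · u · x₀))
      (substᵀ-liftˢ-wkᵀ t) (substᵀ-liftˢ-wkᵀ u))))

rename-eq : ∀ σ {r : Γ ⊆ Δ} {t u : Term L Γ σ} →
  rename r (eq σ t u) ≡ eq σ (renameᵀ r t) (renameᵀ r u)
rename-eq 𝟎 = refl
rename-eq (σ ⟶ τ) {r} {t} {u} = ≡.cong (∀[ σ ]_) (≡.trans (rename-eq τ)
  (≡.cong₂ (λ t u → eq τ (t · x₀) (u · x₀)) (renameᵀ-liftᴿ-wkᵀ t) (renameᵀ-liftᴿ-wkᵀ u)))
rename-eq (σ ✶) {r} {t} {u} = ≡.cong (λ A → con len · renameᵀ r t ≐ con len · renameᵀ r u ∧ (∀[ 𝟎 ] A))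
  (≡.cong₂ _⇒_
    (≡.cong (λ t → x₀ < con len · t) (renameᵀ-liftᴿ-wkᵀ t))
    (≡.trans (rename-eq σ) (≡.cong₂ (λ t u → eq σ (con elt · t · x₀) (con elt · u · x₀))
      (renameᵀ-liftᴿ-wkᵀ t) (renameᵀ-liftᴿ-wkᵀ u))))

subst-rename : {r : Γ ⊆ Δ} {s : Subst L Δ Δ′} {s′ : Subst L Γ Δ′} →
  (∀ {σ} (i : σ ∈ Γ) → s (r i) ≡ s′ i) →
  (A : Formula L Γ) → subst s (rename r A) ≡ subst s′ A
subst-rename-lift : {r : Γ ⊆ Δ} {s : Subst L Δ Δ′} {s′ : Subst L Γ Δ′} →
  (∀ {σ} (i : σ ∈ Γ) → s (r i) ≡ s′ i) →
  (A : Formula L (τ ∷ Γ)) → subst (liftˢ s) (rename (liftᴿ r) A) ≡ subst (liftˢ s′) A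
subst-rename e (t ≐ u)    = ≡.cong₂ _≐_ (substᵀ-renameᵀ e t) (substᵀ-renameᵀ e u)
subst-rename e (std h t)  = ≡.cong (std h) (substᵀ-renameᵀ e t)
subst-rename e ⊥̇          = refl
subst-rename e (A ∧ B)    = ≡.cong₂ _∧_ (subst-rename e A) (subst-rename e B)
subst-rename e (A ∨ B)    = ≡.cong₂ _∨_ (subst-rename e A) (subst-rename e B)
subst-rename e (A ⇒ B)    = ≡.cong₂ _⇒_ (subst-rename e A) (subst-rename e B)
subst-rename e (∀[ σ ] A) = ≡.cong (∀[ σ ]_) (subst-rename-lift e A)
subst-rename e (∃[ σ ] A) = ≡.cong (∃[ σ ]_) (subst-rename-lift e A)
subst-rename-lift e = subst-rename λ where
  (here refl) → refl
  (there i)   → ≡.cong wkᵀ (e i)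

subst-var : (A : Formula L Γ) → subst var A ≡ A
subst-var-liftˢ : (A : Formula L (σ ∷ Γ)) → subst (liftˢ var) A ≡ A
subst-var (t ≐ u)    = ≡.cong₂ _≐_ (substᵀ-var t) (substᵀ-var u)
subst-var (std h t)  = ≡.cong (std h) (substᵀ-var t)
subst-var ⊥̇          = refl
subst-var (A ∧ B)    = ≡.cong₂ _∧_ (subst-var A) (subst-var B)
subst-var (A ∨ B)    = ≡.cong₂ _∨_ (subst-var A) (subst-var B)
subst-var (A ⇒ B)    = ≡.cong₂ _⇒_ (subst-var A) (subst-var B)
subst-var (∀[ σ ] A) = ≡.cong (∀[ σ ]_) (subst-var-liftˢ A)
subst-var (∃[ σ ] A) = ≡.cong (∃[ σ ]_) (subst-var-liftˢ A)
subst-var-liftˢ A = ≡.trans (subst-cong (λ { (here refl) → refl ; (there i) → refl }) A) (subst-var A)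

inst-x₀ : (A : Formula L (σ ∷ Γ)) → rename (liftᴿ there) A [ x₀ ] ≡ A
inst-x₀ A = ≡.trans (subst-rename (λ { (here refl) → refl ; (there i) → refl }) A) (subst-var A)

-- Unlike with ∀E, the formula A is known when A [ t ] is compared with B.
∀e : {T : Theory L} {H : List (Formula L Γ)} {A : Formula L (σ ∷ Γ)} {B : Formula L Γ} →
     T ∣ H ⊢ ∀[ σ ] A → (t : Term L Γ σ) → A [ t ] ≡ B → T ∣ H ⊢ B
∀e d t refl = ∀E d t

-- Derived rules of natural deduction

infix -1 _⊩_
_⊩_ : List (Formula ℒ^Ω Γ) → Formula ℒ^Ω Γ → Set
H ⊩ A = (RCA₀^Ω ⊕ STP) ∣ H ⊢ A

variable
  H H′ : List (Formula ℒ^Ω Γ)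
  A B C D E F : Formula ℒ^Ω Γ
  a b c d e t u v w : Term ℒ^Ω Γ 𝟎
  f g h k : Term ℒ^Ω Γ 𝟏

keep : H ⊆ H′ → (A ∷ H) ⊆ (A ∷ H′)
keep r (here p)  = here p
keep r (there i) = there (r i)

weaken : H ⊆ H′ → H ⊩ A → H′ ⊩ A
weaken r (axiom x)   = axiom x
weaken r (hyp i)     = hyp (r i)
weaken r (raa d)     = raa (weaken (keep r) d)
weaken r (⇒I d)      = ⇒I (weaken (keep r) d)
weaken r (⇒E d e)    = ⇒E (weaken r d) (weaken r e)
weaken r (∧I d e)    = ∧I (weaken r d) (weaken r e)
weaken r (∧E₁ d)     = ∧E₁ (weaken r d)
weaken r (∧E₂ d)     = ∧E₂ (weaken r d)
weaken r (∨I₁ d)     = ∨I₁ (weaken r d)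
weaken r (∨I₂ d)     = ∨I₂ (weaken r d)
weaken r (∨E d e e′) = ∨E (weaken r d) (weaken (keep r) e) (weaken (keep r) e′)
weaken r (∀I d)      = ∀I (weaken (map⁺ wk r) d)
weaken r (∀E d t)    = ∀E (weaken r d) t
weaken r (∃I t d)    = ∃I t (weaken r d)
weaken r (∃E d e)    = ∃E (weaken r d) (weaken (keep (map⁺ wk r)) e)

coe : {H : List (Formula ℒ^Ω Γ)} {A B : Formula ℒ^Ω Γ} → A ≡ B → H ⊩ A → H ⊩ B
coe refl d = d

h₀ : A ∷ H ⊩ A
h₀ = hyp (here refl)

h₁ : B ∷ A ∷ H ⊩ A
h₁ = hyp (there (here refl))

h₂ : C ∷ B ∷ A ∷ H ⊩ A
h₂ = hyp (there (there (here refl)))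

h₃ : D ∷ C ∷ B ∷ A ∷ H ⊩ A
h₃ = hyp (there (there (there (here refl))))

h₄ : E ∷ D ∷ C ∷ B ∷ A ∷ H ⊩ A
h₄ = hyp (there (there (there (there (here refl)))))

h₅ : F ∷ E ∷ D ∷ C ∷ B ∷ A ∷ H ⊩ A
h₅ = hyp (there (there (there (there (there (here refl))))))

h₆ : ∀ {A₆} → A₆ ∷ F ∷ E ∷ D ∷ C ∷ B ∷ A ∷ H ⊩ A
h₆ = hyp (there (there (there (there (there (there (here refl)))))))

h₇ : ∀ {A₆ A₇} → A₇ ∷ A₆ ∷ F ∷ E ∷ D ∷ C ∷ B ∷ A ∷ H ⊩ A
h₇ = hyp (there (there (there (there (there (there (there (here refl))))))))

↑_ : H ⊩ A → B ∷ H ⊩ A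
↑_ = weaken there

cut : H ⊩ A → A ∷ H ⊩ B → H ⊩ B
cut d e = ⇒E (⇒I e) d

⊥E : H ⊩ ⊥̇ → H ⊩ A
⊥E d = raa (↑ d)

absurd : H ⊩ ¬ A → H ⊩ A → H ⊩ B
absurd d e = ⊥E (⇒E d e)

excluded-middle : ∀ A → H ⊩ A ∨ ¬ A
excluded-middle A = raa (⇒E h₀ (∨I₂ (⇒I (⇒E h₁ (∨I₁ h₀)))))

cases : ∀ A → A ∷ H ⊩ B → (¬ A) ∷ H ⊩ B → H ⊩ B
cases A = ∨E (excluded-middle A)

∀E▸ : (A : Formula ℒ^Ω (σ ∷ Γ)) {s : Subst ℒ^Ω Γ Δ} {H : List (Formula ℒ^Ω Δ)} →
      H ⊩ subst s (∀[ σ ] A) → (t : Term ℒ^Ω Δ σ) → H ⊩ subst (s ▸ t) A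
∀E▸ A d t = coe (∀[]-inst A t) (∀E d t)

∀E₂ : (A : Formula ℒ^Ω (σ ∷ ρ ∷ [])) {H : List (Formula ℒ^Ω Δ)} → H ⊩ subst ε (∀[ ρ ] ∀[ σ ] A) →
  (t : Term ℒ^Ω Δ ρ) (u : Term ℒ^Ω Δ σ) → H ⊩ subst (ε ▸ t ▸ u) A
∀E₂ A d t = ∀E▸ A (∀E▸ (∀[ _ ] A) d t)

∀E₃ : (A : Formula ℒ^Ω (τ ∷ σ ∷ ρ ∷ [])) {H : List (Formula ℒ^Ω Δ)} → H ⊩ subst ε (∀[ ρ ] ∀[ σ ] ∀[ τ ] A) →
  (t : Term ℒ^Ω Δ ρ) (u : Term ℒ^Ω Δ σ) (v : Term ℒ^Ω Δ τ) → H ⊩ subst (ε ▸ t ▸ u ▸ v) A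
∀E₃ A d t u = ∀E▸ A (∀E₂ (∀[ _ ] A) d t u)

∀E₄ : ∀ {ρ′} (A : Formula ℒ^Ω (ρ′ ∷ τ ∷ σ ∷ ρ ∷ [])) {H : List (Formula ℒ^Ω Δ)} →
  H ⊩ subst ε (∀[ ρ ] ∀[ σ ] ∀[ τ ] ∀[ ρ′ ] A) →
  (t : Term ℒ^Ω Δ ρ) (u : Term ℒ^Ω Δ σ) (v : Term ℒ^Ω Δ τ) (w : Term ℒ^Ω Δ ρ′) → H ⊩ subst (ε ▸ t ▸ u ▸ v ▸ w) A
∀E₄ A d t u v = ∀E▸ A (∀E₃ (∀[ _ ] A) d t u v)

-- Extensional equality and the β-rule for bracket abstraction

infix  4 _⊩_≈_
_⊩_≈_ : List (Formula ℒ^Ω Γ) → Term ℒ^Ω Γ σ → Term ℒ^Ω Γ σ → Set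
_⊩_≈_ {σ = σ} H t u = H ⊩ eq σ t u

ax : RCA₀^ω A → H ⊩ A
ax = axiom ∘ old ∘ base

≐-sy : H ⊩ t ≐ u → H ⊩ u ≐ t
≐-sy = ⇒E (ax (≐-sym _ _))

infixr 3 _⟫_
_⟫_ : H ⊩ t ≐ u → H ⊩ u ≐ v → H ⊩ t ≐ v
d ⟫ e = ⇒E (ax (≐-trans _ _ _)) (∧I d e)

≐-re : H ⊩ t ≐ t
≐-re = ax (≐-refl _)

ap : (f : Term ℒ^Ω Γ (σ ⟶ τ)) {t u : Term ℒ^Ω Γ σ} → H ⊩ t ≈ u → H ⊩ f · t ≈ f · u
ap f = ⇒E (ax (ext _ _ f))

≈-at : {f g : Term ℒ^Ω Γ (σ ⟶ τ)} → H ⊩ f ≈ g → (t : Term ℒ^Ω Γ σ) → H ⊩ f · t ≈ g · t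
≈-at {τ = τ} {f = f} {g} d t = coe
  (≡.trans (subst-eq τ) (≡.cong₂ (λ f g → eq τ (f · t) (g · t)) (substᵀ-inst-wkᵀ f) (substᵀ-inst-wkᵀ g)))
  (∀E d t)

≈-refl : (t : Term ℒ^Ω Γ σ) → H ⊩ t ≈ t
≈-refl {σ = 𝟎}     t = ≐-re
≈-refl {σ = σ ⟶ τ} t = ∀I (≈-refl _)
≈-refl {σ = σ ✶}   t = ∧I ≐-re (∀I (⇒I (≈-refl _)))

<-resp : H ⊩ u ≐ v → H ⊩ t < u → H ⊩ t < v
<-resp d e = ap (monus · su _) (≐-sy d) ⟫ e

elt-at : {t u : Term ℒ^Ω Γ (σ ✶)} → H ⊩ t ≈ u → (i : Term ℒ^Ω Γ 𝟎) →
  H ⊩ i < con len · t → H ⊩ con elt · t · i ≈ con elt · u · i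
elt-at {σ = σ} {t = t} {u} d i e = ⇒E (coe
  (≡.cong₂ _⇒_ (≡.cong (λ t → i < con len · t) (substᵀ-inst-wkᵀ t))
    (≡.trans (subst-eq σ) (≡.cong₂ (λ t u → eq σ (con elt · t · i) (con elt · u · i))
      (substᵀ-inst-wkᵀ t) (substᵀ-inst-wkᵀ u))))
  (∀E (∧E₂ d) i)) e

-- At a variable type `eq` does not unfold, so `rename` is stuck on an equation that has been moved
-- under a binder; `rename-eq` makes it usable as a hypothesis.
≈h₀ : (r : Γ ⊆ Δ) {t u : Term ℒ^Ω Γ σ} → rename r (eq σ t u) ∷ H ⊩ renameᵀ r t ≈ renameᵀ r u
≈h₀ {σ = σ} r = coe (rename-eq σ) h₀

≈h₁ : (r : Γ ⊆ Δ) {t u : Term ℒ^Ω Γ σ} → A ∷ rename r (eq σ t u) ∷ H ⊩ renameᵀ r t ≈ renameᵀ r u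
≈h₁ {σ = σ} r = coe (rename-eq σ) h₁

≈h₂ : (r : Γ ⊆ Δ) {t u : Term ℒ^Ω Γ σ} → B ∷ A ∷ rename r (eq σ t u) ∷ H ⊩ renameᵀ r t ≈ renameᵀ r u
≈h₂ {σ = σ} r = coe (rename-eq σ) h₂

≈-sym′ : ∀ σ {t u : Term ℒ^Ω Γ σ} → H ⊩ eq σ t u ⇒ eq σ u t
≈-sym′ 𝟎       = ax (≐-sym _ _)
≈-sym′ (σ ⟶ τ) = ⇒I (∀I (⇒E (≈-sym′ τ) (≈-at (≈h₀ {σ = σ ⟶ τ} there) x₀)))
≈-sym′ (σ ✶)   = ⇒I (∧I (≐-sy (∧E₁ h₀)) (∀I (⇒I (⇒E (≈-sym′ σ)
  -- The indices in `eq` are bounded by the length of the left sequence, so exchanging the sides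
  -- moves the bound along the equality of lengths.
  (elt-at (≈h₁ {σ = σ ✶} there) x₀ (<-resp (≐-sy (∧E₁ (≈h₁ {σ = σ ✶} there))) h₀))))))

≈-trans′ : ∀ σ {t u v : Term ℒ^Ω Γ σ} → H ⊩ eq σ t u ⇒ eq σ u v ⇒ eq σ t v
≈-trans′ 𝟎       = ⇒I (⇒I (h₁ ⟫ h₀))
≈-trans′ (σ ⟶ τ) = ⇒I (⇒I (∀I (⇒E (⇒E (≈-trans′ τ)
  (≈-at (≈h₁ {σ = σ ⟶ τ} there) x₀)) (≈-at (≈h₀ {σ = σ ⟶ τ} there) x₀))))
≈-trans′ (σ ✶)   = ⇒I (⇒I (∧I (∧E₁ h₁ ⟫ ∧E₁ h₀) (∀I (⇒I (⇒E (⇒E (≈-trans′ σ)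
  (elt-at (≈h₂ {σ = σ ✶} there) x₀ h₀))
  (elt-at (≈h₁ {σ = σ ✶} there) x₀ (<-resp (∧E₁ (≈h₂ {σ = σ ✶} there)) h₀)))))))

≈-sym : {t u : Term ℒ^Ω Γ σ} → H ⊩ t ≈ u → H ⊩ u ≈ t
≈-sym = ⇒E (≈-sym′ _)

≈-trans : {t u v : Term ℒ^Ω Γ σ} → H ⊩ t ≈ u → H ⊩ u ≈ v → H ⊩ t ≈ v
≈-trans d e = ⇒E (⇒E (≈-trans′ _) d) e

_⟨·⟩_ : {f g : Term ℒ^Ω Γ (σ ⟶ τ)} {t u : Term ℒ^Ω Γ σ} → H ⊩ f ≈ g → H ⊩ t ≈ u → H ⊩ f · t ≈ g · u
_⟨·⟩_ {g = g} {t} d e = ≈-trans (≈-at d t) (ap g e)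

module _ (s : Subst ℒ^Ω Γ Δ) {σ : Type} (v : Term ℒ^Ω Δ σ) {H : List (Formula ℒ^Ω Δ)} where

  Bracket-β : Absᵀ ℒ^Ω Γ σ τ → Term ℒ^Ω Δ τ → Set
  Bracket-β (inj₁ t) r = H ⊩ substᵀ s t ≈ r
  Bracket-β (inj₂ t) r = H ⊩ substᵀ s t · v ≈ r

  bracket-·-β : (p : Absᵀ ℒ^Ω Γ σ (ρ ⟶ τ)) (q : Absᵀ ℒ^Ω Γ σ ρ) {t : Term ℒ^Ω Δ (ρ ⟶ τ)} {u : Term ℒ^Ω Δ ρ} →
    Bracket-β p t → Bracket-β q u → Bracket-β (bracket-· p q) (t · u)
  bracket-·-β (inj₁ t) (inj₁ u) d e = d ⟨·⟩ e
  bracket-·-β (inj₁ t) (inj₂ u) d e = ≈-trans (ax (Σ-eq _ _ _)) (≈-trans (ax (Π-eq _ _)) d ⟨·⟩ e)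
  bracket-·-β (inj₂ t) (inj₁ u) d e = ≈-trans (ax (Σ-eq _ _ _)) (d ⟨·⟩ ≈-trans (ax (Π-eq _ _)) e)
  bracket-·-β (inj₂ t) (inj₂ u) d e = ≈-trans (ax (Σ-eq _ _ _)) (d ⟨·⟩ e)

  bracket-β : (b : Term ℒ^Ω (σ ∷ Γ) τ) → Bracket-β (bracket b) (substᵀ (s ▸ v) b)
  bracket-β (var (here refl)) = ≈-trans (ax (Σ-eq _ _ _)) (ax (Π-eq _ _))
  bracket-β (var (there i))   = ≈-refl (s i)
  bracket-β (con c)           = ≈-refl (con c)
  bracket-β (t · u)           = bracket-·-β (bracket t) (bracket u) (bracket-β t) (bracket-β u)

  -- Parameters enter through `s`. On a concrete body `bracket` computes, while a body containing
  -- arbitrary terms would block it; this is why functionals with parameters are written below as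
  -- `substᵀ` of a closed abstraction.
  β : (b : Term ℒ^Ω (σ ∷ Γ) τ) → H ⊩ substᵀ s (ƛ b) · v ≈ substᵀ (s ▸ v) b
  β b with bracket b | bracket-β b
  ... | inj₁ t | d = ≈-trans (ax (Π-eq _ _)) d
  ... | inj₂ t | d = d

β₂ : (s : Subst ℒ^Ω Γ Δ) (u : Term ℒ^Ω Δ ρ) (v : Term ℒ^Ω Δ σ) (b : Term ℒ^Ω (σ ∷ ρ ∷ Γ) τ) →
  H ⊩ substᵀ s (ƛ (ƛ b)) · u · v ≈ substᵀ (s ▸ u ▸ v) b
β₂ s u v b = ≈-trans (≈-at (β s u (ƛ b)) v) (β (s ▸ u) v b)

β₃ : ∀ {ρ′} (s : Subst ℒ^Ω Γ Δ) (t : Term ℒ^Ω Δ ρ′) (u : Term ℒ^Ω Δ ρ) (v : Term ℒ^Ω Δ σ) (b : Term ℒ^Ω (σ ∷ ρ ∷ ρ′ ∷ Γ) τ) →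
  H ⊩ substᵀ s (ƛ (ƛ (ƛ b))) · t · u · v ≈ substᵀ (s ▸ t ▸ u ▸ v) b
β₃ s t u v b = ≈-trans (≈-at (β₂ s t u (ƛ b)) v) (β (s ▸ t ▸ u) v b)

cong₁ : (f : Term ℒ^Ω Γ 𝟏) → H ⊩ t ≐ u → H ⊩ f · t ≐ f · u
cong₁ f = ap f

cong₂ : (f : Term ℒ^Ω Γ (𝟎 ⟶ 𝟎 ⟶ 𝟎)) → H ⊩ t ≐ u → H ⊩ v ≐ w → H ⊩ f · t · v ≐ f · u · w
cong₂ f p q = ap f p ⟨·⟩ q

cong▸ : (s : Subst ℒ^Ω Γ Δ) (c : Term ℒ^Ω (σ ∷ Γ) τ) {t u : Term ℒ^Ω Δ σ} →
  H ⊩ t ≈ u → H ⊩ substᵀ (s ▸ t) c ≈ substᵀ (s ▸ u) c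
cong▸ s (var (here refl)) d = d
cong▸ s (var (there i))   d = ≈-refl (s i)
cong▸ s (con c)           d = ≈-refl (con c)
cong▸ s (c · c′)          d = cong▸ s c d ⟨·⟩ cong▸ s c′ d

su-cong : H ⊩ t ≐ u → H ⊩ su t ≐ su u
su-cong = ap (con S)

-- The induction formula is given by a template A, whose free variables are
-- the induction variable and those that s replaces.
induction : (A : Formula ℒ^Ω (𝟎 ∷ Γ)) → QuantifierFree A → (s : Subst ℒ^Ω Γ Δ) {H : List (Formula ℒ^Ω Δ)} →
  H ⊩ subst (s ▸ ze) A →
  subst (wkˢ s ▸ x₀) A ∷ map wk H ⊩ subst (wkˢ s ▸ su x₀) A →
  (n : Term ℒ^Ω Δ 𝟎) → H ⊩ subst (s ▸ n) A
induction A qf s {H} d e n = coe (∀[]-inst A n) (∀E (⇒E (ax (QF-IND (subst (liftˢ s) A) (qf-subst A qf)))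
  (∧I (coe (≡.sym (∀[]-inst A ze)) d)
    (∀I (⇒I (≡.subst (λ B → B ∷ map wk H ⊩ subst sucˢ (subst (liftˢ s) A)) hyp-eq (coe step-eq e)))))) n)
  where
  qf-subst : ∀ {Γ Δ} {s : Subst ℒ^Ω Γ Δ} (A : Formula ℒ^Ω Γ) → QuantifierFree A → QuantifierFree (subst s A)
  qf-subst (_ ≐ _) _ = tt
  qf-subst ⊥̇ _ = tt
  qf-subst (A ∧ B) (p , q) = qf-subst A p , qf-subst B q
  qf-subst (A ∨ B) (p , q) = qf-subst A p , qf-subst B q
  qf-subst (A ⇒ B) (p , q) = qf-subst A p , qf-subst B q

  hyp-eq : subst (wkˢ s ▸ x₀) A ≡ subst (liftˢ s) A
  hyp-eq = subst-cong (λ { (here refl) → refl ; (there i) → refl }) A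

  step-eq : subst (wkˢ s ▸ su x₀) A ≡ subst sucˢ (subst (liftˢ s) A)
  step-eq = ≡.sym (subst-subst (λ { (here refl) → refl ; (there i) → wkᵀ-sucˢ (s i) }) A)
    where
    wkᵀ-sucˢ : ∀ {Δ σ} (t : Term ℒ^Ω Δ σ) → substᵀ sucˢ (wkᵀ t) ≡ wkᵀ t
    wkᵀ-sucˢ (var _) = refl
    wkᵀ-sucˢ (con _) = refl
    wkᵀ-sucˢ (t · u) = ≡.cong₂ _·_ (wkᵀ-sucˢ t) (wkᵀ-sucˢ u)

-- Recursion equations and arithmetic

rec-ze : (z : Term ℒ^Ω Γ 𝟎) {r : Term ℒ^Ω Γ (𝟎 ⟶ 𝟎 ⟶ 𝟎)} → H ⊩ con R₀ · ze · z · r ≐ z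
rec-ze z = ax (R₀-zero _ _)

rec-su : (s : Subst ℒ^Ω Γ Δ) {H : List (Formula ℒ^Ω Δ)} (n z : Term ℒ^Ω Δ 𝟎) (r : Term ℒ^Ω (𝟎 ∷ 𝟎 ∷ Γ) 𝟎) →
  H ⊩ con R₀ · su n · z · substᵀ s (ƛ (ƛ r)) ≐
      substᵀ (s ▸ con R₀ · n · z · substᵀ s (ƛ (ƛ r)) ▸ n) r
rec-su s n z r = ax (R₀-suc _ _ _) ⟫ β₂ s _ n r

rec-cong : {m n z : Term ℒ^Ω Γ 𝟎} {r : Term ℒ^Ω Γ (𝟎 ⟶ 𝟎 ⟶ 𝟎)} → H ⊩ m ≐ n →
  H ⊩ con R₀ · m · z · r ≐ con R₀ · n · z · r
rec-cong {z = z} {r} d = ≈-at (≈-at (ap (con R₀) d) z) r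

const₂ : {m n p : Term ℒ^Ω Γ 𝟎} → H ⊩ con Π · (con Π · m) · n · p ≐ m
const₂ {p = p} = ≈-at (ax (Π-eq _ _)) p ⟫ ax (Π-eq _ _)

infixl 8 _+_ _∸_
_+_ _∸_ : Term ℒ^Ω Γ 𝟎 → Term ℒ^Ω Γ 𝟎 → Term ℒ^Ω Γ 𝟎
a + b = add · a · b
a ∸ b = monus · a · b

one : Term ℒ^Ω Γ 𝟎
one = su ze

add-cong : H ⊩ a ≐ b → H ⊩ c ≐ d → H ⊩ a + c ≐ b + d
add-cong = cong₂ add

monus-cong : H ⊩ a ≐ b → H ⊩ c ≐ d → H ⊩ a ∸ c ≐ b ∸ d
monus-cong = cong₂ monus

+-ze : ∀ a → H ⊩ a + ze ≐ a
+-ze a = β₂ ε a ze (con R₀ · x₀ · x₁ · ƛ (ƛ (su x₁))) ⟫ rec-ze a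

+-su : ∀ a b → H ⊩ a + su b ≐ su (a + b)
+-su a b = β₂ ε a (su b) body ⟫ rec-su ε b a (su x₁) ⟫ su-cong (≐-sy (β₂ ε a b body))
  where body = con R₀ · x₀ · x₁ · ƛ (ƛ (su x₁))

pred-ze : H ⊩ pred · ze ≐ ze {Γ = Γ}
pred-ze = β ε ze (con R₀ · x₀ · ze · ƛ (ƛ x₀)) ⟫ rec-ze ze

pred-su : ∀ a → H ⊩ pred · su a ≐ a
pred-su a = β ε (su a) (con R₀ · x₀ · ze · ƛ (ƛ x₀)) ⟫ rec-su ε a ze x₀

∸-ze : ∀ a → H ⊩ a ∸ ze ≐ a
∸-ze a = β₂ ε a ze (con R₀ · x₀ · x₁ · ƛ (ƛ (pred · x₁))) ⟫ rec-ze a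

∸-su : ∀ a b → H ⊩ a ∸ su b ≐ pred · (a ∸ b)
∸-su a b = β₂ ε a (su b) body ⟫ rec-su ε b a (pred · x₁) ⟫ cong₁ pred (≐-sy (β₂ ε a b body))
  where body = con R₀ · x₀ · x₁ · ƛ (ƛ (pred · x₁))

ze-∸ : ∀ n → H ⊩ ze ∸ n ≐ ze
ze-∸ = induction (ze ∸ x₀ ≐ ze) _ ε (∸-ze ze) (∸-su ze x₀ ⟫ cong₁ pred h₀ ⟫ pred-ze)

su-∸-su : ∀ m n → H ⊩ su m ∸ su n ≐ m ∸ n
su-∸-su m = induction (su x₁ ∸ su x₀ ≐ x₁ ∸ x₀) _ (ε ▸ m)
  (∸-su (su m) ze ⟫ cong₁ pred (∸-ze (su m)) ⟫ pred-su m ⟫ ≐-sy (∸-ze m))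
  (∸-su _ _ ⟫ cong₁ pred h₀ ⟫ ≐-sy (∸-su _ _))

ze-+ : ∀ n → H ⊩ ze + n ≐ n
ze-+ = induction (ze + x₀ ≐ x₀) _ ε (+-ze ze) (+-su _ _ ⟫ su-cong h₀)

su-+ : ∀ m n → H ⊩ su m + n ≐ su (m + n)
su-+ m = induction (su x₁ + x₀ ≐ su (x₁ + x₀)) _ (ε ▸ m)
  (+-ze _ ⟫ su-cong (≐-sy (+-ze m)))
  (+-su _ _ ⟫ su-cong (h₀ ⟫ ≐-sy (+-su _ _)))

+-comm : ∀ m n → H ⊩ m + n ≐ n + m
+-comm m = induction (x₁ + x₀ ≐ x₀ + x₁) _ (ε ▸ m)
  (+-ze m ⟫ ≐-sy (ze-+ m))
  (+-su _ _ ⟫ su-cong h₀ ⟫ ≐-sy (su-+ _ _))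

+-assoc : ∀ m n p → H ⊩ (m + n) + p ≐ m + (n + p)
+-assoc m n = induction ((x₂ + x₁) + x₀ ≐ x₂ + (x₁ + x₀)) _ (ε ▸ m ▸ n)
  (+-ze _ ⟫ cong₁ (add · m) (≐-sy (+-ze n)))
  (+-su _ _ ⟫ su-cong h₀ ⟫ ≐-sy (+-su _ _) ⟫ cong₁ (add · wkᵀ m) (≐-sy (+-su _ _)))

∸-self : ∀ n → H ⊩ n ∸ n ≐ ze
∸-self = induction (x₀ ∸ x₀ ≐ ze) _ ε (∸-ze ze) (su-∸-su _ _ ⟫ h₀)

m+n∸n : ∀ m n → H ⊩ m + n ∸ n ≐ m
m+n∸n m = induction (x₁ + x₀ ∸ x₀ ≐ x₁) _ (ε ▸ m)
  (∸-ze _ ⟫ +-ze m)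
  (monus-cong (+-su _ _) ≐-re ⟫ su-∸-su _ _ ⟫ h₀)

m+n∸m : ∀ m n → H ⊩ m + n ∸ m ≐ n
m+n∸m m n = monus-cong (+-comm m n) ≐-re ⟫ m+n∸n n m

m+n∸m+p : ∀ m n p → H ⊩ (m + n) ∸ (m + p) ≐ n ∸ p
m+n∸m+p m n p = induction ((x₀ + x₂) ∸ (x₀ + x₁) ≐ x₂ ∸ x₁) _ (ε ▸ n ▸ p)
  (monus-cong (ze-+ n) (ze-+ p))
  (monus-cong (su-+ _ _) (su-+ _ _) ⟫ su-∸-su _ _ ⟫ h₀) m

-- Naming the predecessor as `pred · n` keeps the induction formula quantifier-free.
num-cases : ∀ n → n ≐ ze ∷ H ⊩ A → n ≐ su (pred · n) ∷ H ⊩ A → H ⊩ A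
num-cases n = ∨E (induction (x₀ ≐ ze ∨ x₀ ≐ su (pred · x₀)) _ ε (∨I₁ ≐-re)
  (∨I₂ (su-cong (≐-sy (pred-su _)))) n)

su≢ze : H ⊩ a ≐ su b → H ⊩ a ≐ ze → H ⊩ A
su≢ze p q = absurd (ax (su≢0 _)) (≐-sy p ⟫ q)

≤-resp : H ⊩ a ≐ b → H ⊩ c ≐ d → H ⊩ a ≤ c → H ⊩ b ≤ d
≤-resp p q r = monus-cong (≐-sy p) (≐-sy q) ⟫ r

ze≤ : ∀ n → H ⊩ ze ≤ n
ze≤ = ze-∸

≤ze : H ⊩ a ≤ ze → H ⊩ a ≐ ze
≤ze p = ≐-sy (∸-ze _) ⟫ p

≤-refl : ∀ n → H ⊩ n ≤ n
≤-refl = ∸-self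

≐⇒≤ : H ⊩ a ≐ b → H ⊩ a ≤ b
≐⇒≤ p = monus-cong p ≐-re ⟫ ≤-refl _

su≤su : H ⊩ a ≤ b → H ⊩ su a ≤ su b
su≤su p = su-∸-su _ _ ⟫ p

su≤su⁻¹ : H ⊩ su a ≤ su b → H ⊩ a ≤ b
su≤su⁻¹ p = ≐-sy (su-∸-su _ _) ⟫ p

m≤m+n : ∀ m n → H ⊩ m ≤ m + n
m≤m+n m n = monus-cong (≐-sy (+-ze m)) ≐-re ⟫ m+n∸m+p m ze n ⟫ ze-∸ n

m≤n+m : ∀ m n → H ⊩ m ≤ n + m
m≤n+m m n = ≤-resp ≐-re (+-comm m n) (m≤m+n m n)

≤-step : H ⊩ a ≤ b → H ⊩ a ≤ su b
≤-step p = ∸-su _ _ ⟫ cong₁ pred p ⟫ pred-ze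

<⇒≤ : H ⊩ a < b → H ⊩ a ≤ b
<⇒≤ p = su≤su⁻¹ (≤-step p)

<-irrefl : H ⊩ a < a → H ⊩ A
<-irrefl {a = a} p = su≢ze (monus-cong (su-cong (≐-sy (ze-+ a)) ⟫ ≐-sy (su-+ ze a)) ≐-re ⟫ m+n∸n one a) p

-- Induction on `a`. If `b ∸ a` vanished in the step, the induction hypothesis would give `a = b`,
-- against `su a ≤ b`; otherwise one unit moves from the difference to `a`.
m+[n∸m] : H ⊩ a ≤ b → H ⊩ a + (b ∸ a) ≐ b
m+[n∸m] {a = a} {b} = ⇒E (induction (x₀ ≤ x₁ ⇒ x₀ + (x₁ ∸ x₀) ≐ x₁) _ (ε ▸ b)
  (⇒I (ze-+ _ ⟫ ∸-ze b))
  (⇒I (num-cases (wkᵀ b ∸ x₀)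
    (<-irrefl (≤-resp ≐-re (≐-sy (⇒E h₂ (<⇒≤ h₁)) ⟫ cong₁ (add · x₀) h₀ ⟫ +-ze _) h₁))
    (su-+ _ _ ⟫ su-cong (cong₁ (add · x₀) (∸-su _ _)) ⟫ ≐-sy (+-su _ _)
      ⟫ cong₁ (add · x₀) (≐-sy h₀) ⟫ ⇒E h₂ (<⇒≤ h₁)))) a)

≤-trans : H ⊩ a ≤ b → H ⊩ b ≤ c → H ⊩ a ≤ c
≤-trans {a = a} {b} {c} p q = ≤-resp ≐-re
  (≐-sy (+-assoc a (b ∸ a) (c ∸ b)) ⟫ add-cong (m+[n∸m] p) ≐-re ⟫ m+[n∸m] q)
  (m≤m+n a ((b ∸ a) + (c ∸ b)))

≤-antisym : H ⊩ a ≤ b → H ⊩ b ≤ a → H ⊩ a ≐ b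
≤-antisym p q = ≐-sy (+-ze _) ⟫ add-cong ≐-re (≐-sy q) ⟫ m+[n∸m] p

≤-or-> : ∀ m n → H ⊩ m ≤ n ∨ n < m
≤-or-> m = induction (x₁ ≤ x₀ ∨ x₀ < x₁) _ (ε ▸ m)
  (num-cases m (∨I₁ (∸-ze m ⟫ h₀)) (∨I₂ (≤-resp ≐-re (≐-sy h₀) (su≤su (ze≤ _)))))
  (∨E h₀ (∨I₁ (≤-step h₀)) (num-cases (wkᵀ m ∸ su x₀)
    (∨I₁ (≐⇒≤ (≐-sy (m+[n∸m] h₁) ⟫ add-cong ≐-re h₀ ⟫ +-ze _)))
    (∨I₂ (≤-resp ≐-re (≐-sy (+-su _ _) ⟫ add-cong ≐-re (≐-sy h₀) ⟫ m+[n∸m] h₁)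
      (su≤su (m≤m+n (su x₀) _))))))

≤-cases : ∀ m n → m ≤ n ∷ H ⊩ A → n < m ∷ H ⊩ A → H ⊩ A
≤-cases m n = ∨E (≤-or-> m n)

<⇒≱ : H ⊩ a < b → H ⊩ b ≤ a → H ⊩ A
<⇒≱ p q = <-irrefl (≤-trans p q)

<-step-cases : H ⊩ a < su b → a < b ∷ H ⊩ A → a ≐ b ∷ H ⊩ A → H ⊩ A
<-step-cases {a = a} {b = b} p d e = cut (su≤su⁻¹ p) (≤-cases b a
  (cut (≤-antisym h₁ h₀) (weaken (λ { (here p) → here p ; (there i) → there (there (there i)) }) e))
  (weaken (λ { (here p) → here p ; (there i) → there (there i) }) d))
  where open import Data.List.Relation.Unary.Any using (here; there)

+-mono-≤ : H ⊩ a ≤ b → H ⊩ c ≤ d → H ⊩ a + c ≤ b + d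
+-mono-≤ {a = a} {b} {c} {d} p q = ≤-trans (m+n∸m+p a c d ⟫ q)
  (≤-resp (+-comm d a) (+-comm d b) (m+n∸m+p d a b ⟫ p))

pred-≤ : ∀ n → H ⊩ pred · n ≤ n
pred-≤ n = num-cases n (≤-resp (≐-sy (cong₁ pred h₀ ⟫ pred-ze)) ≐-re (ze≤ n))
  (≤-resp ≐-re (≐-sy h₀) (≤-step (≤-refl _)))

∸-≤ : ∀ m n → H ⊩ m ∸ n ≤ m
∸-≤ m = induction (x₁ ∸ x₀ ≤ x₁) _ (ε ▸ m) (≐⇒≤ (∸-ze m))
  (≤-trans (≐⇒≤ (∸-su _ _)) (≤-trans (pred-≤ _) h₀))

m∸[m∸n] : H ⊩ b ≤ a → H ⊩ a ∸ (a ∸ b) ≐ b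
m∸[m∸n] {b = b} {a} p = monus-cong (≐-sy (m+[n∸m] p)) ≐-re ⟫ m+n∸n b (a ∸ b)

1∸ze : H ⊩ a ≐ ze → H ⊩ one ∸ a ≐ one
1∸ze p = monus-cong ≐-re p ⟫ ∸-ze one

1∸su : H ⊩ a ≐ su b → H ⊩ one ∸ a ≐ ze
1∸su p = monus-cong ≐-re p ⟫ su-∸-su _ _ ⟫ ze-∸ _

1∸-ze⁻¹ : H ⊩ one ∸ a ≐ one → H ⊩ a ≐ ze
1∸-ze⁻¹ {a = a} p = num-cases a h₀ (su≢ze (↑ p) (1∸su h₀))

1∸≢ze⁻¹ : H ⊩ ¬ (one ∸ a ≐ ze) → H ⊩ a ≐ ze
1∸≢ze⁻¹ {a = a} p = num-cases a h₀ (absurd (↑ p) (1∸su h₀))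

≢ze⇒1∸ : H ⊩ ¬ (a ≐ ze) → H ⊩ one ∸ a ≐ ze
≢ze⇒1∸ {a = a} p = num-cases a (absurd (↑ p) h₀) (1∸su h₀)

sg-unfold : ∀ a → H ⊩ sg · a ≐ one ∸ (one ∸ a)
sg-unfold a = β ε a (monus · su ze · (monus · su ze · x₀))

sg-ze : H ⊩ a ≐ ze → H ⊩ sg · a ≐ ze
sg-ze p = sg-unfold _ ⟫ 1∸su (1∸ze p)

sg-su : H ⊩ a ≐ su b → H ⊩ sg · a ≐ one
sg-su p = sg-unfold _ ⟫ 1∸ze (1∸su p)

-- Pairing

triangle-ze : H ⊩ triangle · ze ≐ ze {Γ = Γ}
triangle-ze = β ε ze (con R₀ · x₀ · ze · ƛ (ƛ (add · x₁ · su x₀))) ⟫ rec-ze ze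

triangle-su : ∀ n → H ⊩ triangle · su n ≐ triangle · n + su n
triangle-su n = β ε (su n) body ⟫ rec-su ε n ze (add · x₁ · su x₀) ⟫ add-cong (≐-sy (β ε n body)) ≐-re
  where body = con R₀ · x₀ · ze · ƛ (ƛ (add · x₁ · su x₀))

triangle-mono : H ⊩ a ≤ b → H ⊩ triangle · a ≤ triangle · b
triangle-mono {a = a} {b} p = ≤-resp ≐-re (cong₁ triangle (m+[n∸m] p))
  (induction (triangle · x₁ ≤ triangle · (x₁ + x₀)) _ (ε ▸ a)
    (≐⇒≤ (cong₁ triangle (≐-sy (+-ze a))))
    (≤-trans h₀ (≤-resp ≐-re (≐-sy (triangle-su _) ⟫ cong₁ triangle (≐-sy (+-su _ _))) (m≤m+n _ _)))
    (b ∸ a))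

pair-unfold : ∀ m n → H ⊩ pair · m · n ≐ triangle · (m + n) + m
pair-unfold m n = β₂ ε m n (add · (triangle · (add · x₁ · x₀)) · x₁)

pair-mono : H ⊩ a ≤ b → H ⊩ c ≤ d → H ⊩ pair · a · c ≤ pair · b · d
pair-mono p q = ≤-resp (≐-sy (pair-unfold _ _)) (≐-sy (pair-unfold _ _))
  (+-mono-≤ (triangle-mono (+-mono-≤ p q)) p)

diagonal-body : Term ℒ^Ω (𝟎 ∷ Γ) 𝟎
diagonal-body = con R₀ · x₀ · ze · ƛ (ƛ (x₁ + (one ∸ (triangle · su x₁ ∸ su x₀))))

diagonal-ze : H ⊩ diagonal · ze ≐ ze {Γ = Γ}
diagonal-ze = β ε ze diagonal-body ⟫ rec-ze ze

diagonal-su : H ⊩ diagonal · a ≐ b → H ⊩ diagonal · su a ≐ b + (one ∸ (triangle · su b ∸ su a))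
diagonal-su {a = a} p =
  β ε (su a) diagonal-body ⟫ rec-su ε a ze (x₁ + (one ∸ (triangle · su x₁ ∸ su x₀)))
  ⟫ cong▸ (ε ▸ a) (x₀ + (one ∸ (triangle · su x₀ ∸ su x₁))) (≐-sy (β ε a diagonal-body) ⟫ p)

-- For `j ≤ w` the next threshold `triangle · su w` lies above `triangle · w + j`, so the recursion
-- adds nothing. The first premise is the base case; `diagonal-triangle` supplies it by induction on
-- `w`, reaching the next triangle number from `j = w`.
diagonal-stays : ∀ w j → H ⊩ diagonal · (triangle · w) ≐ w ⇒ j ≤ w ⇒ diagonal · (triangle · w + j) ≐ w
diagonal-stays w = induction
  (diagonal · (triangle · x₁) ≐ x₁ ⇒ x₀ ≤ x₁ ⇒ diagonal · (triangle · x₁ + x₀) ≐ x₁) _ (ε ▸ w)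
  (⇒I (⇒I (cong₁ diagonal (+-ze _) ⟫ h₁)))
  (⇒I (⇒I (cong₁ diagonal (+-su _ _) ⟫ diagonal-su (⇒E (⇒E h₂ h₁) (<⇒≤ h₀))
    ⟫ add-cong ≐-re (≢ze⇒1∸ (⇒I (<⇒≱ h₁
      (≐-sy (monus-cong (triangle-su _) (≐-sy (+-su _ _)) ⟫ m+n∸m+p _ _ _ ⟫ su-∸-su _ _) ⟫ h₀))))
    ⟫ +-ze _)))

diagonal-triangle : ∀ w → H ⊩ diagonal · (triangle · w) ≐ w
diagonal-triangle = induction (diagonal · (triangle · x₀) ≐ x₀) _ ε
  (cong₁ diagonal triangle-ze ⟫ diagonal-ze)
  (cong₁ diagonal (triangle-su _ ⟫ +-su _ _)
    ⟫ diagonal-su (⇒E (⇒E (diagonal-stays x₀ x₀) h₀) (≤-refl _))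
    ⟫ add-cong ≐-re (1∸ze (monus-cong (triangle-su _ ⟫ +-su _ _) ≐-re ⟫ ∸-self _))
    ⟫ +-su _ _ ⟫ su-cong (+-ze _))

diagonal-pair : ∀ m n → H ⊩ diagonal · (pair · m · n) ≐ m + n
diagonal-pair m n = cong₁ diagonal (pair-unfold m n)
  ⟫ ⇒E (⇒E (diagonal-stays (m + n) m) (diagonal-triangle _)) (m≤m+n m n)

fst-unfold : ∀ p → H ⊩ fst · p ≐ p ∸ triangle · (diagonal · p)
fst-unfold p = β ε p (x₀ ∸ triangle · (diagonal · x₀))

fst-pair : ∀ m n → H ⊩ fst · (pair · m · n) ≐ m
fst-pair m n = fst-unfold _ ⟫ monus-cong (pair-unfold m n) (cong₁ triangle (diagonal-pair m n)) ⟫ m+n∸m _ m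

snd-pair : ∀ m n → H ⊩ snd · (pair · m · n) ≐ n
snd-pair m n = β ε (pair · m · n) (diagonal · x₀ ∸ fst · x₀)
  ⟫ monus-cong (diagonal-pair m n) (fst-pair m n) ⟫ m+n∸m m n

fst-ze : H ⊩ fst · ze ≐ ze {Γ = Γ}
fst-ze = fst-unfold ze ⟫ ze-∸ _

m≤pair : ∀ m n → H ⊩ m ≤ pair · m · n
m≤pair m n = ≤-resp ≐-re (≐-sy (pair-unfold m n)) (m≤n+m _ _)

-- Codes of sequences

snoc-unfold : ∀ s n → H ⊩ snoc · s · n ≐ su (pair · s · n)
snoc-unfold s n = β₂ ε s n (su (pair · x₁ · x₀))

drop-ze : ∀ s → H ⊩ drop · ze · s ≐ s
drop-ze s = β₂ ε ze s (con R₀ · x₁ · x₀ · ƛ (ƛ (fst · (pred · x₁)))) ⟫ rec-ze s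

drop-su : ∀ n s → H ⊩ drop · su n · s ≐ fst · (pred · (drop · n · s))
drop-su n s = β₂ ε (su n) s body ⟫ rec-su ε n s (fst · (pred · x₁)) ⟫ cong₁ fst (cong₁ pred (≐-sy (β₂ ε n s body)))
  where body = con R₀ · x₁ · x₀ · ƛ (ƛ (fst · (pred · x₁)))

bar-ze : ∀ g → H ⊩ bar · g · ze ≐ ze
bar-ze g = β₂ ε g ze (con R₀ · x₀ · ze · ƛ (ƛ (snoc · x₁ · (x₃ · x₀)))) ⟫ rec-ze ze

bar-su : ∀ g x → H ⊩ bar · g · su x ≐ su (pair · (bar · g · x) · (g · x))
bar-su g x = β₂ ε g (su x) body ⟫ rec-su (ε ▸ g ▸ su x) x ze (snoc · x₁ · (x₃ · x₀))
  ⟫ snoc-unfold _ _ ⟫ su-cong (cong₂ pair (≐-sy (β₂ ε g x body)) ≐-re)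
  where
  body : Term ℒ^Ω (𝟎 ∷ 𝟏 ∷ []) 𝟎
  body = con R₀ · x₀ · ze · ƛ (ƛ (snoc · x₁ · (x₃ · x₀)))

-- `lh · s` counts over `k < s`; by this bound the range of the count covers the whole length.
n≤bar : ∀ g n → H ⊩ n ≤ bar · g · n
n≤bar g = induction (x₀ ≤ bar · x₁ · x₀) _ (ε ▸ g) (ze≤ _)
  (≤-resp ≐-re (≐-sy (bar-su _ _)) (su≤su (≤-trans h₀ (m≤pair _ _))))

drop-bar : ∀ g x k → H ⊩ k ≤ x ⇒ drop · k · (bar · g · x) ≐ bar · g · (x ∸ k)
drop-bar g x = induction (x₀ ≤ x₁ ⇒ drop · x₀ · (bar · x₂ · x₁) ≐ bar · x₂ · (x₁ ∸ x₀)) _ (ε ▸ g ▸ x)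
  (⇒I (drop-ze _ ⟫ cong₁ (bar · g) (≐-sy (∸-ze x))))
  (⇒I (num-cases (wkᵀ x ∸ x₀) (<⇒≱ h₁ h₀)
    (drop-su _ _ ⟫ cong₁ fst (cong₁ pred (⇒E h₂ (<⇒≤ h₁) ⟫ cong₁ (bar · wkᵀ g) h₀ ⟫ bar-su _ _) ⟫ pred-su _)
     ⟫ fst-pair _ _ ⟫ cong₁ (bar · wkᵀ g) (≐-sy (∸-su _ _)))))

-- Once the code is 0 it remains 0, since `pred` and `fst` both fix 0.
drop-bar-all : ∀ g x j → H ⊩ drop · (x + j) · (bar · g · x) ≐ ze
drop-bar-all g x = induction (drop · (x₁ + x₀) · (bar · x₂ · x₁) ≐ ze) _ (ε ▸ g ▸ x)
  (cong₂ drop (+-ze x) ≐-re ⟫ ⇒E (drop-bar g x x) (≤-refl x) ⟫ cong₁ (bar · g) (∸-self x) ⟫ bar-ze g)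
  (cong₂ drop (+-su _ _) ≐-re ⟫ drop-su _ _ ⟫ cong₁ fst (cong₁ pred h₀ ⟫ pred-ze) ⟫ fst-ze)

CountF : Formula ℒ^Ω (𝟎 ∷ 𝟎 ∷ 𝟏 ∷ 𝟏 ∷ Γ)
CountF = x₃ · ze ≐ ze ⇒ (∀[ 𝟎 ] x₄ · su x₀ ≐ x₄ · x₀ + x₃ · x₀)
  ⇒ (∀[ 𝟎 ] x₀ < x₂ ⇒ x₃ · x₀ ≐ one) ⇒ (∀[ 𝟎 ] x₂ ≤ x₀ ⇒ x₀ < x₁ ⇒ x₃ · x₀ ≐ ze)
  ⇒ x₁ ≤ x₀ ⇒ x₃ · x₀ ≐ x₁

-- Up to `a` the sums grow by one at each step, and from `a` on they are constant. Only the
-- recursion equations of `c` enter, so this serves both the recursion inside `lh` and `sumᵗ`.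
count : (c w : Term ℒ^Ω Γ 𝟏) (a b : Term ℒ^Ω Γ 𝟎) → H ⊩ subst (ε ▸ c ▸ w ▸ a ▸ b) CountF
count {Γ} = ∀E₄ CountF (∀I (∀I (∀I (∀I (⇒I (⇒I (⇒I (⇒I (⇒I
  (≐-sy (cong₁ x₃ (m+[n∸m] h₀)) ⟫ ⇒E (beyond (x₀ ∸ x₁)) (≐⇒≤ (m+[n∸m] h₀))))))))))))
  where
  Hyps : List (Formula ℒ^Ω (𝟎 ∷ 𝟎 ∷ 𝟏 ∷ 𝟏 ∷ Γ)) → List (Formula ℒ^Ω (𝟎 ∷ 𝟎 ∷ 𝟏 ∷ 𝟏 ∷ Γ))
  Hyps H = x₁ ≤ x₀ ∷ (∀[ 𝟎 ] x₂ ≤ x₀ ⇒ x₀ < x₁ ⇒ x₃ · x₀ ≐ ze) ∷ (∀[ 𝟎 ] x₀ < x₂ ⇒ x₃ · x₀ ≐ one)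
    ∷ (∀[ 𝟎 ] x₄ · su x₀ ≐ x₄ · x₀ + x₃ · x₀) ∷ x₃ · ze ≐ ze ∷ H
  upto : ∀ n → Hyps H ⊩ n ≤ x₁ ⇒ x₃ · n ≐ n
  upto = induction (x₀ ≤ x₁ ⇒ x₂ · x₀ ≐ x₀) _ (ε ▸ x₃ ▸ x₁)
    (⇒I h₅)
    (⇒I (∀e h₅ x₀ refl ⟫ add-cong (⇒E h₁ (<⇒≤ h₀)) (⇒E (∀e h₄ x₀ refl) h₀) ⟫ +-su _ _ ⟫ su-cong (+-ze _)))
  beyond : ∀ n → Hyps H ⊩ x₁ + n ≤ x₀ ⇒ x₃ · (x₁ + n) ≐ x₁
  beyond = induction (x₁ + x₀ ≤ x₂ ⇒ x₃ · (x₁ + x₀) ≐ x₁) _ (ε ▸ x₃ ▸ x₀ ▸ x₁)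
    (⇒I (cong₁ x₃ (+-ze _) ⟫ ⇒E (↑ upto x₁) (≤-refl _)))
    (⇒I (cut (≤-resp (+-su _ _) ≐-re h₀)
      (cong₁ x₄ (+-su _ _) ⟫ ∀E h₆ (x₂ + x₀)
       ⟫ add-cong (⇒E h₂ (<⇒≤ h₀)) (⇒E (⇒E (∀e h₄ (x₂ + x₀) refl) (m≤m+n _ _)) h₀) ⟫ +-ze _)))

lh-bar : ∀ g x → H ⊩ lh · (bar · g · x) ≐ x
-- In `lh` the code is both the number of steps and the sequence that is counted. `body` separates
-- the two roles, so that the count is available for every number of steps.
lh-bar {Γ} g x = β ε s (con R₀ · x₀ · ze · ƛ (ƛ (x₁ + sg · (drop · x₀ · x₂)))) ⟫ ≐-sy (β (ε ▸ s) s body) ⟫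
  ⇒E (⇒E (⇒E (⇒E (⇒E (count (substᵀ (ε ▸ s) (ƛ body)) (substᵀ (ε ▸ s) (ƛ summand)) x s)
    (β (ε ▸ s) ze body ⟫ rec-ze ze))
    (∀I (β (ε ▸ wkᵀ s) (su x₀) body ⟫ rec-su (ε ▸ wkᵀ s ▸ su x₀) x₀ ze (x₁ + sg · (drop · x₀ · x₃))
      ⟫ add-cong (≐-sy (β (ε ▸ wkᵀ s) x₀ body)) (≐-sy (β (ε ▸ wkᵀ s) x₀ summand)))))
    (∀I (⇒I (β (ε ▸ wkᵀ s) x₀ summand ⟫ cong₁ sg (⇒E (drop-bar (wkᵀ g) (wkᵀ x) x₀) (<⇒≤ h₀))
      ⟫ num-cases (wkᵀ x ∸ x₀) (<⇒≱ h₁ h₀) (sg-su (cong₁ (bar · wkᵀ g) h₀ ⟫ bar-su _ _))))))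
    (∀I (⇒I (⇒I (β (ε ▸ wkᵀ s) x₀ summand ⟫ sg-ze (cong₂ drop (≐-sy (m+[n∸m] h₁)) ≐-re ⟫ drop-bar-all (wkᵀ g) (wkᵀ x) _))))))
    (n≤bar g x)
  where
  s : Term ℒ^Ω Γ 𝟎
  s = bar · g · x
  body : Term ℒ^Ω (𝟎 ∷ 𝟎 ∷ []) 𝟎
  body = con R₀ · x₀ · ze · ƛ (ƛ (x₁ + sg · (drop · x₀ · x₃)))
  summand : Term ℒ^Ω (𝟎 ∷ 𝟎 ∷ []) 𝟎
  summand = sg · (drop · x₀ · x₁)

ent-unfold : ∀ s i → H ⊩ ent · s · i ≐ snd · (pred · (drop · (lh · s ∸ su i) · s))
ent-unfold s i = β₂ ε s i (snd · (pred · (drop · (lh · x₁ ∸ su x₀) · x₁)))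

ent-bar : ∀ g x i → H ⊩ i < x → H ⊩ ent · (bar · g · x) · i ≐ g · i
ent-bar {H = H} g x i p = ent-unfold _ i ⟫ cong₁ snd (cong₁ pred drop-ent ⟫ pred-su _) ⟫ snd-pair _ _
  where
  drop-ent : H ⊩ drop · (lh · (bar · g · x) ∸ su i) · (bar · g · x) ≐ su (pair · (bar · g · i) · (g · i))
  drop-ent = cong₂ drop (monus-cong (lh-bar g x) ≐-re) ≐-re
    ⟫ ⇒E (drop-bar g x (x ∸ su i)) (∸-≤ x (su i)) ⟫ cong₁ (bar · g) (m∸[m∸n] p) ⟫ bar-su g i

-- Bounded sums and bounded search

sumᵗ : Term ℒ^Ω Γ (𝟏 ⟶ 𝟎 ⟶ 𝟎)
sumᵗ = ƛ (ƛ (con R₀ · x₀ · ze · ƛ (ƛ (x₁ + x₃ · x₀))))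

sum-ze : ∀ f → H ⊩ sumᵗ · f · ze ≐ ze
sum-ze f = β₂ ε f ze (con R₀ · x₀ · ze · ƛ (ƛ (x₁ + x₃ · x₀))) ⟫ rec-ze ze

sum-su : ∀ f n → H ⊩ sumᵗ · f · su n ≐ sumᵗ · f · n + f · n
sum-su f n = β₂ ε f (su n) body ⟫ rec-su (ε ▸ f ▸ n) n ze (x₁ + x₃ · x₀)
  ⟫ add-cong (≐-sy (β₂ ε f n body)) ≐-re
  where
  body : Term ℒ^Ω (𝟎 ∷ 𝟏 ∷ []) 𝟎
  body = con R₀ · x₀ · ze · ƛ (ƛ (x₁ + x₃ · x₀))

≤-sum : ∀ f i n → H ⊩ i < n → H ⊩ f · i ≤ sumᵗ · f · n
≤-sum f i n = ⇒E (induction (x₁ < x₀ ⇒ x₂ · x₁ ≤ sumᵗ · x₂ · x₀) _ (ε ▸ f ▸ i)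
  (⇒I (su≢ze ≐-re (≤ze h₀)))
  (⇒I (≤-resp ≐-re (≐-sy (sum-su _ _)) (<-step-cases h₀
    (≤-trans (⇒E h₂ h₀) (m≤m+n _ _))
    (≤-trans (≐⇒≤ (cong₁ (wkᵀ f) h₀)) (m≤n+m _ _))))) n)

-- Not multiplication: the step ignores the previous value, so the result is `b` for every positive
-- `a`. The zeros are those of the product.
times : Term ℒ^Ω Γ 𝟎 → Term ℒ^Ω Γ 𝟎 → Term ℒ^Ω Γ 𝟎
times a b = con R₀ · a · ze · (con Π · (con Π · b))

times-ze : H ⊩ a ≐ ze → H ⊩ times a b ≐ ze
times-ze p = rec-cong p ⟫ rec-ze ze

times-su : H ⊩ a ≐ su c → H ⊩ times a b ≐ b
times-su p = rec-cong p ⟫ ax (R₀-suc _ _ _) ⟫ const₂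

-- productᵗ · h · n vanishes exactly when h has a zero below n.
productᵗ : Term ℒ^Ω Γ (𝟏 ⟶ 𝟎 ⟶ 𝟎)
productᵗ = ƛ (ƛ (con R₀ · x₀ · one · ƛ (ƛ (times x₁ (x₃ · x₀)))))

product-ze : ∀ f → H ⊩ productᵗ · f · ze ≐ one
product-ze f = β₂ ε f ze (con R₀ · x₀ · one · ƛ (ƛ (times x₁ (x₃ · x₀)))) ⟫ rec-ze one

product-su : ∀ f n → H ⊩ productᵗ · f · su n ≐ times (productᵗ · f · n) (f · n)
product-su f n = β₂ ε f (su n) body ⟫ rec-su (ε ▸ f ▸ n) n one (times x₁ (x₃ · x₀))
  ⟫ rec-cong (≐-sy (β₂ ε f n body))
  where
  body : Term ℒ^Ω (𝟎 ∷ 𝟏 ∷ []) 𝟎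
  body = con R₀ · x₀ · one · ƛ (ƛ (times x₁ (x₃ · x₀)))

product-zero : ∀ f i n → H ⊩ i < n → H ⊩ f · i ≐ ze → H ⊩ productᵗ · f · n ≐ ze
product-zero f i n p = ⇒E (⇒E (induction (x₁ < x₀ ⇒ x₂ · x₁ ≐ ze ⇒ productᵗ · x₂ · x₀ ≐ ze) _ (ε ▸ f ▸ i)
  (⇒I (su≢ze ≐-re (≤ze h₀)))
  (⇒I (⇒I (product-su _ _ ⟫ <-step-cases h₁
    (times-ze (⇒E (⇒E h₃ h₀) h₁))
    (num-cases (productᵗ · wkᵀ f · x₀) (times-ze h₀)
      (times-su h₀ ⟫ cong₁ (wkᵀ f) (≐-sy h₁) ⟫ h₂))))) n) p)

HasZero : Formula ℒ^Ω (𝟎 ∷ 𝟏 ∷ Γ)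
HasZero = productᵗ · x₁ · x₀ ≐ ze ⇒ (∃[ 𝟎 ] x₀ < x₁ ∧ x₂ · x₀ ≐ ze)

-- The conclusion is existential and hence no induction formula. Assuming that no zero lies below
-- `n`, a quantifier-free induction shows instead that the products up to `n` are nonzero.
product-zero⁻¹ : (f : Term ℒ^Ω Γ 𝟏) (n : Term ℒ^Ω Γ 𝟎) → H ⊩ subst (ε ▸ f ▸ n) HasZero
product-zero⁻¹ = ∀E₂ HasZero $ ∀I $ ∀I $ ⇒I $ raa $ ⇒E (⇒E (induction
  (x₀ ≤ x₁ ⇒ ¬ productᵗ · x₂ · x₀ ≐ ze) _ (ε ▸ x₁ ▸ x₀)
  (⇒I (⇒I (su≢ze (product-ze _) h₀)))
  (⇒I (⇒I (num-cases (productᵗ · x₂ · x₀)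
    (⇒E (⇒E h₃ (<⇒≤ h₂)) h₀)
    (⇒E h₄ (∃I x₀ (∧I h₂ (≐-sy (times-su h₀) ⟫ ≐-sy (product-su _ _) ⟫ h₁)))))))
  x₀) (≤-refl _)) h₁

min : Term ℒ^Ω Γ 𝟎 → Term ℒ^Ω Γ 𝟎 → Term ℒ^Ω Γ 𝟎
min a b = a ∸ (a ∸ b)

min-≤ : ∀ a b → H ⊩ min a b ≤ b
min-≤ a b = ≤-cases a b (≤-trans (∸-≤ a _) h₀) (≐⇒≤ (m∸[m∸n] (<⇒≤ h₀)))

min-≡ : H ⊩ a ≤ b → H ⊩ min a b ≐ a
min-≡ p = monus-cong ≐-re p ⟫ ∸-ze _

-- Closure properties of standardness

axᵒ : RCA₀^Ω A → H ⊩ A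
axᵒ = axiom ∘ old

st-· : {t : Term ℒ^Ω Γ (σ ⟶ τ)} {u : Term ℒ^Ω Γ σ} → H ⊩ st t → H ⊩ st u → H ⊩ st (t · u)
st-· d e = ⇒E (axᵒ (st-app _ _)) (∧I d e)

st-con : (c : Const ℒ^Ω σ) → H ⊩ st (con c)
st-con c = axᵒ (st-clo (con c))

st-substᵀ : {s : Subst ℒ^Ω Γ Δ} {H : List (Formula ℒ^Ω Δ)} (t : Term ℒ^Ω Γ σ) →
  (∀ {τ} (i : τ ∈ Γ) → H ⊩ st (s i)) → H ⊩ st (substᵀ s t)
st-substᵀ (var i) e = e i
st-substᵀ (con c) e = st-con c
st-substᵀ (t · u) e = st-· (st-substᵀ t e) (st-substᵀ u e)

st-ze : H ⊩ st {Γ = Γ} ze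
st-ze = st-con O

st-su : H ⊩ st t → H ⊩ st (su t)
st-su = st-· (st-con S)

st-below : H ⊩ st b → H ⊩ a ≤ b → H ⊩ st a
st-below d e = ⇒E (axᵒ (st-≤ _ _)) (∧I d e)

st-<Ω : H ⊩ st a → H ⊩ ¬ st b → H ⊩ a < b
st-<Ω {a = a} {b} d e = ≤-cases b a (absurd (↑ e) (st-below (↑ d) h₀)) h₀

sum-count : (w : Term ℒ^Ω Γ 𝟏) (a b : Term ℒ^Ω Γ 𝟎) →
  H ⊩ ∀[ 𝟎 ] x₀ < wkᵀ a ⇒ wkᵀ w · x₀ ≐ one →
  H ⊩ ∀[ 𝟎 ] wkᵀ a ≤ x₀ ⇒ x₀ < wkᵀ b ⇒ wkᵀ w · x₀ ≐ ze →
  H ⊩ a ≤ b → H ⊩ sumᵗ · w · b ≐ a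
sum-count w a b d e = ⇒E (⇒E (⇒E (⇒E (⇒E (count (sumᵗ · w) w a b) (sum-ze w)) (∀I (sum-su _ _))) d) e)

-- The standard part of a function with standard bound k on the standard numbers

StandardPart : Formula ℒ^Ω (𝟏 ∷ 𝟏 ∷ Γ)
StandardPart = st x₁ ⇒ (∀ˢᵗ[ 𝟎 ] x₁ · x₀ ≤ x₂ · x₀) ⇒ (∃ˢᵗ[ 𝟏 ] ∀ˢᵗ[ 𝟎 ] x₁ · x₀ ≐ x₂ · x₀)

-- STP speaks of sets, so `G` is passed to it as the set of pairs `(i, j)` with `j < G i`. A value
-- of `G` is recovered as the number of elements in a column, counted up to the bound `k i`.
subgraph : Term ℒ^Ω (𝟎 ∷ 𝟏 ∷ []) 𝟎
subgraph = one ∸ (su (snd · x₀) ∸ x₁ · (fst · x₀))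

Subgraph : Term ℒ^Ω Γ 𝟏 → Term ℒ^Ω Γ 𝟏
Subgraph G = substᵀ (ε ▸ G) (ƛ subgraph)

Subgraph-pair : (G : Term ℒ^Ω Γ 𝟏) (i j : Term ℒ^Ω Γ 𝟎) →
  H ⊩ Subgraph G · (pair · i · j) ≐ one ∸ (su j ∸ G · i)
Subgraph-pair G i j = β (ε ▸ G) (pair · i · j) subgraph
  ⟫ monus-cong ≐-re (monus-cong (su-cong (snd-pair i j)) (cong₁ G (fst-pair i j)))

columnSum : Term ℒ^Ω (𝟎 ∷ 𝟏 ∷ 𝟏 ∷ []) 𝟎
columnSum = sumᵗ · ƛ (x₂ · (pair · x₁ · x₀)) · (x₂ · x₀)

≤one-cases : H ⊩ a ≤ one → H ⊩ ¬ a ≐ one → H ⊩ a ≐ ze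
≤one-cases p q = <-step-cases (su≤su p) (≤ze (su≤su⁻¹ h₀)) (absurd (↑ q) h₀)

column : Term ℒ^Ω (𝟎 ∷ 𝟎 ∷ 𝟏 ∷ []) 𝟎
column = x₂ · (pair · x₁ · x₀)

Column : Term ℒ^Ω Γ 𝟏 → Term ℒ^Ω Γ 𝟎 → Term ℒ^Ω Γ 𝟏
Column Y i = substᵀ (ε ▸ Y ▸ i) (ƛ column)

Column-at : (Y : Term ℒ^Ω Γ 𝟏) (i j : Term ℒ^Ω Γ 𝟎) → H ⊩ Column Y i · j ≐ Y · (pair · i · j)
Column-at Y i j = β (ε ▸ Y ▸ i) j column

ColumnSum : (k Y : Term ℒ^Ω Γ 𝟏) → Term ℒ^Ω Γ 𝟏
ColumnSum k Y = substᵀ (ε ▸ k ▸ Y) (ƛ columnSum)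

ColumnSum-at : (k Y : Term ℒ^Ω Γ 𝟏) (i : Term ℒ^Ω Γ 𝟎) → H ⊩ ColumnSum k Y · i ≐ sumᵗ · Column Y i · (k · i)
ColumnSum-at k Y i = β (ε ▸ k ▸ Y) i columnSum

st-pair : H ⊩ st a → H ⊩ st b → H ⊩ st (pair · a · b)
st-pair d e = st-· (st-· (axᵒ (st-clo pair)) d) e

SameMembers : Formula ℒ^Ω (𝟎 ∷ 𝟏 ∷ 𝟏 ∷ Γ)
SameMembers = st x₀ ⇒ (x₀ ∈ˣ Subgraph x₂ ⇔ x₀ ∈ˣ x₁)

cell : (G Y : Term ℒ^Ω Γ 𝟏) (i j : Term ℒ^Ω Γ 𝟎) → H ⊩ subst (ε ▸ G ▸ Y) (∀[ 𝟎 ] SameMembers) →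
  H ⊩ st i → H ⊩ st j → H ⊩ Subgraph G · (pair · i · j) ≐ one ⇔ Y · (pair · i · j) ≐ one
cell G Y i j d e f = ⇒E (∀E▸ SameMembers {s = ε ▸ G ▸ Y} d (pair · i · j)) (st-pair e f)

cell-one : (G Y : Term ℒ^Ω Γ 𝟏) (i j : Term ℒ^Ω Γ 𝟎) → H ⊩ subst (ε ▸ G ▸ Y) (∀[ 𝟎 ] SameMembers) →
  H ⊩ st i → H ⊩ st j → H ⊩ j < G · i → H ⊩ Column Y i · j ≐ one
cell-one G Y i j d e f p = Column-at Y i j ⟫ ⇒E (∧E₁ (cell G Y i j d e f)) (Subgraph-pair G i j ⟫ 1∸ze p)

cell-ze : (G Y : Term ℒ^Ω Γ 𝟏) (i j : Term ℒ^Ω Γ 𝟎) → H ⊩ subst (ε ▸ G ▸ Y) (∀[ 𝟎 ] SameMembers) →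
  H ⊩ st i → H ⊩ st j → H ⊩ Y · (pair · i · j) ≤ one → H ⊩ G · i ≤ j → H ⊩ Column Y i · j ≐ ze
cell-ze G Y i j d e f q p = Column-at Y i j ⟫ ≤one-cases q (⇒I (<⇒≱
  (1∸-ze⁻¹ (≐-sy (Subgraph-pair G i j) ⟫ ⇒E (∧E₂ (cell G Y i j (↑ d) (↑ e) (↑ f))) h₀)) (↑ p)))

Column-sum : List (Formula ℒ^Ω (𝟎 ∷ 𝟏 ∷ 𝟏 ∷ 𝟏 ∷ Γ)) → List (Formula ℒ^Ω (𝟎 ∷ 𝟏 ∷ 𝟏 ∷ 𝟏 ∷ Γ))
Column-sum H = st x₀ ∷ (st x₁ ∧ IsSet x₁ ∧ (∀ˢᵗ[ 𝟎 ] x₀ ∈ˣ Subgraph x₃ ⇔ x₀ ∈ˣ x₂))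
  ∷ (∀ˢᵗ[ 𝟎 ] x₃ · x₀ ≤ x₄ · x₀) ∷ st x₃ ∷ H

-- Every `j` that is counted lies below `k i`, which is standard; so `j` is standard too, and there
-- the set given by STP agrees with the subgraph.
column-sum : Column-sum H ⊩ sumᵗ · Column x₁ x₀ · (x₃ · x₀) ≐ x₂ · x₀
column-sum {H = H} = sum-count (Column x₁ x₀) (x₂ · x₀) (x₃ · x₀) ones zeros (⇒E (∀e h₂ x₀ refl) h₀)
  where
  ones : Column-sum H ⊩ ∀[ 𝟎 ] x₀ < x₃ · x₁ ⇒ Column x₂ x₁ · x₀ ≐ one
  ones = ∀I (⇒I (cell-one x₃ x₂ x₁ x₀ (∧E₂ (∧E₂ h₂)) h₁
    (st-below (st-· h₄ h₁) (≤-trans (<⇒≤ h₀) (⇒E (∀e h₃ x₁ refl) h₁))) h₀))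

  zeros : Column-sum H ⊩ ∀[ 𝟎 ] x₃ · x₁ ≤ x₀ ⇒ x₀ < x₄ · x₁ ⇒ Column x₂ x₁ · x₀ ≐ ze
  zeros = ∀I (⇒I (⇒I (cell-ze x₃ x₂ x₁ x₀ (∧E₂ (∧E₂ h₃)) h₂
    (st-below (st-· h₅ h₂) (<⇒≤ h₀)) (∀e (∧E₁ (∧E₂ h₃)) (pair · x₁ · x₀) refl) h₁)))

IsSet-Subgraph : (G : Term ℒ^Ω Γ 𝟏) → H ⊩ IsSet (Subgraph G)
IsSet-Subgraph G = ∀I (≤-resp (≐-sy (β (ε ▸ wkᵀ G) x₀ subgraph)) ≐-re (∸-≤ one (su (snd · x₀) ∸ wkᵀ G · (fst · x₀))))

STP′ : Formula ℒ^Ω (𝟏 ∷ Γ)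
STP′ = IsSet x₀ ⇒ (∃ˢᵗ[ 𝟏 ] IsSet x₀ ∧ (∀ˢᵗ[ 𝟎 ] x₀ ∈ˣ x₂ ⇔ x₀ ∈ˣ x₁))

standard-part : (k G : Term ℒ^Ω Γ 𝟏) → H ⊩ subst (ε ▸ k ▸ G) StandardPart
standard-part = ∀E₂ StandardPart (∀I (∀I (⇒I (⇒I
  (∃E (⇒E (∀E▸ STP′ {s = ε} (axiom new) (Subgraph x₀)) (IsSet-Subgraph x₀))
    (∃I (ColumnSum x₂ x₀) (∧I
      (st-substᵀ {s = ε ▸ x₂ ▸ x₀} (ƛ columnSum) λ { (here refl) → ∧E₁ h₀ ; (there (here refl)) → h₂ })
      (∀I (⇒I (ColumnSum-at x₃ x₁ x₀ ⟫ column-sum))))))))))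

-- Two functions in one object

tuple : Term ℒ^Ω (𝟎 ∷ 𝟎 ∷ 𝟏 ∷ 𝟏 ∷ []) 𝟎
tuple = con R₀ · x₁ · (x₃ · x₀) · (con Π · (con Π · (x₂ · x₀)))

-- PF-TP has a single variable. A statement about two functions is transferred as one about an
-- object whose values at 0 and 1 are these functions; a number enters as a constant function.
Tuple : Term ℒ^Ω Γ 𝟏 → Term ℒ^Ω Γ 𝟏 → Term ℒ^Ω Γ (𝟎 ⟶ 𝟏)
Tuple f g = substᵀ (ε ▸ f ▸ g) (ƛ (ƛ tuple))

Tuple-first : (f g : Term ℒ^Ω Γ 𝟏) (x : Term ℒ^Ω Γ 𝟎) → H ⊩ Tuple f g · ze · x ≐ f · x
Tuple-first f g x = β₂ (ε ▸ f ▸ g) ze x tuple ⟫ rec-ze _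

Tuple-second : (f g : Term ℒ^Ω Γ 𝟏) (x : Term ℒ^Ω Γ 𝟎) → H ⊩ Tuple f g · one · x ≐ g · x
Tuple-second f g x = β₂ (ε ▸ f ▸ g) one x tuple ⟫ ax (R₀-suc _ _ _) ⟫ const₂

-- Constants for lh, ent and bar.  Being atomic, they are not unfolded when
-- formulas are renamed or instantiated, which would make checking infeasible.

chain : {H : List (Formula ℒ^ω Γ)} {t u v : Term ℒ^ω Γ 𝟎} → RCA₀^ω ∣ H ⊢ t ≐ v → RCA₀^ω ∣ H ⊢ u ≐ v → RCA₀^ω ∣ H ⊢ t ≐ u
chain d e = ⇒E (axiom (≐-trans _ _ _)) (∧I d (⇒E (axiom (≐-sym _ _)) e))

IsLh : Formula ℒ^ω (𝟏 ∷ [])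
IsLh = ∀[ 𝟎 ] x₁ · x₀ ≐ lh · x₀

IsEnt : Formula ℒ^ω ((𝟎 ⟶ 𝟏) ∷ [])
IsEnt = ∀[ 𝟎 ] ∀[ 𝟎 ] x₂ · x₁ · x₀ ≐ ent · x₁ · x₀

IsBar : Formula ℒ^ω ((𝟏 ⟶ 𝟏) ∷ [])
IsBar = ∀[ 𝟏 ] ∀[ 𝟎 ] x₂ · x₁ · x₀ ≐ bar · x₁ · x₀

IsLh-unique : RCA₀^ω ⊢ Uniqueness IsLh
IsLh-unique = ∀I (∀I (⇒I (∀I (chain (∀e (∧E₁ (hyp (here refl))) x₀ refl) (∀e (∧E₂ (hyp (here refl))) x₀ refl)))))

IsEnt-unique : RCA₀^ω ⊢ Uniqueness IsEnt
IsEnt-unique = ∀I (∀I (⇒I (∀I (∀I (chain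
  (∀e (∀e (∧E₁ (hyp (here refl))) x₁ refl) x₀ refl) (∀e (∀e (∧E₂ (hyp (here refl))) x₁ refl) x₀ refl))))))

IsBar-unique : RCA₀^ω ⊢ Uniqueness IsBar
IsBar-unique = ∀I (∀I (⇒I (∀I (∀I (chain
  (∀e (∀e (∧E₁ (hyp (here refl))) x₁ refl) x₀ refl) (∀e (∀e (∧E₂ (hyp (here refl))) x₁ refl) x₀ refl))))))

lhˢ : Specification 𝟏
lhˢ = specification IsLh IsLh-unique

entˢ : Specification (𝟎 ⟶ 𝟏)
entˢ = specification IsEnt IsEnt-unique

barˢ : Specification (𝟏 ⟶ 𝟏)
barˢ = specification IsBar IsBar-unique

lhᶜ : Term ℒ^Ω Γ 𝟏
lhᶜ = con (extra lhˢ)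

entᶜ : Term ℒ^Ω Γ (𝟎 ⟶ 𝟏)
entᶜ = con (extra entˢ)

barᶜ : Term ℒ^Ω Γ (𝟏 ⟶ 𝟏)
barᶜ = con (extra barˢ)

lh-standard : H ⊩ ∀ˢᵗ[ 𝟎 ] lhᶜ · x₀ ≐ lh · x₀
lh-standard = ⇒E (⇒E (∀e (∧E₂ (axᵒ (Ξ₀ lhˢ))) lh refl) (axᵒ (st-clo lh))) (∀I (⇒I ≐-re))

ent-standard : H ⊩ ∀ˢᵗ[ 𝟎 ] ∀ˢᵗ[ 𝟎 ] entᶜ · x₁ · x₀ ≐ ent · x₁ · x₀
ent-standard = ⇒E (⇒E (∀e (∧E₂ (axᵒ (Ξ₀ entˢ))) ent refl) (axᵒ (st-clo ent))) (∀I (⇒I (∀I (⇒I ≐-re))))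

bar-standard : H ⊩ ∀ˢᵗ[ 𝟏 ] ∀ˢᵗ[ 𝟎 ] barᶜ · x₁ · x₀ ≐ bar · x₁ · x₀
bar-standard = ⇒E (⇒E (∀e (∧E₂ (axᵒ (Ξ₀ barˢ))) bar refl) (axᵒ (st-clo bar))) (∀I (⇒I (∀I (⇒I ≐-re))))

LhAgrees : Formula ℒ^Ω (𝟎 ∷ Γ)
LhAgrees = lhᶜ · x₀ ≐ lh · x₀

-- The axiom on the constant concerns standard arguments only. Constants are not parameters, so
-- PF-TP extends the agreement to all arguments.
lh-agrees : (s : Term ℒ^Ω Γ 𝟎) → H ⊩ lhᶜ · s ≐ lh · s
lh-agrees = ∀E▸ LhAgrees {s = ε} (⇒E (axᵒ (PF-TP∀ LhAgrees _)) lh-standard)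

EntAgrees : Formula ℒ^Ω ((𝟎 ⟶ 𝟏) ∷ Γ)
EntAgrees = entᶜ · (x₀ · ze · ze) · (x₀ · one · ze) ≐ ent · (x₀ · ze · ze) · (x₀ · one · ze)

BarAgrees : Formula ℒ^Ω ((𝟎 ⟶ 𝟏) ∷ Γ)
BarAgrees = barᶜ · (x₀ · ze) · (x₀ · one · ze) ≐ bar · (x₀ · ze) · (x₀ · one · ze)

ent-agrees : (s i : Term ℒ^Ω Γ 𝟎) → H ⊩ entᶜ · s · i ≐ ent · s · i
ent-agrees {Γ} {H} s i = cong₂ entᶜ (≐-sy first) (≐-sy second) ⟫ transferred ⟫ cong₂ ent first second
  where
  first : H ⊩ Tuple (con Π · s) (con Π · i) · ze · ze ≐ s
  first = Tuple-first (con Π · s) (con Π · i) ze ⟫ ax (Π-eq s ze)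
  second : H ⊩ Tuple (con Π · s) (con Π · i) · one · ze ≐ i
  second = Tuple-second (con Π · s) (con Π · i) ze ⟫ ax (Π-eq i ze)
  on-standard : H ⊩ ∀ˢᵗ[ 𝟎 ⟶ 𝟏 ] EntAgrees
  on-standard = ⇒E (⇒I (∀I (⇒I (⇒E (∀e (⇒E (∀e h₁ (x₀ · ze · ze) refl) (st-· (st-· h₀ st-ze) st-ze))
    (x₀ · one · ze) refl) (st-· (st-· h₀ (st-su st-ze)) st-ze))))) ent-standard
  transferred : H ⊩ subst (ε ▸ Tuple (con Π · s) (con Π · i)) EntAgrees
  transferred = ∀E▸ EntAgrees {s = ε} (⇒E (axᵒ (PF-TP∀ EntAgrees _)) on-standard) (Tuple (con Π · s) (con Π · i))

bar-agrees : (g : Term ℒ^Ω Γ 𝟏) (x : Term ℒ^Ω Γ 𝟎) → H ⊩ barᶜ · g · x ≐ bar · g · x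
bar-agrees {Γ} {H} g x = ≈-at (ap barᶜ (≈-sym first)) x ⟫ cong₁ (barᶜ · (Tuple g (con Π · x) · ze)) (≐-sy second) ⟫ transferred
  ⟫ cong₁ (bar · (Tuple g (con Π · x) · ze)) second ⟫ ≈-at (ap bar first) x
  where
  first : H ⊩ Tuple g (con Π · x) · ze ≈ g
  first = ∀I (Tuple-first (wkᵀ g) (con Π · wkᵀ x) x₀)
  second : H ⊩ Tuple g (con Π · x) · one · ze ≐ x
  second = Tuple-second g (con Π · x) ze ⟫ ax (Π-eq x ze)
  on-standard : H ⊩ ∀ˢᵗ[ 𝟎 ⟶ 𝟏 ] BarAgrees
  on-standard = ⇒E (⇒I (∀I (⇒I (⇒E (∀e (⇒E (∀e h₁ (x₀ · ze) refl) (st-· h₀ st-ze))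
    (x₀ · one · ze) refl) (st-· (st-· h₀ (st-su st-ze)) st-ze))))) bar-standard
  transferred : H ⊩ subst (ε ▸ Tuple g (con Π · x)) BarAgrees
  transferred = ∀E▸ BarAgrees {s = ε} (⇒E (axᵒ (PF-TP∀ BarAgrees _)) on-standard) (Tuple g (con Π · x))

barᶜ-ze : (g : Term ℒ^Ω Γ 𝟏) → H ⊩ barᶜ · g · ze ≐ ze
barᶜ-ze g = bar-agrees g ze ⟫ bar-ze g

barᶜ-su : (g : Term ℒ^Ω Γ 𝟏) (x : Term ℒ^Ω Γ 𝟎) → H ⊩ barᶜ · g · su x ≐ su (pair · (barᶜ · g · x) · (g · x))
barᶜ-su g x = bar-agrees g (su x) ⟫ bar-su g x ⟫ su-cong (cong₂ pair (≐-sy (bar-agrees g x)) ≐-re)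

lhᶜ-barᶜ : (g : Term ℒ^Ω Γ 𝟏) (x : Term ℒ^Ω Γ 𝟎) → H ⊩ lhᶜ · (barᶜ · g · x) ≐ x
lhᶜ-barᶜ g x = lh-agrees (barᶜ · g · x) ⟫ cong₁ lh (bar-agrees g x) ⟫ lh-bar g x

entᶜ-barᶜ : (g : Term ℒ^Ω Γ 𝟏) (x i : Term ℒ^Ω Γ 𝟎) → H ⊩ i < x → H ⊩ entᶜ · (barᶜ · g · x) · i ≐ g · i
entᶜ-barᶜ g x i p = ent-agrees (barᶜ · g · x) i ⟫ cong₂ ent (bar-agrees g x) ≐-re ⟫ ent-bar g x i p

-- Replacing closed terms by extensionally equal ones in a formula

data Replaces {Γ : Ctx} : Term ℒ^Ω Γ σ → Term ℒ^Ω Γ σ → Set where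
  same   : (t : Term ℒ^Ω Γ σ) → Replaces t t
  closed : (t u : Term ℒ^Ω [] σ) →
           (∀ {Δ} {H : List (Formula ℒ^Ω Δ)} → H ⊩ renameᵀ (λ ()) t ≈ renameᵀ (λ ()) u) →
           Replaces (renameᵀ (λ ()) t) (renameᵀ (λ ()) u)

Replaces-sym : {t u : Term ℒ^Ω Γ σ} → Replaces t u → Replaces u t
Replaces-sym (same t)       = same t
Replaces-sym (closed t u e) = closed u t (≈-sym e)

-- The context and the hypotheses change under a binder; an equation between closed terms that holds
-- under all hypotheses survives this.
Replaces-wk : {t u : Term ℒ^Ω Γ σ} → Replaces t u → Replaces (wkᵀ {τ = τ} t) (wkᵀ u)
Replaces-wk (same t)       = same (wkᵀ t)
Replaces-wk (closed t u e) = ≡.subst₂ Replaces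
  (≡.sym (renameᵀ-renameᵀ (λ ()) t)) (≡.sym (renameᵀ-renameᵀ (λ ()) u)) (closed t u e)

Replacesˢ : Subst ℒ^Ω Γ Δ → Subst ℒ^Ω Γ Δ → Set
Replacesˢ s s′ = ∀ {σ} (i : σ ∈ _) → Replaces (s i) (s′ i)

Replaces-liftˢ : {s s′ : Subst ℒ^Ω Γ Δ} → Replacesˢ s s′ → Replacesˢ (liftˢ {σ = σ} s) (liftˢ s′)
Replaces-liftˢ R (here p)  = same (var (here p))
Replaces-liftˢ R (there i) = Replaces-wk (R i)

replaceᵀ : {s s′ : Subst ℒ^Ω Γ Δ} {H : List (Formula ℒ^Ω Δ)} → Replacesˢ s s′ →
  (t : Term ℒ^Ω Γ σ) → H ⊩ substᵀ s t ≈ substᵀ s′ t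
replaceᵀ {s = s} R (var i) = reflexive (R i)
  where
  reflexive : ∀ {Δ σ} {H : List (Formula ℒ^Ω Δ)} {t u : Term ℒ^Ω Δ σ} → Replaces t u → H ⊩ t ≈ u
  reflexive (same t)       = ≈-refl t
  reflexive (closed t u e) = e
replaceᵀ R (con c) = ≈-refl (con c)
replaceᵀ R (t · u) = replaceᵀ R t ⟨·⟩ replaceᵀ R u

replace : {s s′ : Subst ℒ^Ω Γ Δ} {H : List (Formula ℒ^Ω Δ)} → Replacesˢ s s′ →
  (A : Formula ℒ^Ω Γ) → H ⊩ subst s A ⇒ subst s′ A
replace R (t ≐ u)    = ⇒I (≐-sy (replaceᵀ R t) ⟫ h₀ ⟫ replaceᵀ R u)
replace R (std h t)  = ⇒I (⇒E (axᵒ (st-≡ _ _)) (∧I h₀ (replaceᵀ R t)))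
replace R ⊥̇          = ⇒I h₀
replace R (A ∧ B)    = ⇒I (∧I (⇒E (replace R A) (∧E₁ h₀)) (⇒E (replace R B) (∧E₂ h₀)))
replace R (A ∨ B)    = ⇒I (∨E h₀ (∨I₁ (⇒E (replace R A) h₀)) (∨I₂ (⇒E (replace R B) h₀)))
replace R (A ⇒ B)    = ⇒I (⇒I (⇒E (replace R B) (⇒E h₁ (⇒E (replace (λ i → Replaces-sym (R i)) A) h₀))))
replace {s = s} R (∀[ σ ] A) = ⇒I (∀I (⇒E (replace (Replaces-liftˢ R) A)
  (∀e h₀ x₀ (inst-x₀ (subst (liftˢ s) A)))))
replace {s′ = s′} R (∃[ σ ] A) = ⇒I (∃E h₀ (∃I x₀ (coe (≡.sym (inst-x₀ (subst (liftˢ s′) A)))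
  (⇒E (replace (Replaces-liftˢ R) A) h₀))))

bar-constant : Replaces {Γ} barᶜ bar
bar-constant = closed barᶜ bar (∀I (∀I (bar-agrees x₁ x₀)))

ent-constant : Replaces {Γ} entᶜ ent
ent-constant = closed entᶜ ent (∀I (∀I (ent-agrees x₁ x₀)))

lh-constant : Replaces {Γ} lhᶜ lh
lh-constant = closed lhᶜ lh (∀I (lh-agrees x₀))

-- Initial segments and codes below a bound

BarCong : Formula ℒ^Ω (𝟎 ∷ 𝟏 ∷ 𝟏 ∷ Γ)
BarCong = (∀[ 𝟎 ] x₀ < x₁ ⇒ x₃ · x₀ ≐ x₂ · x₀) ⇒ barᶜ · x₂ · x₀ ≐ barᶜ · x₁ · x₀

bar-cong : (g h : Term ℒ^Ω Γ 𝟏) (n : Term ℒ^Ω Γ 𝟎) → H ⊩ subst (ε ▸ g ▸ h ▸ n) BarCong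
bar-cong = ∀E₃ BarCong (∀I (∀I (∀I (⇒I (⇒E (induction
  (x₀ ≤ x₁ ⇒ barᶜ · x₃ · x₀ ≐ barᶜ · x₂ · x₀) _ (ε ▸ x₂ ▸ x₁ ▸ x₀)
  (⇒I (barᶜ-ze x₂ ⟫ ≐-sy (barᶜ-ze x₁)))
  (⇒I (barᶜ-su x₃ x₀ ⟫ su-cong (cong₂ pair (⇒E h₁ (<⇒≤ h₀)) (⇒E (∀e h₂ x₀ refl) h₀)) ⟫ ≐-sy (barᶜ-su x₂ x₀)))
  x₀) (≤-refl _))))))

BarMono : Formula ℒ^Ω (𝟎 ∷ 𝟏 ∷ 𝟏 ∷ Γ)
BarMono = (∀[ 𝟎 ] x₀ < x₁ ⇒ x₃ · x₀ ≤ x₂ · x₀) ⇒ barᶜ · x₂ · x₀ ≤ barᶜ · x₁ · x₀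

-- `pair` is monotone, so pointwise smaller sequences have smaller codes. This makes the search for
-- a code below `k` a bounded one.
bar-mono : (g h : Term ℒ^Ω Γ 𝟏) (n : Term ℒ^Ω Γ 𝟎) → H ⊩ subst (ε ▸ g ▸ h ▸ n) BarMono
bar-mono = ∀E₃ BarMono (∀I (∀I (∀I (⇒I (⇒E (induction
  (x₀ ≤ x₁ ⇒ barᶜ · x₃ · x₀ ≤ barᶜ · x₂ · x₀) _ (ε ▸ x₂ ▸ x₁ ▸ x₀)
  (⇒I (≐⇒≤ (barᶜ-ze _ ⟫ ≐-sy (barᶜ-ze _))))
  (⇒I (≤-resp (≐-sy (barᶜ-su _ _)) (≐-sy (barᶜ-su _ _))
    (su≤su (pair-mono (⇒E h₁ (<⇒≤ h₀)) (⇒E (∀e h₂ x₀ refl) h₀)))))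
  x₀) (≤-refl _))))))

infix 6 _≼_
_≼_ : Term ℒ^Ω Γ 𝟎 → Term ℒ^Ω Γ 𝟎 → Formula ℒ^Ω Γ
s ≼ t = lhᶜ · s ≐ lhᶜ · t ∧ (∀[ 𝟎 ] x₀ < lhᶜ · wkᵀ t ⇒ entᶜ · wkᵀ s · x₀ ≤ entᶜ · wkᵀ t · x₀)

BelowIntro : Formula ℒ^Ω (𝟎 ∷ 𝟏 ∷ 𝟏 ∷ Γ)
BelowIntro = (∀[ 𝟎 ] x₀ < x₁ ⇒ x₃ · x₀ ≤ x₂ · x₀) ⇒ barᶜ · x₂ · x₀ ≼ barᶜ · x₁ · x₀

below-intro : (g k : Term ℒ^Ω Γ 𝟏) (M : Term ℒ^Ω Γ 𝟎) → H ⊩ subst (ε ▸ g ▸ k ▸ M) BelowIntro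
below-intro = ∀E₃ BelowIntro (∀I (∀I (∀I (⇒I (∧I (lhᶜ-barᶜ x₂ x₀ ⟫ ≐-sy (lhᶜ-barᶜ x₁ x₀))
  (∀I (⇒I (cut (≤-resp ≐-re (lhᶜ-barᶜ x₂ x₁) h₀)
    (≤-resp (≐-sy (entᶜ-barᶜ x₃ x₁ x₀ h₀)) (≐-sy (entᶜ-barᶜ x₂ x₁ x₀ h₀)) (⇒E (∀e h₂ x₀ refl) h₀))))))))))

Entrywise : Formula ℒ^Ω (𝟎 ∷ 𝟎 ∷ 𝟎 ∷ Γ)
Entrywise = x₀ < lhᶜ · x₁ ⇒ entᶜ · x₂ · x₀ ≤ entᶜ · x₁ · x₀

below-elim : (c : Term ℒ^Ω Γ 𝟎) (k : Term ℒ^Ω Γ 𝟏) (M i : Term ℒ^Ω Γ 𝟎) →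
  H ⊩ c ≼ barᶜ · k · M → H ⊩ i < M → H ⊩ entᶜ · c · i ≤ k · i
below-elim c k M i d p = ≤-resp ≐-re (entᶜ-barᶜ k M i p)
  (⇒E (∀E▸ Entrywise {s = ε ▸ c ▸ barᶜ · k · M} (∧E₂ d) i) (≤-resp ≐-re (≐-sy (lhᶜ-barᶜ k M)) p))

BarAgree : Formula ℒ^Ω (𝟎 ∷ 𝟏 ∷ 𝟏 ∷ Γ)
BarAgree = (∀ˢᵗ[ 𝟎 ] x₃ · x₀ ≐ x₂ · x₀) ⇒ st x₀ ⇒ barᶜ · x₂ · x₀ ≐ barᶜ · x₁ · x₀

bar-agree : (g h : Term ℒ^Ω Γ 𝟏) (x : Term ℒ^Ω Γ 𝟎) → H ⊩ subst (ε ▸ g ▸ h ▸ x) BarAgree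
bar-agree = ∀E₃ BarAgree (∀I (∀I (∀I (⇒I (⇒I (⇒E (bar-cong x₂ x₁ x₀)
  (∀I (⇒I (⇒E (∀e h₂ x₀ refl) (st-below h₁ (<⇒≤ h₀)))))))))))

BarEntBar : Formula ℒ^Ω (𝟎 ∷ 𝟎 ∷ 𝟏 ∷ Γ)
BarEntBar = x₀ ≤ x₁ ⇒ barᶜ · (entᶜ · (barᶜ · x₂ · x₁)) · x₀ ≐ barᶜ · x₂ · x₀

bar-ent-bar : (g : Term ℒ^Ω Γ 𝟏) (M x : Term ℒ^Ω Γ 𝟎) → H ⊩ subst (ε ▸ g ▸ M ▸ x) BarEntBar
bar-ent-bar = ∀E₃ BarEntBar (∀I (∀I (∀I (⇒I (⇒E (bar-cong (entᶜ · (barᶜ · x₂ · x₁)) x₂ x₀)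
  (∀I (⇒I (entᶜ-barᶜ x₃ x₂ x₀ (≤-trans h₀ h₁)))))))))

StandardPath : Formula ℒ^Ω (𝟎 ∷ 𝟎 ∷ 𝟏 ∷ Γ)
StandardPath = st x₂ ⇒ (¬ st x₁) ⇒ x₀ ≼ barᶜ · x₂ · x₁ ⇒ (∃ˢᵗ[ 𝟏 ] ∀ˢᵗ[ 𝟎 ] x₁ · x₀ ≐ entᶜ · x₂ · x₀)

-- All standard positions lie below the nonstandard `M`, so there the entries of the code are
-- bounded by the standard `k`, as `standard-part` demands.
standard-path : (k : Term ℒ^Ω Γ 𝟏) (M c : Term ℒ^Ω Γ 𝟎) → H ⊩ subst (ε ▸ k ▸ M ▸ c) StandardPath
standard-path = ∀E₃ StandardPath (∀I (∀I (∀I (⇒I (⇒I (⇒I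
  (⇒E (⇒E (standard-part x₂ (entᶜ · x₀)) h₂)
    (∀I (⇒I (below-elim x₁ x₃ x₂ x₀ h₁ (st-<Ω h₀ h₂)))))))))))

-- BoundedBar and Bar are the two sides of (RB); Path f says that some standard
-- g avoids the zeros of f at all standard positions.

BoundedBar : Term ℒ^Ω Γ 𝟏 → Term ℒ^Ω Γ 𝟏 → Term ℒ^Ω Γ 𝟎 → Formula ℒ^Ω Γ
BoundedBar f k M = ∀[ 𝟎 ] x₀ ≼ barᶜ · wkᵀ k · wkᵀ M
  ⇒ (∃[ 𝟎 ] x₀ ≤ wkᵀ (wkᵀ M) ∧ wkᵀ (wkᵀ f) · (barᶜ · (entᶜ · x₁) · x₀) ≐ ze)

Bar : Term ℒ^Ω Γ 𝟏 → Formula ℒ^Ω Γ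
Bar f = ∀[ 𝟏 ] ∃[ 𝟎 ] wkᵀ (wkᵀ f) · (barᶜ · x₁ · x₀) ≐ ze

PathBy : Term ℒ^Ω Γ (𝟏 ⟶ 𝟏) → Term ℒ^Ω Γ 𝟏 → Formula ℒ^Ω Γ
PathBy b f = ∃ˢᵗ[ 𝟏 ] ∀ˢᵗ[ 𝟎 ] ¬ wkᵀ (wkᵀ f) · (wkᵀ (wkᵀ b) · x₁ · x₀) ≐ ze

Path : Term ℒ^Ω Γ 𝟏 → Formula ℒ^Ω Γ
Path = PathBy barᶜ

-- Bars are hit below nonstandard lengths

Π⁰₁-Transfer : Formula ℒ^Ω Γ
Π⁰₁-Transfer = ∀ˢᵗ[ 𝟏 ] (∃[ 𝟎 ] x₁ · x₀ ≐ ze) ⇒ (∃ˢᵗ[ 𝟎 ] x₁ · x₀ ≐ ze)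

along : Term ℒ^Ω (𝟎 ∷ 𝟏 ∷ 𝟏 ∷ []) 𝟎
along = x₂ · (barᶜ · x₁ · x₀)

Along : Term ℒ^Ω Γ 𝟏 → Term ℒ^Ω Γ 𝟏 → Term ℒ^Ω Γ 𝟏
Along f g = substᵀ (ε ▸ f ▸ g) (ƛ along)

Along-at : (f g : Term ℒ^Ω Γ 𝟏) (x : Term ℒ^Ω Γ 𝟎) → H ⊩ Along f g · x ≐ f · (barᶜ · g · x)
Along-at f g x = β (ε ▸ f ▸ g) x along

st-Along : {f g : Term ℒ^Ω Γ 𝟏} → H ⊩ st f → H ⊩ st g → H ⊩ st (Along f g)
st-Along {f = f} {g} d e = st-substᵀ {s = ε ▸ f ▸ g} (ƛ along) λ { (here refl) → e ; (there (here refl)) → d }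

BarBounded : Formula ℒ^Ω (𝟎 ∷ 𝟏 ∷ 𝟏 ∷ Γ)
BarBounded = Π⁰₁-Transfer ⇒ st x₂ ⇒ st x₁ ⇒ (¬ st x₀) ⇒ Bar x₂ ⇒ BoundedBar x₂ x₁ x₀

StandardZero : Formula ℒ^Ω (𝟏 ∷ 𝟏 ∷ Γ)
StandardZero = Π⁰₁-Transfer ⇒ st x₁ ⇒ st x₀ ⇒ Bar x₁ ⇒ (∃ˢᵗ[ 𝟎 ] x₂ · (barᶜ · x₁ · x₀) ≐ ze)

standard-zero : (f g : Term ℒ^Ω Γ 𝟏) → H ⊩ subst (ε ▸ f ▸ g) StandardZero
standard-zero = ∀E₂ StandardZero (∀I (∀I (⇒I (⇒I (⇒I (⇒I
  (∃E (⇒E (⇒E (∀e h₃ (Along x₁ x₀) refl) (st-Along h₂ h₁))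
      (∃E (∀e h₀ x₀ refl) (∃I x₀ (Along-at x₂ x₁ x₀ ⟫ h₀))))
    (∃I x₀ (∧I (∧E₁ h₀) (≐-sy (Along-at x₂ x₁ x₀) ⟫ ∧E₂ h₀))))))))))

-- The code is known to agree with its standard part at standard positions only. Hence the hit along
-- the standard part has to be moved to a standard position, and this is what transfer achieves.
bar-bounded : (f k : Term ℒ^Ω Γ 𝟏) (M : Term ℒ^Ω Γ 𝟎) → H ⊩ subst (ε ▸ f ▸ k ▸ M) BarBounded
bar-bounded = ∀E₃ BarBounded (∀I (∀I (∀I (⇒I (⇒I (⇒I (⇒I (⇒I (∀I (⇒I
  (∃E (⇒E (⇒E (⇒E (standard-path x₂ x₁ x₀) h₃) h₂) h₀)
  (∃E (⇒E (⇒E (⇒E (⇒E (standard-zero x₄ x₀) h₆) h₅) (∧E₁ h₀)) h₂)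
  (∃I x₀ (∧I (<⇒≤ (st-<Ω (∧E₁ h₀) h₄))
    (cong₁ x₅ (≐-sy (⇒E (⇒E (bar-agree x₁ (entᶜ · x₂) x₀) (∧E₂ h₁)) (∧E₁ h₀))) ⟫ ∧E₂ h₀)))))))))))))))

-- RB and S² ˢᵗ with variables in place of lh, ent and bar

RBWith : Formula ℒ^Ω ((𝟏 ⟶ 𝟏) ∷ (𝟎 ⟶ 𝟏) ∷ 𝟏 ∷ Γ)
RBWith = ∃ˢᵗ[ 𝟏 ⟶ 𝟏 ] ∀ˢᵗ[ 𝟏 ] ∀[ 𝟎 ] ¬ st x₀ ⇒
  ((∀[ 𝟎 ] (x₆ · x₀ ≐ x₆ · (x₄ · (x₃ · x₂) · x₁)
             ∧ (∀[ 𝟎 ] x₀ < x₇ · (x₅ · (x₄ · x₃) · x₂) ⇒ x₆ · x₁ · x₀ ≤ x₆ · (x₅ · (x₄ · x₃) · x₂) · x₀))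
           ⇒ (∃[ 𝟎 ] x₀ ≤ x₂ ∧ x₃ · (x₅ · (x₆ · x₁) · x₀) ≐ ze))
   ⇔ (∀[ 𝟏 ] ∃[ 𝟎 ] x₃ · (x₅ · x₁ · x₀) ≐ ze))

S²With : Formula ℒ^Ω ((𝟏 ⟶ 𝟏) ∷ Γ)
S²With = ∃ˢᵗ[ 𝟐 ] ∀ˢᵗ[ 𝟏 ] x₁ · x₀ ≐ ze ⇔ PathBy x₂ x₀

constants : Replacesˢ {Δ = Γ} (ε ▸ lhᶜ ▸ entᶜ ▸ barᶜ) (ε ▸ lh ▸ ent ▸ bar)
constants (here refl)                 = bar-constant
constants (there (here refl))         = ent-constant
constants (there (there (here refl))) = lh-constant

RBᶜ⇒RB : [] ⊩ subst (ε ▸ lhᶜ ▸ entᶜ ▸ barᶜ) RBWith ⇒ RB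
RBᶜ⇒RB = replace constants RBWith

RB⇒RBᶜ : [] ⊩ RB ⇒ subst (ε ▸ lhᶜ ▸ entᶜ ▸ barᶜ) RBWith
RB⇒RBᶜ = replace (λ i → Replaces-sym (constants i)) RBWith

S²ᶜ⇒S² : [] ⊩ subst (ε ▸ barᶜ) S²With ⇒ S² ˢᵗ
S²ᶜ⇒S² = replace {s = ε ▸ barᶜ} {s′ = ε ▸ bar} (λ { (here refl) → bar-constant }) S²With

-- The Suslin functional

HasPath : Formula ℒ^ω (𝟏 ∷ 𝟐 ∷ [])
HasPath = ∃[ 𝟏 ] ∀[ 𝟎 ] ¬ x₂ · (bar · x₁ · x₀) ≐ ze

-- (S²) determines only where the functional vanishes. Prescribing the value 1 elsewhere gives the
-- uniqueness that a `Specification` requires.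
Suslin : Formula ℒ^ω (𝟐 ∷ [])
Suslin = ∀[ 𝟏 ] (x₁ · x₀ ≐ ze ∧ HasPath) ∨ (x₁ · x₀ ≐ su ze ∧ ¬ HasPath)

Suslin-unique : RCA₀^ω ⊢ Uniqueness Suslin
Suslin-unique = ∀I (∀I (⇒I (∀I (∨E (∀E (∧E₁ (hyp (here refl))) x₀)
  (∨E (∀E (∧E₂ (hyp (there (here refl)))) x₀)
    (chain (∧E₁ (hyp (there (here refl)))) (∧E₁ (hyp (here refl))))
    (differ (∧E₂ (hyp (here refl))) (∧E₂ (hyp (there (here refl))))))
  (∨E (∀E (∧E₂ (hyp (there (here refl)))) x₀)
    (differ (∧E₂ (hyp (there (here refl)))) (∧E₂ (hyp (here refl))))
    (chain (∧E₁ (hyp (there (here refl)))) (∧E₁ (hyp (here refl)))))))))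
  where
  differ : ∀ {Γ} {H : List (Formula ℒ^ω Γ)} {A B} → RCA₀^ω ∣ H ⊢ ¬ A → RCA₀^ω ∣ H ⊢ A → RCA₀^ω ∣ H ⊢ B
  differ d e = ⇒E (⇒I (raa (hyp (there (here refl))))) (⇒E d e)

ξ : Term ℒ^Ω Γ 𝟐
ξ = con (extra (specification Suslin Suslin-unique))

SuslinFor : Formula ℒ^Ω ((𝟏 ⟶ 𝟏) ∷ Γ)
SuslinFor = ∀ˢᵗ[ 𝟏 ] (ξ · x₀ ≐ ze ∧ PathBy x₁ x₀) ∨ (ξ · x₀ ≐ one ∧ ¬ PathBy x₁ x₀)

SuslinConstant : Formula ℒ^Ω Γ
SuslinConstant = ∀ˢᵗ[ 𝟏 ] (ξ · x₀ ≐ ze ∧ Path x₀) ∨ (ξ · x₀ ≐ one ∧ ¬ Path x₀)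

SuslinAt : Formula ℒ^Ω (𝟏 ∷ 𝟐 ∷ Γ)
SuslinAt = (x₁ · x₀ ≐ ze ∧ PathBy bar x₀) ∨ (x₁ · x₀ ≐ one ∧ ¬ PathBy bar x₀)

Ξ₀-agrees : Formula ℒ^Ω (𝟐 ∷ Γ)
Ξ₀-agrees = st x₀ ⇒ (∀ˢᵗ[ 𝟏 ] SuslinAt) ⇒ (∀ˢᵗ[ 𝟏 ] ξ · x₀ ≐ x₁ · x₀)

ξ-agrees : (X : Term ℒ^Ω Γ 𝟐) → H ⊩ subst (ε ▸ X) Ξ₀-agrees
ξ-agrees X = ∀E▸ Ξ₀-agrees {s = ε} (∧E₂ (axᵒ (Ξ₀ (specification Suslin Suslin-unique)))) X

normalised : Term ℒ^Ω (𝟏 ∷ 𝟐 ∷ []) 𝟎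
normalised = sg · (x₁ · x₀)

Normalised : Term ℒ^Ω Γ 𝟐 → Term ℒ^Ω Γ 𝟐
Normalised X = substᵀ (ε ▸ X) (ƛ normalised)

Normalised-at : (X : Term ℒ^Ω Γ 𝟐) (f : Term ℒ^Ω Γ 𝟏) → H ⊩ Normalised X · f ≐ sg · (X · f)
Normalised-at X f = β (ε ▸ X) f normalised

-- The nonzero values of the given functional are arbitrary; composing it with `sg` produces a
-- standard solution of the relativised specification, with which the axiom compares `ξ`.
suslin-constant′ : S² ˢᵗ ∷ [] ⊩ subst (ε ▸ bar) SuslinFor
suslin-constant′ = ∃E h₀ (cut agrees (cut (↑ normalised-suslin) (∀I (⇒I (∨E (⇒E (∀e h₁ x₀ refl) h₀)
  (∨I₁ (∧I (⇒E (∀e h₃ x₀ refl) h₁ ⟫ ∧E₁ h₀) (∧E₂ h₀)))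
  (∨I₂ (∧I (⇒E (∀e h₃ x₀ refl) h₁ ⟫ ∧E₁ h₀) (∧E₂ h₀))))))))
  where
  S²-at : Formula ℒ^Ω (𝟐 ∷ [])
  S²-at = st x₀ ∧ (∀ˢᵗ[ 𝟏 ] x₁ · x₀ ≐ ze ⇔ PathBy bar x₀)

  S²-iff : st x₀ ∷ wk S²-at ∷ H ⊩ x₁ · x₀ ≐ ze ⇔ PathBy bar x₀
  S²-iff = ⇒E (∀e (∧E₂ h₁) x₀ refl) h₀

  normalised-suslin : S²-at ∷ H ⊩ subst (ε ▸ Normalised x₀) (∀ˢᵗ[ 𝟏 ] SuslinAt)
  normalised-suslin = ∀I (⇒I (num-cases (x₁ · x₀)
    (∨I₁ (∧I (Normalised-at x₁ x₀ ⟫ sg-ze h₀) (⇒E (∧E₁ (↑ S²-iff)) h₀)))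
    (∨I₂ (∧I (Normalised-at x₁ x₀ ⟫ sg-su h₀) (⇒I (su≢ze h₁ (⇒E (∧E₂ (↑ ↑ S²-iff)) h₀)))))))

  agrees : S²-at ∷ H ⊩ subst (ε ▸ Normalised x₀) (∀ˢᵗ[ 𝟏 ] ξ · x₀ ≐ x₁ · x₀)
  agrees = ⇒E (⇒E (ξ-agrees (Normalised x₀))
    (st-substᵀ {s = ε ▸ x₀} (ƛ normalised) λ { (here refl) → ∧E₁ h₀ })) normalised-suslin

suslin-constant : S² ˢᵗ ∷ [] ⊩ SuslinConstant
suslin-constant = ⇒E (replace {s = ε ▸ bar} {s′ = ε ▸ barᶜ} (λ { (here refl) → Replaces-sym bar-constant }) SuslinFor)
  suslin-constant′

-- Transfer for the Suslin functional

BarOrPath : Formula ℒ^Ω (𝟏 ∷ 𝟏 ∷ Γ)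
BarOrPath = ξ · x₁ ≐ ze ∨ (∃[ 𝟎 ] x₂ · (barᶜ · x₁ · x₀) ≐ ze)

BarOrPathPair : Formula ℒ^Ω ((𝟎 ⟶ 𝟏) ∷ Γ)
BarOrPathPair = ξ · (x₀ · ze) ≐ ze ∨ (∃[ 𝟎 ] x₁ · ze · (barᶜ · (x₁ · one) · x₀) ≐ ze)

bar-or-path-standard : SuslinConstant ∷ H ⊩ ∀[ 𝟎 ⟶ 𝟏 ] st x₀ ⇒ BarOrPathPair
bar-or-path-standard = ∀I (⇒I (∨E (⇒E (∀e h₁ (x₀ · ze) refl) (st-· h₀ st-ze))
  (∨I₁ (∧E₁ h₀))
  (cases (∃[ 𝟎 ] x₁ · ze · (barᶜ · (x₁ · one) · x₀) ≐ ze) (∨I₂ h₀)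
    (absurd (∧E₂ h₁) (∃I (x₀ · one) (∧I (st-· h₂ (st-su st-ze))
      (∀I (⇒I (⇒I (⇒E h₂ (∃I x₀ h₀)))))))))))

bar-or-path-pair : SuslinConstant ∷ H ⊩ ∀[ 𝟎 ⟶ 𝟏 ] BarOrPathPair
bar-or-path-pair = ⇒E (axᵒ (PF-TP∀ BarOrPathPair _)) bar-or-path-standard

bar-or-path : (f g : Term ℒ^Ω Γ 𝟏) → H ⊩ SuslinConstant → H ⊩ subst (ε ▸ f ▸ g) BarOrPath
bar-or-path f g d = ∀E₂ BarOrPath (⇒E (⇒I (∀I (∀I (∨E (∀e bar-or-path-pair (Tuple x₁ x₀) refl)
  (∨I₁ (ap ξ (≈-sym (∀I (Tuple-first x₂ x₁ x₀))) ⟫ h₀))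
  (∨I₂ (∃E h₀ (∃I x₀
    (≐-sy (Tuple-first x₂ x₁ (barᶜ · (Tuple x₂ x₁ · one) · x₀)
      ⟫ cong▸ (ε ▸ x₂ ▸ x₀) (x₂ · (barᶜ · x₀ · x₁)) (∀I (Tuple-second x₃ x₂ x₀))) ⟫ h₀)))))))) d) f g

suslin-cases : (f : Term ℒ^Ω Γ 𝟏) → H ⊩ SuslinConstant → H ⊩ st f →
  (ξ · f ≐ ze ∧ Path f) ∷ H ⊩ A → (ξ · f ≐ one ∧ ¬ Path f) ∷ H ⊩ A → H ⊩ A
suslin-cases f d e = ∨E (⇒E (∀E▸ (st x₀ ⇒ ((ξ · x₀ ≐ ze ∧ Path x₀) ∨ (ξ · x₀ ≐ one ∧ ¬ Path x₀))) {s = ε} d f) e)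

BarOfNonzero : Formula ℒ^Ω (𝟏 ∷ Γ)
BarOfNonzero = SuslinConstant ⇒ (¬ ξ · x₀ ≐ ze) ⇒ Bar x₀

bar-of-nonzero : (f : Term ℒ^Ω Γ 𝟏) → H ⊩ subst (ε ▸ f) BarOfNonzero
bar-of-nonzero {Γ} {H} = ∀E▸ BarOfNonzero {s = ε} (∀I (⇒I (⇒I (∀I (∨E or (absurd h₁ h₀) h₀)))))
  where
  or : (¬ ξ · x₁ ≐ ze) ∷ SuslinConstant ∷ map wk (map wk H) ⊩ subst (ε ▸ x₁ ▸ x₀) BarOrPath
  or = bar-or-path x₁ x₀ h₁

-- Π¹₁ transfer in contrapositive form: as soon as any `g` at all avoids the zeros of a standard
-- `f`, a standard one does so at the standard positions.
path-of-no-bar : SuslinConstant ∷ H ⊩ ∀ˢᵗ[ 𝟏 ] (¬ Bar x₀) ⇒ Path x₀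
path-of-no-bar = ∀I (⇒I (⇒I (suslin-cases x₀ h₂ h₁ (∧E₂ h₀)
  (absurd h₁ (⇒E (⇒E (bar-of-nonzero x₀) h₃) (⇒I (su≢ze (∧E₁ h₁) h₀)))))))

firstEntry : Term ℒ^Ω (𝟎 ∷ 𝟏 ∷ []) 𝟎
-- The empty code gets the value 1, so that length 0 is never a hit.
firstEntry = con R₀ · x₀ · one · (con Π · (con Π · (one ∸ x₁ · (entᶜ · x₀ · ze))))

-- A path g avoids the zeros of FirstEntry h exactly when h vanishes at g 0, so
-- standard paths of FirstEntry h give standard zeros of h.
FirstEntry : Term ℒ^Ω Γ 𝟏 → Term ℒ^Ω Γ 𝟏
FirstEntry h = substᵀ (ε ▸ h) (ƛ firstEntry)

st-FirstEntry : {h : Term ℒ^Ω Γ 𝟏} → H ⊩ st h → H ⊩ st (FirstEntry h)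
st-FirstEntry {h = h} d = st-substᵀ {s = ε ▸ h} (ƛ firstEntry) λ { (here refl) → d }

FirstEntry-ze : (h : Term ℒ^Ω Γ 𝟏) → H ⊩ FirstEntry h · ze ≐ one
FirstEntry-ze h = β (ε ▸ h) ze firstEntry ⟫ rec-ze one

FirstEntry-su : (h : Term ℒ^Ω Γ 𝟏) {s p : Term ℒ^Ω Γ 𝟎} → H ⊩ s ≐ su p →
  H ⊩ FirstEntry h · s ≐ one ∸ h · (entᶜ · s · ze)
FirstEntry-su h {s} d = β (ε ▸ h) s firstEntry ⟫ rec-cong d
  ⟫ ax (R₀-suc _ _ _) ⟫ const₂

FirstEntry-bar : (h g : Term ℒ^Ω Γ 𝟏) (x : Term ℒ^Ω Γ 𝟎) →
  H ⊩ FirstEntry h · (barᶜ · g · su x) ≐ one ∸ h · (g · ze)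
FirstEntry-bar h g x = FirstEntry-su h (barᶜ-su g x)
  ⟫ monus-cong ≐-re (cong₁ h (entᶜ-barᶜ g (su x) ze (su≤su (ze≤ x))))

no-bar : (h : Term ℒ^Ω Γ 𝟏) (n x : Term ℒ^Ω Γ 𝟎) → H ⊩ h · n ≐ ze →
  H ⊩ FirstEntry h · (barᶜ · (con Π · n) · x) ≐ one
no-bar h n x d = num-cases x
  (cong₁ (FirstEntry h) (cong₁ (barᶜ · (con Π · n)) h₀ ⟫ barᶜ-ze (con Π · n)) ⟫ FirstEntry-ze h)
  (cong₁ (FirstEntry h) (cong₁ (barᶜ · (con Π · n)) h₀) ⟫ FirstEntry-bar h (con Π · n) (pred · x)
    ⟫ 1∸ze (cong₁ h (ax (Π-eq n ze)) ⟫ ↑ d))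

-- A zero `n` of `h`, standard or not, gives the constant sequence `n`, along which `FirstEntry h`
-- never vanishes. So `FirstEntry h` is no bar, and the standard path that it then has starts with a
-- standard zero of `h`.
Π⁰₁-transfer : SuslinConstant ∷ H ⊩ Π⁰₁-Transfer
Π⁰₁-transfer = ⇒E (⇒I (∀I (⇒I (⇒I (∃E h₀
  (∃E (⇒E (⇒E (∀e h₃ (FirstEntry x₁) refl) (st-FirstEntry h₂))
      (⇒I (∃E (∀e h₀ (con Π · x₀) refl) (su≢ze (no-bar x₂ x₁ x₀ h₂) h₀))))
    (∃I (x₀ · ze) (∧I (st-· (∧E₁ h₀) st-ze)
      -- The path is inspected at length 1, the least length at which `FirstEntry` reads the entry
      -- at 0.
      (1∸≢ze⁻¹ (⇒I (⇒E (⇒E (∀e (∧E₂ h₁) one refl) (st-su st-ze)) (FirstEntry-bar x₂ x₀ ze ⟫ h₀))))))))))))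
  path-of-no-bar

-- Choice of avoiding paths and the functional Φ

Escapes : Formula ℒ^Ω (𝟏 ∷ 𝟏 ∷ Γ)
Escapes = ξ · x₁ ≐ ze ⇒ (∀[ 𝟎 ] ¬ x₂ · (barᶜ · x₁ · x₀) ≐ ze)

never-zero : (st x₀ ∧ (∀ˢᵗ[ 𝟎 ] ¬ x₂ · (barᶜ · x₁ · x₀) ≐ ze)) ∷ st x₁ ∷ Π⁰₁-Transfer ∷ H ⊩
  ∀[ 𝟎 ] ¬ x₂ · (barᶜ · x₁ · x₀) ≐ ze
never-zero = ∀I (⇒I (∃E
  (⇒E (⇒E (∀e h₃ (Along x₂ x₁) refl) (st-Along h₂ (∧E₁ h₁))) (∃I x₀ (Along-at x₂ x₁ x₀ ⟫ h₀)))
  (⇒E (⇒E (∀e (∧E₂ h₂) x₀ refl) (∧E₁ h₀)) (≐-sy (Along-at x₃ x₂ x₀) ⟫ ∧E₂ h₀))))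

-- HAC-int requires an internal matrix. Therefore `Escapes` has the premise `ξ · f ≐ ze` in place of
-- `Path f`, and Π⁰₁ transfer strengthens avoidance at standard positions to avoidance everywhere.
escapes : Π⁰₁-Transfer ∷ SuslinConstant ∷ H ⊩ ∀ˢᵗ[ 𝟏 ] ∃ˢᵗ[ 𝟏 ] Escapes
escapes = ∀I (⇒I (suslin-cases x₀ h₂ h₀
  (∃E (∧E₂ h₀) (∃I x₀ (∧I (∧E₁ h₀) (⇒I (⇒E (⇒E (⇒E (⇒I (⇒I (⇒I never-zero))) h₄) h₃) h₁)))))
  -- Here the premise of `Escapes` fails, so any standard function serves as a default.
  (∃I (con Π · ze) (∧I (st-· (st-con Π) st-ze) (⇒I (su≢ze (∧E₁ h₁) h₀))))))

Escape : Formula ℒ^Ω (𝟏 ∷ 𝟎 ∷ 𝟏 ∷ 𝟏 ∷ Γ)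
Escape = (∀[ 𝟎 ] ¬ x₄ · (barᶜ · x₁ · x₀) ≐ ze) ⇒ (∀[ 𝟎 ] x₁ · x₀ ≤ x₃ · x₀) ⇒ ¬ BoundedBar x₃ x₂ x₁

escape : (f k : Term ℒ^Ω Γ 𝟏) (M : Term ℒ^Ω Γ 𝟎) (g : Term ℒ^Ω Γ 𝟏) → H ⊩ subst (ε ▸ f ▸ k ▸ M ▸ g) Escape
escape = ∀E₄ Escape (∀I (∀I (∀I (∀I (⇒I (⇒I (⇒I
  (∃E (⇒E (∀e h₀ (barᶜ · x₀ · x₁) refl) (⇒E (below-intro x₀ x₂ x₁) (∀I (⇒I (∀e h₂ x₀ refl)))))
    (⇒E (∀e h₃ x₀ refl) (cong₁ x₄ (≐-sy (⇒E (bar-ent-bar x₁ x₂ x₀) (∧E₁ h₀))) ⟫ ∧E₂ h₀))))))))))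

entry : Term ℒ^Ω (𝟎 ∷ 𝟎 ∷ (𝟏 ✶) ∷ []) 𝟎
entry = con elt · x₂ · x₀ · x₁

EntriesAt : Term ℒ^Ω Γ (𝟏 ✶) → Term ℒ^Ω Γ 𝟎 → Term ℒ^Ω Γ 𝟏
EntriesAt s i = substᵀ (ε ▸ s ▸ i) (ƛ entry)

MemberBound : Formula ℒ^Ω (𝟎 ∷ 𝟏 ∷ (𝟏 ✶) ∷ Γ)
MemberBound = x₁ ∈ˢ x₂ ⇒ x₁ · x₀ ≤ sumᵗ · EntriesAt x₂ x₀ · (con len · x₂)

member-bound : (s : Term ℒ^Ω Γ (𝟏 ✶)) (g : Term ℒ^Ω Γ 𝟏) (i : Term ℒ^Ω Γ 𝟎) →
  H ⊩ subst (ε ▸ s ▸ g ▸ i) MemberBound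
member-bound = ∀E₃ MemberBound (∀I (∀I (∀I (⇒I (∃E h₀
  (≤-resp (β (ε ▸ x₃ ▸ x₁) x₀ entry ⟫ ≐-sy (∀e (∧E₂ h₀) x₁ refl)) ≐-re
    (≤-sum (EntriesAt x₃ x₁) x₀ (con len · x₃) (∧E₁ h₀))))))))

bound : Term ℒ^Ω (𝟎 ∷ 𝟏 ∷ (𝟏 ⟶ 𝟏 ✶) ∷ []) 𝟎
bound = sumᵗ · ƛ (con elt · (x₃ · x₂) · x₀ · x₁) · (con len · (x₂ · x₁))

Bound : Term ℒ^Ω Γ (𝟏 ⟶ 𝟏 ✶) → Term ℒ^Ω Γ (𝟏 ⟶ 𝟏)
Bound Ψ = substᵀ (ε ▸ Ψ) (ƛ (ƛ bound))

Bound-at : (Ψ : Term ℒ^Ω Γ (𝟏 ⟶ 𝟏 ✶)) (f : Term ℒ^Ω Γ 𝟏) (i : Term ℒ^Ω Γ 𝟎) →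
  H ⊩ Bound Ψ · f · i ≐ sumᵗ · EntriesAt (Ψ · f) i · (con len · (Ψ · f))
Bound-at Ψ f i = β₂ (ε ▸ Ψ) f i bound

EscapeCandidates : Term ℒ^Ω Γ (𝟏 ⟶ 𝟏 ✶) → Formula ℒ^Ω Γ
EscapeCandidates Ψ = st Ψ ∧ (∀ˢᵗ[ 𝟏 ] ∃[ 𝟏 ] x₀ ∈ˢ wkᵀ (wkᵀ Ψ) · x₁ ∧ Escapes)

st-Bound : {Ψ : Term ℒ^Ω Γ (𝟏 ⟶ 𝟏 ✶)} → H ⊩ st Ψ → H ⊩ st (Bound Ψ)
st-Bound {Ψ = Ψ} d = st-substᵀ {s = ε ▸ Ψ} (ƛ (ƛ bound)) λ { (here refl) → d }

Escaping : Formula ℒ^Ω (𝟏 ∷ 𝟎 ∷ 𝟏 ∷ (𝟏 ⟶ 𝟏 ✶) ∷ Γ)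
Escaping = x₀ ∈ˢ x₃ · x₂ ∧ (∀[ 𝟎 ] ¬ x₃ · (barᶜ · x₁ · x₀) ≐ ze)

bounded-escape : Escaping ∷ H ⊩ ¬ BoundedBar x₂ (Bound x₃ · x₂) x₁
bounded-escape = ⇒E (⇒E (escape x₂ (Bound x₃ · x₂) x₁ x₀) (∧E₂ h₀))
  (∀I (≤-resp ≐-re (≐-sy (Bound-at x₄ x₃ x₀)) (⇒E (member-bound (x₄ · x₃) x₁ x₀) (∧E₁ h₀))))

Candidate : Formula ℒ^Ω (𝟏 ∷ 𝟎 ∷ 𝟏 ∷ (𝟏 ⟶ 𝟏 ✶) ∷ Γ)
Candidate = x₀ ∈ˢ x₃ · x₂ ∧ (ξ · x₂ ≐ ze ⇒ (∀[ 𝟎 ] ¬ x₃ · (barᶜ · x₁ · x₀) ≐ ze))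

escaping : Candidate ∷ ξ · x₂ ≐ ze ∷ H ⊩ Escaping
escaping = ∧I (∧E₁ h₀) (⇒E (∧E₂ h₀) h₁)

candidate : st x₁ ∷ EscapeCandidates x₂ ∷ H ⊩ ∃[ 𝟏 ] Candidate
candidate = ⇒E (∀e (∧E₂ h₁) x₁ refl) h₀

no-candidate : Candidate ∷ ξ · x₂ ≐ ze ∷ B ∷ BoundedBar x₂ (Bound x₃ · x₂) x₁ ∷ H ⊩ ⊥̇
no-candidate = ⇒E (⇒E (⇒I bounded-escape) escaping) h₃

nonzero-of-bounded : (∃[ 𝟏 ] Candidate) ∷ BoundedBar x₁ (Bound x₂ · x₁) x₀ ∷ H ⊩ ¬ ξ · x₁ ≐ ze
nonzero-of-bounded = ⇒I (∃E h₁ no-candidate)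

bar-of-bounded : st x₁ ∷ EscapeCandidates x₂ ∷ BoundedBar x₁ (Bound x₂ · x₁) x₀ ∷ SuslinConstant ∷ H ⊩ Bar x₁
bar-of-bounded = ⇒E (⇒E (bar-of-nonzero x₁) h₃) (⇒E (⇒E (⇒I (⇒I nonzero-of-bounded)) h₂) candidate)

rb-forward : (¬ st x₀) ∷ st x₁ ∷ EscapeCandidates x₂ ∷ Π⁰₁-Transfer ∷ SuslinConstant ∷ H ⊩
  BoundedBar x₁ (Bound x₂ · x₁) x₀ ⇒ Bar x₁
rb-forward = ⇒I (⇒E (⇒E (⇒E (⇒E (⇒I (⇒I (⇒I (⇒I bar-of-bounded)))) h₅) h₀) h₃) h₂)

rb-backward : (¬ st x₀) ∷ st x₁ ∷ EscapeCandidates x₂ ∷ Π⁰₁-Transfer ∷ SuslinConstant ∷ H ⊩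
  Bar x₁ ⇒ BoundedBar x₁ (Bound x₂ · x₁) x₀
rb-backward = ⇒E (⇒E (⇒E (⇒E (bar-bounded x₁ (Bound x₂ · x₁) x₀) h₃) h₁) (st-· (st-Bound (∧E₁ h₂)) h₁)) h₀

rb-body : EscapeCandidates x₀ ∷ Π⁰₁-Transfer ∷ SuslinConstant ∷ H ⊩
  ∀ˢᵗ[ 𝟏 ] ∀[ 𝟎 ] ¬ st x₀ ⇒ (BoundedBar x₁ (Bound x₂ · x₁) x₀ ⇔ Bar x₁)
rb-body = ∀I (⇒I (∀I (⇒I (∧I rb-forward rb-backward))))

S²ˢᵗ⇒RB : [] ⊩ S² ˢᵗ ⇒ RB
S²ˢᵗ⇒RB = ⇒I (cut suslin-constant (cut Π⁰₁-transfer (⇒E (weaken (λ ()) RBᶜ⇒RB)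
  (∃E (⇒E (axᵒ (HAC-int Escapes _)) escapes) (∃I (Bound x₀) (∧I (st-Bound (∧E₁ h₀)) rb-body))))))

-- Bounds for lists of numbers

size : Term ℒ^Ω Γ (𝟎 ✶) → Term ℒ^Ω Γ 𝟎
size s = sumᵗ · (con elt · s) · (con len · s)

st-size : {s : Term ℒ^Ω Γ (𝟎 ✶)} → H ⊩ st s → H ⊩ st (size s)
st-size d = st-· (st-· (axᵒ (st-clo sumᵗ)) (st-· (st-con elt) d)) (st-· (st-con len) d)

SizeBound : Formula ℒ^Ω (𝟎 ∷ (𝟎 ✶) ∷ Γ)
SizeBound = x₀ ∈ˢ x₁ ⇒ x₀ ≤ size x₁

-- HAC-int leaves open which entry of its list is the right one; the sum is a single number,
-- standard for a standard list, that bounds them all.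
size-bound : (s : Term ℒ^Ω Γ (𝟎 ✶)) (z : Term ℒ^Ω Γ 𝟎) → H ⊩ subst (ε ▸ s ▸ z) SizeBound
size-bound = ∀E₂ SizeBound (∀I (∀I (⇒I (∃E h₀
  (≤-resp (≐-sy (∧E₂ h₀)) ≐-re (≤-sum (con elt · x₂) x₀ (con len · x₂) (∧E₁ h₀)))))))

-- Underspill

Settles : Term ℒ^Ω Γ 𝟏 → Formula ℒ^Ω Γ
Settles P = ∃ˢᵗ[ 𝟎 ] ∀[ 𝟎 ] x₁ ≤ x₀ ⇒ wkᵀ (wkᵀ P) · x₀ ≐ ze

Frequent : Formula ℒ^Ω (𝟎 ∷ 𝟏 ∷ Γ)
Frequent = (¬ Settles x₁) ⇒ st x₀ ⇒ (∃[ 𝟎 ] x₁ ≤ x₀ ∧ ¬ x₂ · x₀ ≐ ze)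

frequent : (P : Term ℒ^Ω Γ 𝟏) (m : Term ℒ^Ω Γ 𝟎) → H ⊩ subst (ε ▸ P ▸ m) Frequent
frequent = ∀E₂ Frequent (∀I (∀I (⇒I (⇒I (raa (⇒E h₂
  (∃I x₀ (∧I h₁ (∀I (⇒I (raa (⇒E h₂ (∃I x₀ (∧I h₁ h₀))))))))))))))

LargeNonzero : Formula ℒ^Ω (𝟎 ∷ 𝟎 ∷ 𝟏 ∷ Γ)
LargeNonzero = x₀ ≤ x₁ ∧ ¬ x₂ · x₁ ≐ ze

-- The premise of Idealization: a list has the upper bound `size`, and if `P` never settles, it is
-- nonzero somewhere beyond that bound.
finitely-large : (¬ Settles x₀) ∷ H ⊩ ∀ˢᵗ[ 𝟎 ✶ ] ∃[ 𝟎 ] ∀[ 𝟎 ] x₀ ∈ˢ x₂ ⇒ (x₀ ≤ x₁ ∧ ¬ x₃ · x₁ ≐ ze)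
finitely-large = ∀I (⇒I (∃E (⇒E (⇒E (frequent x₁ (size x₀)) h₁) (st-size h₀))
  (∃I x₀ (∀I (⇒I (∧I (≤-trans (⇒E (size-bound x₂ x₀) h₀) (∧E₁ h₁)) (∧E₂ h₁)))))))

Underspill : Formula ℒ^Ω (𝟏 ∷ Γ)
Underspill = (∀[ 𝟎 ] ¬ st x₀ ⇒ x₁ · x₀ ≐ ze) ⇒ Settles x₀

not-large : (∀ˢᵗ[ 𝟎 ] LargeNonzero) ∷ B ∷ (∀[ 𝟎 ] ¬ st x₀ ⇒ x₂ · x₀ ≐ ze) ∷ H ⊩ ⊥̇
not-large = ⇒E (∧E₂ (⇒E (∀e h₀ ze refl) st-ze))
  (⇒E (∀e h₂ x₀ refl) (⇒I (<-irrefl (∧E₁ (⇒E (∀e h₁ (su x₀) refl) (st-su h₀))))))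

-- Otherwise Idealization gives one number above all standard numbers at which `P` is nonzero. Being
-- above its own successor if it were standard, it is nonstandard, against the hypothesis.
underspill : (P : Term ℒ^Ω Γ 𝟏) → H ⊩ subst (ε ▸ P) Underspill
underspill = ∀E▸ Underspill {s = ε} (∀I (⇒I (raa
  (∃E (⇒E (axᵒ (I LargeNonzero _)) finitely-large) not-large))))

-- If all numbers were standard, the constant function 1 would vacuously vanish at the nonstandard
-- ones, and `underspill` would make it vanish somewhere.
infinite-number : H ⊩ ∃[ 𝟎 ] ¬ st x₀
infinite-number = raa (∃E (⇒E (underspill (con Π · one)) (∀I (⇒I (absurd h₁ (∃I x₀ h₀)))))
  (su≢ze (ax (Π-eq one x₀)) (⇒E (∀e (∧E₂ h₀) x₀ refl) (≤-refl x₀))))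

-- Deciding the left-hand side of (RB)

clamped : Term ℒ^Ω (𝟎 ∷ 𝟎 ∷ 𝟏 ∷ []) 𝟎
clamped = min (entᶜ · x₁ · x₀) (x₂ · x₀)

-- Cutting the entries down to `k` turns every number into an admissible sequence, so the search
-- runs over all numbers up to a bound without testing which of them are codes below `k`.
Clamped : Term ℒ^Ω Γ 𝟏 → Term ℒ^Ω Γ 𝟎 → Term ℒ^Ω Γ 𝟏
Clamped k c = substᵀ (ε ▸ k ▸ c) (ƛ clamped)

Clamped-at : (k : Term ℒ^Ω Γ 𝟏) (c i : Term ℒ^Ω Γ 𝟎) → H ⊩ Clamped k c · i ≐ min (entᶜ · c · i) (k · i)
Clamped-at k c i = β (ε ▸ k ▸ c) i clamped

valueAlong : Term ℒ^Ω (𝟎 ∷ 𝟎 ∷ 𝟏 ∷ 𝟏 ∷ []) 𝟎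
valueAlong = x₃ · (barᶜ · Clamped x₂ x₁ · x₀)

ValueAlong : Term ℒ^Ω Γ 𝟏 → Term ℒ^Ω Γ 𝟏 → Term ℒ^Ω Γ 𝟎 → Term ℒ^Ω Γ 𝟏
ValueAlong f k c = substᵀ (ε ▸ f ▸ k ▸ c) (ƛ valueAlong)

ValueAlong-at : (f k : Term ℒ^Ω Γ 𝟏) (c x : Term ℒ^Ω Γ 𝟎) →
  H ⊩ ValueAlong f k c · x ≐ f · (barᶜ · Clamped k c · x)
ValueAlong-at f k c x = β (ε ▸ f ▸ k ▸ c) x valueAlong

misses : Term ℒ^Ω (𝟎 ∷ 𝟎 ∷ 𝟏 ∷ 𝟏 ∷ []) 𝟎
-- The successor makes the range inclusive, as in `x ≤ M`.
misses = one ∸ productᵗ · ValueAlong x₃ x₂ x₀ · su x₁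

Misses : Term ℒ^Ω Γ 𝟏 → Term ℒ^Ω Γ 𝟏 → Term ℒ^Ω Γ 𝟎 → Term ℒ^Ω Γ 𝟏
Misses f k M = substᵀ (ε ▸ f ▸ k ▸ M) (ƛ misses)

Misses-at : (f k : Term ℒ^Ω Γ 𝟏) (M c : Term ℒ^Ω Γ 𝟎) →
  H ⊩ Misses f k M · c ≐ one ∸ productᵗ · ValueAlong f k c · su M
Misses-at f k M c = β (ε ▸ f ▸ k ▸ M) c misses

-- Unbounded f k M vanishes exactly when BoundedBar f k M fails.
Unbounded : Term ℒ^Ω Γ 𝟏 → Term ℒ^Ω Γ 𝟏 → Term ℒ^Ω Γ 𝟎 → Term ℒ^Ω Γ 𝟎
Unbounded f k M = productᵗ · Misses f k M · su (barᶜ · k · M)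

clamped-below : (k : Term ℒ^Ω Γ 𝟏) (M c : Term ℒ^Ω Γ 𝟎) → H ⊩ barᶜ · Clamped k c · M ≼ barᶜ · k · M
clamped-below k M c = ⇒E (below-intro (Clamped k c) k M)
  (∀I (⇒I (≤-resp (≐-sy (Clamped-at (wkᵀ k) (wkᵀ c) x₀)) ≐-re (min-≤ (entᶜ · wkᵀ c · x₀) (wkᵀ k · x₀)))))

MissRefutes : Formula ℒ^Ω (𝟎 ∷ 𝟎 ∷ 𝟏 ∷ 𝟏 ∷ Γ)
MissRefutes = (¬ productᵗ · ValueAlong x₃ x₂ x₀ · su x₁ ≐ ze) ⇒ ¬ BoundedBar x₃ x₂ x₁

miss-refutes : (f k : Term ℒ^Ω Γ 𝟏) (M c : Term ℒ^Ω Γ 𝟎) → H ⊩ subst (ε ▸ f ▸ k ▸ M ▸ c) MissRefutes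
miss-refutes {Γ} = ∀E₄ MissRefutes (∀I (∀I (∀I (∀I (⇒I (⇒I (∃E hit
  (⇒E h₂ (product-zero (ValueAlong x₄ x₃ x₁) x₀ (su x₂) (su≤su (∧E₁ h₀)) zero-value)))))))))
  where
  hit : BoundedBar x₃ x₂ x₁ ∷ H ⊩ ∃[ 𝟎 ] x₀ ≤ x₂ ∧ x₄ · (barᶜ · (entᶜ · (barᶜ · Clamped x₃ x₁ · x₂)) · x₀) ≐ ze
  -- The number `c` need not be a code below the bound; its clamped sequence, coded anew at length
  -- `M`, is one.
  hit = ⇒E (∀e h₀ (barᶜ · Clamped x₂ x₀ · x₁) refl) (clamped-below x₂ x₁ x₀)
  zero-value : (x₀ ≤ x₂ ∧ x₄ · (barᶜ · (entᶜ · (barᶜ · Clamped x₃ x₁ · x₂)) · x₀) ≐ ze) ∷ H ⊩ ValueAlong x₄ x₃ x₁ · x₀ ≐ ze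
  zero-value = ValueAlong-at x₄ x₃ x₁ x₀ ⟫ cong₁ x₄ (≐-sy (⇒E (bar-ent-bar (Clamped x₃ x₁) x₂ x₀) (∧E₁ h₀))) ⟫ ∧E₂ h₀

CodeBound : Formula ℒ^Ω (𝟎 ∷ 𝟎 ∷ 𝟏 ∷ Γ)
CodeBound = x₀ ≼ barᶜ · x₂ · x₁ ⇒ barᶜ · (entᶜ · x₀) · x₁ ≤ barᶜ · x₂ · x₁

-- The bound is for `c` recoded from its entries, which suffices for the search and avoids showing
-- that a number is the code of its own entries.
code-bound : (k : Term ℒ^Ω Γ 𝟏) (M c : Term ℒ^Ω Γ 𝟎) → H ⊩ subst (ε ▸ k ▸ M ▸ c) CodeBound
code-bound = ∀E₃ CodeBound (∀I (∀I (∀I (⇒I (⇒E (bar-mono (entᶜ · x₀) x₂ x₁)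
  (∀I (⇒I (below-elim x₁ x₃ x₂ x₀ h₁ h₀))))))))

clamped-code : (k : Term ℒ^Ω Γ 𝟏) (M c i : Term ℒ^Ω Γ 𝟎) → H ⊩ c ≼ barᶜ · k · M → H ⊩ i < M →
  H ⊩ Clamped k (barᶜ · (entᶜ · c) · M) · i ≐ entᶜ · c · i
clamped-code {H = H} k M c i d p = Clamped-at k (barᶜ · (entᶜ · c) · M) i
  ⟫ min-≡ (≤-resp (≐-sy recoded) ≐-re (below-elim c k M i d p)) ⟫ recoded
  where
  recoded : H ⊩ entᶜ · (barᶜ · (entᶜ · c) · M) · i ≐ entᶜ · c · i
  recoded = entᶜ-barᶜ (entᶜ · c) M i p

BarClamped : Formula ℒ^Ω (𝟎 ∷ 𝟎 ∷ 𝟎 ∷ 𝟏 ∷ Γ)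
BarClamped = x₁ ≼ barᶜ · x₃ · x₂ ⇒ x₀ ≤ x₂ ⇒
  barᶜ · Clamped x₃ (barᶜ · (entᶜ · x₁) · x₂) · x₀ ≐ barᶜ · (entᶜ · x₁) · x₀

bar-clamped : (k : Term ℒ^Ω Γ 𝟏) (M c x : Term ℒ^Ω Γ 𝟎) → H ⊩ subst (ε ▸ k ▸ M ▸ c ▸ x) BarClamped
bar-clamped = ∀E₄ BarClamped (∀I (∀I (∀I (∀I (⇒I (⇒I
  (⇒E (bar-cong (Clamped x₃ (barᶜ · (entᶜ · x₁) · x₂)) (entᶜ · x₁) x₀)
    (∀I (⇒I (clamped-code x₄ x₃ x₂ x₀ h₂ (≤-trans h₀ h₁)))))))))))

HitOf : Formula ℒ^Ω (𝟎 ∷ 𝟎 ∷ 𝟏 ∷ 𝟏 ∷ Γ)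
HitOf = x₀ ≼ barᶜ · x₂ · x₁ ⇒ productᵗ · ValueAlong x₃ x₂ (barᶜ · (entᶜ · x₀) · x₁) · su x₁ ≐ ze
  ⇒ (∃[ 𝟎 ] x₀ ≤ x₂ ∧ x₄ · (barᶜ · (entᶜ · x₁) · x₀) ≐ ze)

hit-of : (f k : Term ℒ^Ω Γ 𝟏) (M c : Term ℒ^Ω Γ 𝟎) → H ⊩ subst (ε ▸ f ▸ k ▸ M ▸ c) HitOf
hit-of = ∀E₄ HitOf (∀I (∀I (∀I (∀I (⇒I (⇒I
  (∃E (⇒E (product-zero⁻¹ (ValueAlong x₃ x₂ (barᶜ · (entᶜ · x₀) · x₁)) (su x₁)) h₀)
    (cut (su≤su⁻¹ (∧E₁ h₀)) (∃I x₀ (∧I h₀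
      (cong₁ x₄ (≐-sy (⇒E (⇒E (bar-clamped x₃ x₂ x₁ x₀) h₃) h₀))
        ⟫ ≐-sy (ValueAlong-at x₄ x₃ (barᶜ · (entᶜ · x₁) · x₂) x₀) ⟫ ∧E₂ h₁)))))))))))

BoundedIfNonzero : Formula ℒ^Ω (𝟎 ∷ 𝟏 ∷ 𝟏 ∷ Γ)
BoundedIfNonzero = (¬ Unbounded x₂ x₁ x₀ ≐ ze) ⇒ BoundedBar x₂ x₁ x₀

UnboundedIfZero : Formula ℒ^Ω (𝟎 ∷ 𝟏 ∷ 𝟏 ∷ Γ)
UnboundedIfZero = Unbounded x₂ x₁ x₀ ≐ ze ⇒ ¬ BoundedBar x₂ x₁ x₀

miss-zero : (f k : Term ℒ^Ω Γ 𝟏) (M c : Term ℒ^Ω Γ 𝟎) → H ⊩ Misses f k M · c ≐ ze →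
  H ⊩ ¬ productᵗ · ValueAlong f k c · su M ≐ ze
miss-zero f k M c d = ⇒I (su≢ze (Misses-at f k M c ⟫ 1∸ze h₀) (↑ d))

unbounded-if-zero : (f k : Term ℒ^Ω Γ 𝟏) (M : Term ℒ^Ω Γ 𝟎) → H ⊩ subst (ε ▸ f ▸ k ▸ M) UnboundedIfZero
unbounded-if-zero = ∀E₃ UnboundedIfZero (∀I (∀I (∀I (⇒I
  (∃E (⇒E (product-zero⁻¹ (Misses x₂ x₁ x₀) (su (barᶜ · x₁ · x₀))) h₀)
    (⇒E (miss-refutes x₃ x₂ x₁ x₀) (miss-zero x₃ x₂ x₁ x₀ (∧E₂ h₀))))))))

miss-hits : (f k : Term ℒ^Ω Γ 𝟏) (M c : Term ℒ^Ω Γ 𝟎) → H ⊩ ¬ Unbounded f k M ≐ ze → H ⊩ c ≤ barᶜ · k · M →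
  H ⊩ productᵗ · ValueAlong f k c · su M ≐ ze
miss-hits f k M c d p = 1∸≢ze⁻¹ (⇒I (⇒E (↑ d) (product-zero (Misses f k M) c (su (barᶜ · k · M)) (su≤su (↑ p))
  (Misses-at f k M c ⟫ h₀))))

bounded-if-nonzero : (f k : Term ℒ^Ω Γ 𝟏) (M : Term ℒ^Ω Γ 𝟎) → H ⊩ subst (ε ▸ f ▸ k ▸ M) BoundedIfNonzero
bounded-if-nonzero = ∀E₃ BoundedIfNonzero (∀I (∀I (∀I (⇒I (∀I (⇒I
  (⇒E (⇒E (hit-of x₃ x₂ x₁ x₀) h₀)
    (miss-hits x₃ x₂ x₁ (barᶜ · (entᶜ · x₀) · x₁) h₁ (⇒E (code-bound x₂ x₁ x₀) h₀)))))))))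

unboundedᵗ : Term ℒ^Ω Γ (𝟏 ⟶ 𝟏 ⟶ 𝟎 ⟶ 𝟎)
unboundedᵗ = ƛ (ƛ (ƛ (Unbounded x₂ x₁ x₀)))

unbounded-at : (f k : Term ℒ^Ω Γ 𝟏) (M : Term ℒ^Ω Γ 𝟎) → H ⊩ unboundedᵗ · f · k · M ≐ Unbounded f k M
unbounded-at f k M = β₃ ε f k M (Unbounded x₂ x₁ x₀)

Decides : Formula ℒ^Ω ((𝟏 ⟶ 𝟏 ⟶ 𝟎 ⟶ 𝟎) ∷ Γ)
Decides = ∀[ 𝟏 ] ∀[ 𝟏 ] ∀[ 𝟎 ] x₃ · x₂ · x₁ · x₀ ≐ ze ⇔ ¬ BoundedBar x₂ x₁ x₀

refutes : H ⊩ unboundedᵗ · x₂ · x₁ · x₀ ≐ ze ⇒ ¬ BoundedBar x₂ x₁ x₀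
refutes = ⇒I (⇒E (unbounded-if-zero x₂ x₁ x₀) (≐-sy (unbounded-at x₂ x₁ x₀) ⟫ h₀))

vanishes : H ⊩ (¬ BoundedBar x₂ x₁ x₀) ⇒ unboundedᵗ · x₂ · x₁ · x₀ ≐ ze
vanishes = ⇒I (unbounded-at x₂ x₁ x₀ ⟫ raa (⇒E h₁ (⇒E (bounded-if-nonzero x₂ x₁ x₀) h₀)))

-- As an existential statement, so that the formulas below contain a variable where the large term
-- `unboundedᵗ` would stand.
decider : H ⊩ ∃ˢᵗ[ 𝟏 ⟶ 𝟏 ⟶ 𝟎 ⟶ 𝟎 ] Decides
decider = ∃I unboundedᵗ (∧I (axᵒ (st-clo unboundedᵗ)) (∀I (∀I (∀I (∧I refutes vanishes)))))

-- Functions that depend on the length only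

lengthValue : Term ℒ^Ω (𝟎 ∷ 𝟏 ∷ 𝟏 ∷ []) 𝟎
lengthValue = x₂ · (barᶜ · x₁ · (lhᶜ · x₀))

LengthValue : Term ℒ^Ω Γ 𝟏 → Term ℒ^Ω Γ 𝟏 → Term ℒ^Ω Γ 𝟏
LengthValue f g = substᵀ (ε ▸ f ▸ g) (ƛ lengthValue)

-- Along every `g′` the values are those of `f` along `g`. So a single zero of `f` along `g` makes
-- this function a bar, and a hit on any code reveals such a zero.
LengthValue-bar : (f g g′ : Term ℒ^Ω Γ 𝟏) (x : Term ℒ^Ω Γ 𝟎) →
  H ⊩ LengthValue f g · (barᶜ · g′ · x) ≐ f · (barᶜ · g · x)
LengthValue-bar f g g′ x = β (ε ▸ f ▸ g) (barᶜ · g′ · x) lengthValue ⟫ cong₁ f (cong₁ (barᶜ · g) (lhᶜ-barᶜ g′ x))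

st-LengthValue : {f g : Term ℒ^Ω Γ 𝟏} → H ⊩ st f → H ⊩ st g → H ⊩ st (LengthValue f g)
st-LengthValue {f = f} {g} d e = st-substᵀ {s = ε ▸ f ▸ g} (ƛ lengthValue)
  λ { (here refl) → e ; (there (here refl)) → d }

LengthBar : Formula ℒ^Ω (𝟏 ∷ 𝟏 ∷ Γ)
LengthBar = (∃[ 𝟎 ] x₂ · (barᶜ · x₁ · x₀) ≐ ze) ⇒ Bar (LengthValue x₁ x₀)

length-bar : (f g : Term ℒ^Ω Γ 𝟏) → H ⊩ subst (ε ▸ f ▸ g) LengthBar
length-bar = ∀E₂ LengthBar (∀I (∀I (⇒I (∃E h₀ (∀I (∃I x₁ (LengthValue-bar x₃ x₂ x₀ x₁ ⟫ h₀)))))))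

LengthHit : Formula ℒ^Ω (𝟎 ∷ 𝟏 ∷ 𝟏 ∷ 𝟏 ∷ Γ)
LengthHit = BoundedBar (LengthValue x₃ x₂) x₁ x₀ ⇒ (∃[ 𝟎 ] x₀ ≤ x₁ ∧ x₄ · (barᶜ · x₃ · x₀) ≐ ze)

length-hit : (f g k : Term ℒ^Ω Γ 𝟏) (m : Term ℒ^Ω Γ 𝟎) → H ⊩ subst (ε ▸ f ▸ g ▸ k ▸ m) LengthHit
length-hit = ∀E₄ LengthHit (∀I (∀I (∀I (∀I (⇒I
  -- Any code below the bound would do; the segment of `k` itself is one.
  (∃E (⇒E (∀e h₀ (barᶜ · x₁ · x₀) refl) (⇒E (below-intro x₁ x₁ x₀) (∀I (⇒I (≤-refl (x₂ · x₀))))))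
    (∃I x₀ (∧I (∧E₁ h₀) (≐-sy (LengthValue-bar x₄ x₃ (entᶜ · (barᶜ · x₂ · x₁)) x₀) ⟫ ∧E₂ h₀)))))))))

UnboundedPath : Formula ℒ^Ω (𝟎 ∷ 𝟏 ∷ 𝟏 ∷ Γ)
UnboundedPath = st x₁ ⇒ (¬ st x₀) ⇒ (¬ BoundedBar x₂ x₁ x₀) ⇒ Path x₂

-- The code that refutes `BoundedBar` has a standard part. A zero of `f` along it at a standard
-- position would also be a hit on the code, at a position below `M`.
unbounded-path : (f k : Term ℒ^Ω Γ 𝟏) (M : Term ℒ^Ω Γ 𝟎) → H ⊩ subst (ε ▸ f ▸ k ▸ M) UnboundedPath
unbounded-path = ∀E₃ UnboundedPath (∀I (∀I (∀I (⇒I (⇒I (⇒I (raa (⇒E h₁ (∀I (⇒I (raa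
  (⇒E h₂ (∃E (⇒E (⇒E (⇒E (standard-path x₂ x₁ x₀) h₅) h₄) h₁)
    (∃I x₀ (∧I (∧E₁ h₀) (∀I (⇒I (⇒I (⇒E h₃
      (∃I x₀ (∧I (<⇒≤ (st-<Ω h₁ h₇)) (cong₁ x₅ (≐-sy (⇒E (⇒E (bar-agree x₁ (entᶜ · x₂) x₀) (∧E₂ h₂)) h₁)) ⟫ h₀))))))))))))))))))))))

-- What the converse direction needs of the decider U and of Φ

Agrees : Formula ℒ^Ω ((𝟏 ⟶ 𝟏) ∷ (𝟏 ⟶ 𝟏 ⟶ 𝟎 ⟶ 𝟎) ∷ Γ)
Agrees = ∀ˢᵗ[ 𝟏 ] ∀[ 𝟎 ] ¬ st x₀ ⇒ (x₃ · x₁ · (x₂ · x₁) · x₀ ≐ ze ⇔ ¬ Bar x₁)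

ZeroPath : Formula ℒ^Ω ((𝟏 ⟶ 𝟏 ⟶ 𝟎 ⟶ 𝟎) ∷ Γ)
ZeroPath = ∀[ 𝟏 ] ∀[ 𝟏 ] ∀[ 𝟎 ] st x₁ ⇒ (¬ st x₀) ⇒ x₃ · x₂ · x₁ · x₀ ≐ ze ⇒ Path x₂

NonzeroHit : Formula ℒ^Ω ((𝟏 ⟶ 𝟏 ⟶ 𝟎 ⟶ 𝟎) ∷ Γ)
NonzeroHit = ∀[ 𝟏 ] ∀[ 𝟏 ] ∀[ 𝟏 ] ∀[ 𝟎 ] (¬ x₄ · LengthValue x₃ x₂ · x₁ · x₀ ≐ ze)
  ⇒ (∃[ 𝟎 ] x₀ ≤ x₁ ∧ x₄ · (barᶜ · x₃ · x₀) ≐ ze)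

zero-path : Decides ∷ H ⊩ ZeroPath
zero-path = ∀I (∀I (∀I (⇒I (⇒I (⇒I (⇒E (⇒E (⇒E (unbounded-path x₂ x₁ x₀) h₂) h₁)
  (⇒E (∧E₁ (∀e (∀e (∀e h₃ x₂ refl) x₁ refl) x₀ refl)) h₀)))))))

nonzero-hit : Decides ∷ H ⊩ NonzeroHit
nonzero-hit = ∀I (∀I (∀I (∀I (⇒I (⇒E (length-hit x₃ x₂ x₁ x₀) (raa (⇒E h₁
  (⇒E (∧E₂ (∀e (∀e (∀e h₂ (LengthValue x₃ x₂) refl) x₁ refl) x₀ refl)) h₀))))))))

RBBody : Formula ℒ^Ω ((𝟏 ⟶ 𝟏) ∷ Γ)
RBBody = ∀ˢᵗ[ 𝟏 ] ∀[ 𝟎 ] ¬ st x₀ ⇒ (BoundedBar x₁ (x₂ · x₁) x₀ ⇔ Bar x₁)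

iff-trans-¬ : H ⊩ A ⇔ ¬ B → H ⊩ B ⇔ C → H ⊩ A ⇔ ¬ C
iff-trans-¬ d e = ∧I
  (⇒I (⇒I (⇒E (⇒E (∧E₁ (↑ ↑ d)) h₁) (⇒E (∧E₂ (↑ ↑ e)) h₀))))
  (⇒I (⇒E (∧E₂ (↑ d)) (⇒I (⇒E h₁ (⇒E (∧E₁ (↑ ↑ e)) h₀)))))

agrees : RBBody ∷ wk Decides ∷ H ⊩ Agrees
agrees = ∀I (⇒I (∀I (⇒I (iff-trans-¬ (∀e (∀e (∀e h₃ x₁ refl) (x₂ · x₁) refl) x₀ refl)
  (⇒E (∀e (⇒E (∀e h₂ x₁ refl) h₁) x₀ refl) h₀)))))

complement : Term ℒ^Ω (𝟎 ∷ 𝟏 ∷ []) 𝟎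
complement = one ∸ x₁ · x₀

Complement : Term ℒ^Ω Γ 𝟏 → Term ℒ^Ω Γ 𝟏
Complement P = substᵀ (ε ▸ P) (ƛ complement)

Complement-at : (P : Term ℒ^Ω Γ 𝟏) (n : Term ℒ^Ω Γ 𝟎) → H ⊩ Complement P · n ≐ one ∸ P · n
Complement-at P n = β (ε ▸ P) n complement

-- Internal, as `Bar` ranges over all `g`, so HAC-int applies. It is also preserved when `m` grows,
-- so an upper bound of a list of candidates is as good as the right candidate.
Settled : Formula ℒ^Ω (𝟎 ∷ 𝟏 ∷ (𝟏 ⟶ 𝟏) ∷ (𝟏 ⟶ 𝟏 ⟶ 𝟎 ⟶ 𝟎) ∷ Γ)
Settled = ∀[ 𝟎 ] x₁ ≤ x₀ ⇒ (x₄ · x₂ · (x₃ · x₂) · x₀ ≐ ze ⇔ ¬ Bar x₂)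

agrees-at : (¬ st x₀) ∷ B ∷ st x₁ ∷ wk (wk Agrees) ∷ H ⊩ x₃ · x₁ · (x₂ · x₁) · x₀ ≐ ze ⇔ ¬ Bar x₁
agrees-at = ⇒E (∀e (⇒E (∀e h₃ x₁ refl) h₂) x₀ refl) h₀

-- For a bar the decider is nonzero at all nonstandard arguments, while `underspill` is about
-- vanishing; hence the complement.
settled-bar : Bar x₀ ∷ st x₀ ∷ wk Agrees ∷ H ⊩ ∃ˢᵗ[ 𝟎 ] Settled
settled-bar = ∃E (⇒E (underspill (Complement (x₂ · x₀ · (x₁ · x₀))))
    (∀I (⇒I (Complement-at (x₃ · x₁ · (x₂ · x₁)) x₀ ⟫ ≢ze⇒1∸ (⇒I (⇒E (⇒E (∧E₁ (↑ agrees-at)) h₀) h₂))))))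
  (∃I x₀ (∧I (∧E₁ h₀) (∀I (⇒I (∧I
    (⇒I (su≢ze (Complement-at (x₄ · x₂ · (x₃ · x₂)) x₀ ⟫ 1∸ze h₀) (⇒E (∀e (∧E₂ h₂) x₀ refl) h₁)))
    (⇒I (absurd h₀ h₃)))))))

settled-no-bar : (¬ Bar x₀) ∷ st x₀ ∷ wk Agrees ∷ H ⊩ ∃ˢᵗ[ 𝟎 ] Settled
settled-no-bar = ∃E (⇒E (underspill (x₂ · x₀ · (x₁ · x₀))) (∀I (⇒I (⇒E (∧E₂ agrees-at) h₁))))
  (∃I x₀ (∧I (∧E₁ h₀) (∀I (⇒I (∧I (⇒I h₃) (⇒I (⇒E (∀e (∧E₂ h₂) x₀ refl) h₁)))))))

settled : Agrees ∷ H ⊩ ∀ˢᵗ[ 𝟏 ] ∃ˢᵗ[ 𝟎 ] Settled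
settled = ∀I (⇒I (cases (Bar x₀) settled-bar settled-no-bar))

-- The Suslin functional obtained from U, Φ and the bounds Ψ

Correct : Formula ℒ^Ω ((𝟏 ⟶ 𝟎 ✶) ∷ (𝟏 ⟶ 𝟏) ∷ (𝟏 ⟶ 𝟏 ⟶ 𝟎 ⟶ 𝟎) ∷ Γ)
Correct = ∀ˢᵗ[ 𝟏 ] x₃ · x₀ · (x₂ · x₀) · size (x₁ · x₀) ≐ ze ⇔ ¬ Bar x₀

correct : (∀ˢᵗ[ 𝟏 ] ∃[ 𝟎 ] x₀ ∈ˢ x₂ · x₁ ∧ (∀[ 𝟎 ] x₁ ≤ x₀ ⇒ (x₅ · x₂ · (x₄ · x₂) · x₀ ≐ ze ⇔ ¬ Bar x₂))) ∷ H ⊩ Correct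
correct = ∀I (⇒I (∃E (⇒E (∀e h₁ x₀ refl) h₀)
  (⇒E (∀e (∧E₂ h₀) (size (x₂ · x₁)) refl) (⇒E (size-bound (x₂ · x₁) x₀) (∧E₁ h₀)))))

-- The argument returns from the standard bound to some nonstandard `M`, because only there does a
-- refuting code have a standard part defined at all standard positions.
correct-path : Correct ∷ st x₁ ∷ wk (wk ZeroPath) ∷ wk Agrees ∷ H ⊩ ∀ˢᵗ[ 𝟏 ] (¬ Bar x₀) ⇒ Path x₀
correct-path = ∀I (⇒I (⇒I (∃E infinite-number
  (⇒E (⇒E (⇒E (∀e (∀e (∀e h₅ x₁ refl) (x₃ · x₁) refl) x₀ refl) (st-· h₄ h₂)) h₀)
    (⇒E (∧E₂ (⇒E (∀e (⇒E (∀e h₆ x₁ refl) h₂) x₀ refl) h₀)) h₁)))))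

path-hit : (st x₀ ∧ (∀ˢᵗ[ 𝟎 ] ¬ x₂ · (barᶜ · x₁ · x₀) ≐ ze)) ∷ Bar x₁ ∷ B ∷ st x₁ ∷ wk (wk Correct) ∷ C ∷ D ∷ wk (wk (wk (wk NonzeroHit))) ∷ H ⊩
  ∃[ 𝟎 ] x₀ ≤ size (x₃ · LengthValue x₂ x₁) ∧ x₂ · (barᶜ · x₁ · x₀) ≐ ze
path-hit = ⇒E (∀e (∀e (∀e (∀e h₇ x₁ refl) x₀ refl) (x₃ · LengthValue x₁ x₀) refl) (size (x₂ · LengthValue x₁ x₀)) refl)
  (⇒I (⇒E (⇒E (∧E₁ (⇒E (∀e h₅ (LengthValue x₁ x₀) refl) (st-LengthValue h₄ (∧E₁ h₁)))) h₀)
    (⇒E (length-bar x₁ x₀) (∀e h₂ x₀ refl))))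

-- If `f` has a zero along the standard path `g`, then `LengthValue f g` is a standard bar. Its
-- decider is nonzero already at the standard bound given by the list, so `f` has a zero along `g`
-- below that bound, at a standard position, which a path excludes.
correct-no-bar : Correct ∷ st x₀ ∷ st x₁ ∷ wk (wk NonzeroHit) ∷ H ⊩ ∀ˢᵗ[ 𝟏 ] Path x₀ ⇒ ¬ Bar x₀
correct-no-bar = ∀I (⇒I (⇒I (⇒I (∃E h₁ (∃E path-hit
  (⇒E (⇒E (∀e (∧E₂ h₁) x₀ refl) (st-below (st-size (st-· h₆ (st-LengthValue h₄ (∧E₁ h₁)))) (∧E₁ h₀))) (∧E₂ h₀)))))))

suslinOf : Term ℒ^Ω (𝟏 ∷ (𝟏 ⟶ 𝟎 ✶) ∷ (𝟏 ⟶ 𝟏) ∷ (𝟏 ⟶ 𝟏 ⟶ 𝟎 ⟶ 𝟎) ∷ []) 𝟎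
suslinOf = x₃ · x₀ · (x₂ · x₀) · size (x₁ · x₀)

SuslinOf : Term ℒ^Ω Γ (𝟏 ⟶ 𝟏 ⟶ 𝟎 ⟶ 𝟎) → Term ℒ^Ω Γ (𝟏 ⟶ 𝟏) → Term ℒ^Ω Γ (𝟏 ⟶ 𝟎 ✶) → Term ℒ^Ω Γ 𝟐
SuslinOf U Φ Ψ = substᵀ (ε ▸ U ▸ Φ ▸ Ψ) (ƛ suslinOf)

SuslinOf-at : (U : Term ℒ^Ω Γ (𝟏 ⟶ 𝟏 ⟶ 𝟎 ⟶ 𝟎)) (Φ : Term ℒ^Ω Γ (𝟏 ⟶ 𝟏)) (Ψ : Term ℒ^Ω Γ (𝟏 ⟶ 𝟎 ✶)) (f : Term ℒ^Ω Γ 𝟏) →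
  H ⊩ SuslinOf U Φ Ψ · f ≐ U · f · (Φ · f) · size (Ψ · f)
SuslinOf-at U Φ Ψ f = β (ε ▸ U ▸ Φ ▸ Ψ) f suslinOf

S²-standard : Formula ℒ^Ω Γ
S²-standard = ∃ˢᵗ[ 𝟐 ] ∀ˢᵗ[ 𝟏 ] x₁ · x₀ ≐ ze ⇔ Path x₀

standard-suslin : Correct ∷ st x₀ ∷ st x₁ ∷ wk (wk NonzeroHit) ∷ wk (wk ZeroPath) ∷ wk Agrees ∷ st x₂ ∷ H ⊩ S²-standard
standard-suslin = cut correct-no-bar (cut (⇒E (⇒E (⇒E (⇒E (⇒I (⇒I (⇒I (⇒I correct-path)))) h₆) h₅) h₃) h₁)
  (∃I (SuslinOf x₂ x₁ x₀) (∧I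
    (st-substᵀ {s = ε ▸ x₂ ▸ x₁ ▸ x₀} (ƛ suslinOf)
      λ { (here refl) → h₃ ; (there (here refl)) → h₄ ; (there (there (here refl))) → hyp (there (there (there (there (there (there (there (there (here refl))))))))) })
    (∀I (⇒I (∧I
      (⇒I (⇒E (⇒E (∀e h₂ x₀ refl) h₁) (⇒E (∧E₁ (⇒E (∀e h₄ x₀ refl) h₁)) (≐-sy (SuslinOf-at x₃ x₂ x₁ x₀) ⟫ h₀))))
      (⇒I (SuslinOf-at x₃ x₂ x₁ x₀ ⟫ ⇒E (∧E₂ (⇒E (∀e h₄ x₀ refl) h₁)) (⇒E (⇒E (∀e h₃ x₀ refl) h₁) h₀)))))))))

suslin-of-agrees : Agrees ∷ st x₀ ∷ wk NonzeroHit ∷ wk ZeroPath ∷ st x₁ ∷ H ⊩ S²-standard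
suslin-of-agrees = ∃E (⇒E (axᵒ (HAC-int Settled _)) settled)
  (⇒E (⇒E (⇒E (⇒E (⇒E (⇒E (⇒E (⇒I (⇒I (⇒I (⇒I (⇒I (⇒I (⇒I standard-suslin))))))) h₅) h₁) h₄) h₃) h₂) (∧E₁ h₀))
    (⇒E (⇒I correct) (∧E₂ h₀)))

suslin-of-rb : (st x₀ ∧ RBBody) ∷ wk Decides ∷ wk NonzeroHit ∷ wk ZeroPath ∷ st x₁ ∷ H ⊩ S²-standard
suslin-of-rb = ⇒E (⇒E (⇒E (⇒E (⇒E (⇒I (⇒I (⇒I (⇒I (⇒I suslin-of-agrees))))) h₄) h₃) h₂) (∧E₁ h₀))
  (⇒E (⇒E (⇒I (⇒I agrees)) h₁) (∧E₂ h₀))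

suslin-of-decider : (st x₀ ∧ Decides) ∷ (∃ˢᵗ[ 𝟏 ⟶ 𝟏 ] RBBody) ∷ H ⊩ S²-standard
suslin-of-decider = cut (⇒E (⇒I zero-path) (∧E₂ h₀)) (cut (⇒E (⇒I nonzero-hit) (∧E₂ h₁)) (∃E h₃
  (⇒E (⇒E (⇒E (⇒E (⇒E (⇒I (⇒I (⇒I (⇒I (⇒I suslin-of-rb))))) (∧E₁ h₃)) h₂) h₁) (∧E₂ h₃)) h₀)))

RB⇒S²ˢᵗ : [] ⊩ RB ⇒ S² ˢᵗ
RB⇒S²ˢᵗ = ⇒I (⇒E (weaken (λ ()) S²ᶜ⇒S²) (cut (⇒E (weaken (λ ()) RB⇒RBᶜ) h₀) (∃E decider suslin-of-decider)))

theorem7p3 : (RCA₀^Ω ⊕ STP) ⊢ (S² ˢᵗ ⇔ RB)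
theorem7p3 = ∧I S²ˢᵗ⇒RB RB⇒S²ˢᵗ
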